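{- Let $\mathcal{G}(t;x,u,v,q,z)$ be the generating function of permutations defined by $$\mathcal{G}(t;x,u,v,q,z)=\sum_{n=1}^{\infty}t^n\sum_{\pi\in\mathfrak{S}_n}\frac{u^{\mathsf{des}(\pi)}x^{\mathsf{ides}(\pi)}q^{\mathsf{lmin}(\pi)}v^{\mathsf{rmax}(\pi)}z^{\mathsf{lmax}(\pi)}}{(1-u)^n(1-x)^n}.$$ Put $r=1-t$. Then $$\mathcal{G}(t;x,u,v,q,1)=\frac{vt}{1-x}\sum_{n=1}^{\infty}\frac{qx-1+(1-q)r^{n-1}}{x-r^n}\prod_{i=1}^{n-1}\frac{u(x-r^i-xvt)\big((1-qt)r^{i-1}-1\big)}{(r^{i}-1)(x-r^i)}$$ $$\times\left(1-\frac{ut(q-1)}{x-1}\sum_{n=1}^{\infty}\frac{(x-1-xv)r^{n-1}+xv}{r^n-1}\prod_{i=1}^{n-1}\frac{u(x-r^i-xvt)\big((1-qt)r^{i-1}-1\big)}{(r^{i}-1)(x-r^i)}\right)^{ -1}.$$ Furthermore, $$\mathcal{G}(t;x,u,v,q,1)=\mathcal{G}(t;x,u,q,v,1)=\mathcal{G}(t;u,x,q,v,1),$$ namely, for every $n\ge 1$ the quadruples $(\mathsf{des},\mathsf{ides},\mathsf{rmax},\mathsf{lmin})$, $(\mathsf{des},\mathsf{ides},\mathsf{lmin},\mathsf{rmax})$ and $(\mathsf{ides},\mathsf{des},\mathsf{rmax},\mathsf{lmin})$ are all equidistributed over $\mathfrak{S}_n$.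
   Context: $\mathfrak{S}_n$ is the set of permutations $\pi=\pi_1\pi_2\cdots\pi_n$ of $[n]=\{1,\dots,n\}$. $\mathsf{des}(\pi)=|\{i\in[n-1]:\pi_i>\pi_{i+1}\}|$ (descents); $\mathsf{ides}(\pi)=\mathsf{des}(\pi^{ -1})$; $\mathsf{lmax}(\pi)=|\{\pi_i:\pi_i>\pi_j\text{ for all }j<i\}|$ (left-to-right maxima); $\mathsf{lmin}(\pi)=|\{\pi_i:\pi_i<\pi_j\text{ for all }j<i\}|$ (left-to-right minima); $\mathsf{rmax}(\pi)=|\{\pi_i:\pi_i>\pi_j\text{ for all }j>i\}|$ (right-to-left maxima). Empty products equal $1$. Two tuples of statistics are equidistributed over a finite set if each tuple of values is attained by the same number of elements of the set. The formula is an identity of formal power series in $u$ whose coefficients are power series in $x$ and $t$ with coefficients polynomial in $v,q$: the $n$-th summand of each sum carries the factor $u^{n-1}$ coming from the product, $\frac{(1-qt)r^{i-1}-1}{r^i-1}$ and $\frac{t}{r^n-1}$ are read as power series in $t$ (common factor $t$ cancelled), and $\frac1{x-r^n}$, $\frac1{1-x}$, $\frac1{1-u}$ are expanded as power series. -}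

module Defs where

open import Algebra.Bundles using (RawRing)
import Algebra.Definitions.RawSemiring as RawSemiringDefs
open import Data.Fin.Base as Fin using (Fin; zero; suc; toℕ; inject₁)
open import Data.Fin.Permutation
  using (Permutation′; _⟨$⟩ʳ_; flip; insert; id)
open import Data.Fin.Properties using (all?; _<?_)
open import Data.List.Base as List
  using (List; []; _∷_; allFin; cartesianProductWith; filter; foldr; length)
open import Data.Nat.Base as ℕ using (ℕ; zero; suc; _∸_)
import Data.Nat.Properties as ℕ
open import Data.Product.Base using (_×_)
open import Data.Product.Properties using (≡-dec)
open import Data.Rational.Base as ℚ using (ℚ; 0ℚ; 1ℚ; 1/_)
import Data.Rational.Properties as ℚ
open import Function.Base using (_∘_)
open import Level using (Level; 0ℓ)
open import Relation.Binary.Definitions using (DecidableEquality)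
open import Relation.Binary.PropositionalEquality using (_≡_)
open import Relation.Nullary.Decidable using (yes; no; _→-dec_)
open import Relation.Unary using (Pred; Decidable)

private
  variable
    c ℓ : Level
    n   : ℕ

-- A permutation is a map on positions: π i is π ⟨$⟩ʳ i, with positions and
-- values numbered from 0, and π⁻¹ is flip π.
--
-- Every permutation of Fin (suc n) is, up to pointwise equality, uniquely
-- insert zero j π, where j is the image of zero (cf. insert-remove and
-- remove-insert); so each element of 𝔖ₙ is listed exactly once.
permutations : ∀ n → List (Permutation′ n)
permutations zero    = id ∷ []
permutations (suc n) =
  cartesianProductWith (insert zero) (allFin (suc n)) (permutations n)

count : {P : Pred (Fin n) 0ℓ} → Decidable P → ℕ
count P? = length (filter P? (allFin _))

des : Permutation′ n → ℕ
des {zero}  π = 0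
des {suc n} π = count (λ (i : Fin n) → π ⟨$⟩ʳ suc i <? π ⟨$⟩ʳ inject₁ i)

ides : Permutation′ n → ℕ
ides π = des (flip π)

-- The values π i in the definitions of lmax, lmin and rmax are distinct, so
-- they are counted through their positions i.

lmax : Permutation′ n → ℕ
lmax π = count λ i → all? λ j → (j <? i) →-dec (π ⟨$⟩ʳ j <? π ⟨$⟩ʳ i)

lmin : Permutation′ n → ℕ
lmin π = count λ i → all? λ j → (j <? i) →-dec (π ⟨$⟩ʳ i <? π ⟨$⟩ʳ j)

rmax : Permutation′ n → ℕ
rmax π = count λ i → all? λ j → (i <? j) →-dec (π ⟨$⟩ʳ j <? π ⟨$⟩ʳ i)

ℕ⁴ : Set
ℕ⁴ = ℕ × ℕ × ℕ × ℕ

_≟⁴_ : DecidableEquality ℕ⁴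
_≟⁴_ = ≡-dec ℕ._≟_ (≡-dec ℕ._≟_ (≡-dec ℕ._≟_ ℕ._≟_))

Equidistributed : ∀ n → (S T : Permutation′ n → ℕ⁴) → Set
Equidistributed n S T =
  ∀ k → attaining S k ≡ attaining T k
  where
  attaining : (Permutation′ n → ℕ⁴) → ℕ⁴ → ℕ
  attaining S k = length (filter (λ π → S π ≟⁴ k) (permutations n))

module _ (R : RawRing c ℓ) where
  open RawRing R
  open RawSemiringDefs rawSemiring using (sum)

  coeff : List Carrier → ℕ → Carrier
  coeff []       _       = 0#
  coeff (a ∷ _)  zero    = a
  coeff (_ ∷ as) (suc n) = coeff as n

  -- a₀ ∷ a₁ ∷ ⋯ stands for a₀ + a₁ X + ⋯; trailing zeros are immaterial.
  polynomials : RawRing c ℓ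
  polynomials = record
    { Carrier = List Carrier
    ; _≈_     = λ f g → ∀ n → coeff f n ≈ coeff g n
    ; _+_     = _+ₚ_
    ; _*_     = _*ₚ_
    ; -_      = List.map -_
    ; 0#      = []
    ; 1#      = 1# ∷ []
    }
    where
    _+ₚ_ : List Carrier → List Carrier → List Carrier
    []       +ₚ g        = g
    f        +ₚ []       = f
    (a ∷ as) +ₚ (b ∷ bs) = (a + b) ∷ (as +ₚ bs)

    _*ₚ_ : List Carrier → List Carrier → List Carrier
    []       *ₚ g = []
    (a ∷ as) *ₚ g = List.map (a *_) g +ₚ (0# ∷ (as *ₚ g))

  constₚ : Carrier → List Carrier
  constₚ a = a ∷ []

  varₚ : List Carrier
  varₚ = 0# ∷ 1# ∷ []

  constₛ : Carrier → (ℕ → Carrier)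
  constₛ a zero    = a
  constₛ a (suc _) = 0#

  varₛ : ℕ → Carrier
  varₛ zero          = 0#
  varₛ (suc zero)    = 1#
  varₛ (suc (suc _)) = 0#

  powerSeries : RawRing c ℓ
  powerSeries = record
    { Carrier = ℕ → Carrier
    ; _≈_     = λ f g → ∀ n → f n ≈ g n
    ; _+_     = λ f g n → f n + g n
    ; _*_     = λ f g n →
                  sum {n = suc n} (λ k → f (toℕ k) * g (n ∸ toℕ k))
    ; -_      = λ f n → - f n
    ; 0#      = λ _ → 0#
    ; 1#      = constₛ 1#
    }

-- The ring ℚ[q][v]⟦t⟧⟦x⟧⟦u⟧: the coefficient of uᵏ xʲ tⁱ in f is f k j i.

ℚ[q] ℚ[q,v] ℚ[q,v]⟦t⟧ ℚ[q,v]⟦t,x⟧ ℚ[q,v]⟦t,x,u⟧ : RawRing 0ℓ 0ℓ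
ℚ[q]           = polynomials ℚ.+-*-rawRing
ℚ[q,v]         = polynomials ℚ[q]
ℚ[q,v]⟦t⟧      = powerSeries ℚ[q,v]
ℚ[q,v]⟦t,x⟧    = powerSeries ℚ[q,v]⟦t⟧
ℚ[q,v]⟦t,x,u⟧  = powerSeries ℚ[q,v]⟦t,x⟧

open RawRing ℚ[q,v]⟦t,x,u⟧ public
  using (_≈_; _+_; _*_; -_; 0#; 1#)
  renaming (Carrier to Series)

open RawSemiringDefs (RawRing.rawSemiring ℚ[q,v]⟦t,x,u⟧) public
  using (_^_; product)

infixl 6 _-_
_-_ : Series → Series → Series
f - g = f + (- g)

embed : RawRing.Carrier ℚ[q,v] → Series
embed = constₛ ℚ[q,v]⟦t,x⟧ ∘ constₛ ℚ[q,v]⟦t⟧ ∘ constₛ ℚ[q,v]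

scalar : ℚ → Series
scalar = embed ∘ constₚ ℚ[q] ∘ constₚ ℚ.+-*-rawRing

-- ∏[ n ] f = f 1 * f 2 * ⋯ * f (n - 1)
∏[_] : ℕ → (ℕ → Series) → Series
∏[ n ] f = product {n = n ∸ 1} (λ i → f (suc (toℕ i)))

-- The sum of f 0, f 1, f 2, … for a family in which every term of f k has
-- total degree at least k in t, x, u: only f 0, …, f d then contribute to a
-- coefficient of total degree d.
∑∞ : (ℕ → Series) → Series
∑∞ f k j i =
  sum {n = suc (k ℕ.+ j ℕ.+ i)} (λ m → f (toℕ m) k j i)
  where open RawSemiringDefs (RawRing.rawSemiring ℚ[q,v]) using (sum)

∑ₙ≥₁ : (ℕ → Series) → Series
∑ₙ≥₁ f = ∑∞ (λ m → f (suc m))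

∑𝔖 : ∀ n → (Permutation′ n → Series) → Series
∑𝔖 n f = foldr (λ π s → f π + s) 0# (permutations n)

-- A series is invertible exactly when its constant coefficient is a nonzero
-- rational a, and then its inverse is a⁻¹ ∑ₖ (1 - a⁻¹ f)ᵏ.  The value on
-- other series is irrelevant.

inverseℚ : ℚ → ℚ
inverseℚ a with a ℚ.≟ 0ℚ
... | yes _   = 0ℚ
... | no  a≢0 = 1/_ a {{ℚ.≢-nonZero a≢0}}

constantTerm : Series → ℚ
constantTerm f = coeff ℚ.+-*-rawRing (coeff ℚ[q] (f 0 0 0) 0) 0

inverse : Series → Series
inverse f = b * ∑∞ (λ k → (1# - b * f) ^ k)
  where
  b : Series
  b = scalar (inverseℚ (constantTerm f))

infixl 7 _/_ _/ₜ_
_/_ : Series → Series → Series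
f / g = f * inverse g

-- f / t for f divisible by t
divideByT : Series → Series
divideByT f k j i = f k j (suc i)

-- The quotient f / g of two multiples of t, computed as (f / t) / (g / t).
_/ₜ_ : Series → Series → Series
f /ₜ g = divideByT f / divideByT g

𝓖 : (t x u v q z : Series) → Series
𝓖 t x u v q z = ∑ₙ≥₁ λ n → t ^ n * ∑𝔖 n λ π →
  u ^ des π * x ^ ides π * q ^ lmin π * v ^ rmax π * z ^ lmax π
    / ((1# - u) ^ n * (1# - x) ^ n)

t x u v q r : Series
t = constₛ ℚ[q,v]⟦t,x⟧ (constₛ ℚ[q,v]⟦t⟧ (varₛ ℚ[q,v]))
x = constₛ ℚ[q,v]⟦t,x⟧ (varₛ ℚ[q,v]⟦t⟧)
u = varₛ ℚ[q,v]⟦t,x⟧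
v = embed (varₚ ℚ[q])
q = embed (constₚ ℚ[q] (varₚ ℚ.+-*-rawRing))
r = 1# - t

factor : ℕ → Series
factor i =
  u * (x - r ^ i - x * v * t)
    * (((1# - q * t) * r ^ (i ∸ 1) - 1#) /ₜ (r ^ i - 1#))
    / (x - r ^ i)

{-# OPTIONS --safe #-}

-- The symmetries come from the inversion and the reverse-complement of
-- permutations, so the point is the formula.
--
-- Modulo xᴹ, x^ides(π)/(1-x)ⁿ is the sum of x^max(w) over the words w with
-- letters < M whose standardisation is π, and des, lmin and rmax can be read
-- off w.  Likewise u^des(w)/(1-u)ⁿ counts the ways to cut w into weakly
-- increasing rows.  Reading w from right to left and writing q = 1 + (q - 1)
-- at each left-to-right minimum, one only has to remember the number d of
-- columns reached so far and the number c of columns that have become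
-- forbidden.  With r = 1 - t, adding all possible rows maps the final weight
-- x^d y^(d-c) to a linear combination of x^d (y/r)^(d-c) and x^d.  Hence the
-- generating functions pᵢ with final weight x^d r^(-i(d-c)) satisfy
--   pᵢ = 1 + factorᵢ₊₁ pᵢ₊₁ + βᵢ p₀,
-- where βᵢ contains the i-th term of the second sum; p₀ is then a quotient of
-- two sums, and (1-u) p₀ = 1 + u x 𝓖.
--
-- All of this takes place in the rings of series modulo terms of total degree
-- ≥ D, in which the sums are finite and t, u, x are nilpotent.

module Submission where

open import Algebra.Bundles using (CommutativeRing; RawRing; Semiring)
import Algebra.Construct.Pointwise as Pointwise
import Algebra.Definitions.RawSemiring as RawSemiringDefs
import Algebra.Morphism.RingMonomorphism as RingMonomorphism
open import Algebra.Morphism.Structures using (IsRingMonomorphism)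
import Algebra.Properties.CommutativeMonoid.Sum as MonoidSum
import Algebra.Properties.CommutativeSemigroup as CommutativeSemigroupProperties
import Algebra.Properties.Monoid.Mult.TCOptimised as MultTC
import Algebra.Properties.Ring as RingProperties
import Algebra.Properties.Semiring.Exp as SemiringExp
import Algebra.Properties.Semiring.Mult as SemiringMult
import Algebra.Properties.Semiring.Sum as SemiringSum
import Algebra.Solver.Ring as RingSolver
open import Algebra.Solver.Ring.AlmostCommutativeRing using (_-Raw-AlmostCommutative⟶_; fromCommutativeRing)
open import Algebra.Structures using (IsCommutativeRing)
open import Data.Bool.Base using (false; if_then_else_; true)
open import Data.Fin.Base as Fin using (Fin; fromℕ; inject₁; opposite; punchIn; suc; toℕ; zero)
open import Data.Fin.Permutation as Perm using (Permutation; Permutation′; _∘ₚ_; _⟨$⟩ʳ_; _⟨$⟩ˡ_; flip; insert; remove; reverse)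
open import Data.Fin.Properties as Fin using (_<?_; all?)
open import Data.Integer.Base as ℤ using (ℤ)
import Data.Integer.Properties as ℤ
open import Data.List.Base as List using (List; []; _∷_; cartesianProductWith; filter; foldr; length)
open import Data.Maybe.Base as Maybe using (Maybe)
open import Data.Nat.Base as ℕ using (_<_; _∸_; _≤_; _⊓_; _⊔_; suc; s≤s; zero; z≤n; ℕ)
open import Data.Nat.Properties as ℕ using (_≤?_)
open import Data.Product.Base using (_,_; _×_; proj₁; proj₂; ∃)
open import Data.Rational.Base as ℚ using (0ℚ; 1ℚ; ℚ)
import Data.Rational.Properties as ℚ
import Data.Sign.Base as Sign
open import Data.Sum.Base using (_⊎_; inj₁; inj₂)
open import Data.Unit.Base using (tt; ⊤)
open import Data.Vec.Functional as Vector using (insertAt)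
import Data.Vec.Functional.Properties as Vector
open import Function.Base using (_∘_)
open import Function.Bundles using (Equivalence; _⇔_; mk⇔)
open import Level using (0ℓ; Level)
open import Relation.Binary.Definitions using (tri<; tri>; tri≈)
open import Relation.Binary.PropositionalEquality as ≡ using (_≗_; _≡_; _≢_)
import Relation.Binary.Reasoning.Setoid as SetoidReasoning
open import Relation.Binary.Structures using (IsEquivalence)
open import Relation.Nullary.Decidable using (Dec; _×-dec_; _→-dec_; dec-false; dec-true; dec⇒maybe; does; does-⇔; no; proof; yes)
open import Relation.Nullary.Negation using (contradiction)
open import Relation.Nullary.Reflects using (ofʸ; ofⁿ)
open import Relation.Unary using (Decidable; Pred)
import Defs as 𝔻
open import Defs using (Equidistributed; _≟⁴_; coeff; constₛ; count; des; ides; lmax; lmin; permutations; polynomials; powerSeries; rmax; varₛ; ℕ⁴)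

-- Whether a letter is a left-to-right minimum depends on letters not yet read; the splitting
-- `q = 1 + (q - 1)` turns this into a promise about them, and only the strongest promise, `c`, has
-- to be remembered. A row may repeat each of the `d - c` columns between `c` and `d` freely, each
-- with the geometric factor `1/r`: hence the passage from `y` to `y/r` and the powers of `r`.
-- Marking a letter resets `c`, so the exponent forgets where the row began; these contributions add
-- up to the multiple of `x^d`, that is, to the term in `p₀`. Two divisions are delicate. `rⁱ - 1`
-- is a multiple of `t`, so `1 - r^(-i)` has no inverse; the quotient of `rⁱ - 1` by `t` has
-- constant term `-i` and is invertible over the rationals. And the identity obtained carries a
-- factor `u x`, which is nilpotent in every truncation; it is proved there with this factor, for
-- all `D`, and the factor is cancelled in the full ring.

-- A ring solver with integer coefficients

module IntegerSolver {c ℓ : Level} (R : CommutativeRing c ℓ) where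
  open CommutativeRing R
  open RingProperties ring
  open SetoidReasoning setoid
  open MultTC +-monoid using (1+×; ×-homo-+; ×ᵤ≈×) renaming (_×_ to _·_)
  open SemiringMult semiring using (×1-homo-*)

  -- With the optimised multiples `1 · 1#` is `1#` by definition, so the constants `:0` and `:1` of
  -- the solver match `0#` and `1#` without conversion.
  fromℤ : ℤ → Carrier
  fromℤ (ℤ.+ n)    = n · 1#
  fromℤ ℤ.-[1+ n ] = - (suc n · 1#)

  private
    ×-homo-* : ∀ m n → (m ℕ.* n) · 1# ≈ (m · 1#) * (n · 1#)
    ×-homo-* m n = begin
      (m ℕ.* n) · 1#        ≈⟨ ×ᵤ≈× (m ℕ.* n) 1# ⟨
      _                     ≈⟨ ×1-homo-* m n ⟩
      _                     ≈⟨ *-cong (×ᵤ≈× m 1#) (×ᵤ≈× n 1#) ⟩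
      (m · 1#) * (n · 1#)   ∎

    ◃⁺ : ∀ n → fromℤ (Sign.+ ℤ.◃ n) ≈ n · 1#
    ◃⁺ zero    = refl
    ◃⁺ (suc n) = refl

    ◃⁻ : ∀ n → fromℤ (Sign.- ℤ.◃ n) ≈ - (n · 1#)
    ◃⁻ zero    = sym -0#≈0#
    ◃⁻ (suc n) = refl

    cancel-suc : ∀ a b → (1# + a) - (1# + b) ≈ a - b
    cancel-suc a b = begin
      (1# + a) - (1# + b)       ≈⟨ +-cong (+-comm a 1#) (-‿+-comm 1# b) ⟨
      (a + 1#) + (- 1# + - b)   ≈⟨ +-assoc a 1# _ ⟩
      a + (1# + (- 1# + - b))   ≈⟨ +-congˡ (+-assoc 1# _ _) ⟨
      a + ((1# + - 1#) + - b)   ≈⟨ +-congˡ (+-congʳ (-‿inverseʳ 1#)) ⟩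
      a + (0# + - b)            ≈⟨ +-congˡ (+-identityˡ _) ⟩
      a - b                     ∎

    ⊖-homo : ∀ m n → fromℤ (m ℤ.⊖ n) ≈ m · 1# - n · 1#
    ⊖-homo zero zero       = sym (-‿inverseʳ 0#)
    ⊖-homo zero (suc n)    = sym (+-identityˡ _)
    ⊖-homo (suc m) zero    = sym (trans (+-congˡ -0#≈0#) (+-identityʳ _))
    ⊖-homo (suc m) (suc n) = begin
      fromℤ (suc m ℤ.⊖ suc n)         ≡⟨ ≡.cong fromℤ (ℤ.[1+m]⊖[1+n]≡m⊖n m n) ⟩
      fromℤ (m ℤ.⊖ n)                 ≈⟨ ⊖-homo m n ⟩
      m · 1# - n · 1#                 ≈⟨ cancel-suc _ _ ⟨
      (1# + m · 1#) - (1# + n · 1#)   ≈⟨ +-cong (1+× m 1#) (-‿cong (1+× n 1#)) ⟨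
      suc m · 1# - suc n · 1#         ∎

    +-homo : ∀ i j → fromℤ (i ℤ.+ j) ≈ fromℤ i + fromℤ j
    +-homo (ℤ.+ m) (ℤ.+ n)        = ×-homo-+ 1# m n
    +-homo (ℤ.+ m) ℤ.-[1+ n ]     = ⊖-homo m (suc n)
    +-homo ℤ.-[1+ m ] (ℤ.+ n)     = trans (⊖-homo n (suc m)) (+-comm _ _)
    +-homo ℤ.-[1+ m ] ℤ.-[1+ n ]  = begin
      - (suc (suc (m ℕ.+ n)) · 1#)      ≡⟨ ≡.cong (λ k → - (suc k · 1#)) (≡.sym (ℕ.+-suc m n)) ⟩
      - ((suc m ℕ.+ suc n) · 1#)        ≈⟨ -‿cong (×-homo-+ 1# (suc m) (suc n)) ⟩
      - (suc m · 1# + suc n · 1#)       ≈⟨ -‿+-comm _ _ ⟨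
      - (suc m · 1#) + - (suc n · 1#)   ∎

    *-homo : ∀ i j → fromℤ (i ℤ.* j) ≈ fromℤ i * fromℤ j
    *-homo (ℤ.+ m) (ℤ.+ n)       = trans (◃⁺ (m ℕ.* n)) (×-homo-* m n)
    *-homo (ℤ.+ m) ℤ.-[1+ n ]    = trans (◃⁻ (m ℕ.* suc n))
      (trans (-‿cong (×-homo-* m (suc n))) (-‿distribʳ-* _ _))
    *-homo ℤ.-[1+ m ] (ℤ.+ n)    = trans (◃⁻ (suc m ℕ.* n))
      (trans (-‿cong (×-homo-* (suc m) n)) (-‿distribˡ-* _ _))
    *-homo ℤ.-[1+ m ] ℤ.-[1+ n ] = begin
      fromℤ (Sign.+ ℤ.◃ (suc m ℕ.* suc n))   ≈⟨ ◃⁺ (suc m ℕ.* suc n) ⟩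
      (suc m ℕ.* suc n) · 1#                 ≈⟨ ×-homo-* (suc m) (suc n) ⟩
      (suc m · 1#) * (suc n · 1#)            ≈⟨ -‿involutive _ ⟨
      - (- ((suc m · 1#) * (suc n · 1#)))    ≈⟨ -‿cong (-‿distribʳ-* _ _) ⟩
      - ((suc m · 1#) * - (suc n · 1#))      ≈⟨ -‿distribˡ-* _ _ ⟩
      - (suc m · 1#) * - (suc n · 1#)        ∎

    neg-homo : ∀ i → fromℤ (ℤ.- i) ≈ - fromℤ i
    neg-homo (ℤ.+ zero)  = sym -0#≈0#
    neg-homo (ℤ.+ suc n) = refl
    neg-homo ℤ.-[1+ n ]  = sym (-‿involutive _)

  private
    morphism : ℤ.+-*-rawRing -Raw-AlmostCommutative⟶ fromCommutativeRing R
    morphism = record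
      { ⟦_⟧    = fromℤ
      ; +-homo = +-homo
      ; *-homo = *-homo
      ; -‿homo = neg-homo
      ; 0-homo = refl
      ; 1-homo = refl
      }

    coefficient≟ : ∀ i j → Maybe (fromℤ i ≈ fromℤ j)
    coefficient≟ i j = Maybe.map (λ i≡j → reflexive (≡.cong fromℤ i≡j)) (dec⇒maybe (i ℤ.≟ j))

  open RingSolver ℤ.+-*-rawRing (fromCommutativeRing R) morphism coefficient≟
    public using (Polynomial; solve; _:=_; _:+_; _:*_; _:-_; :-_; con)

  :0 :1 : ∀ {n} → Polynomial n
  :0 = con (ℤ.+ 0)
  :1 = con (ℤ.+ 1)

-- Words and the transfer operators on their states

module Words {c ℓ : Level} (R : CommutativeRing c ℓ) where
  open CommutativeRing R hiding (zero)
  open SemiringExp semiring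
  open SemiringSum semiring
  open SetoidReasoning setoid

  1^n≈1 : ∀ n → 1# ^ n ≈ 1#
  1^n≈1 zero    = refl
  1^n≈1 (suc n) = trans (*-identityˡ _) (1^n≈1 n)

  infixl 10 ∑<
  ∑< : ℕ → (ℕ → Carrier) → Carrier
  ∑< n f = sum {n} (λ i → f (toℕ i))

  ∑<-cong : ∀ n {f g : ℕ → Carrier} → (∀ i → i < n → f i ≈ g i) → ∑< n f ≈ ∑< n g
  ∑<-cong n f≈g = sum-cong-≋ (λ i → f≈g (toℕ i) (Fin.toℕ<n i))

  ∑<-last : ∀ n f → ∑< (suc n) f ≈ ∑< n f + f n
  ∑<-last zero    f = +-comm _ _
  ∑<-last (suc n) f = trans (+-congˡ (∑<-last n (f ∘ suc))) (sym (+-assoc _ _ _))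

  ∑-word : ∀ {m} n → ((Fin n → Fin m) → Carrier) → Carrier
  ∑-word zero    F = F (λ ())
  ∑-word (suc n) F = ∑[ a < _ ] ∑-word n (λ w → F (a Vector.∷ w))

  ∑-word-cong : ∀ {m} n {F G : (Fin n → Fin m) → Carrier} →
                (∀ w → F w ≈ G w) → ∑-word n F ≈ ∑-word n G
  ∑-word-cong zero    F≈G = F≈G _
  ∑-word-cong (suc n) F≈G = sum-cong-≋ (λ a → ∑-word-cong n (λ w → F≈G (a Vector.∷ w)))

  ∑-word-+ : ∀ {m} n (F G : (Fin n → Fin m) → Carrier) →
             ∑-word n (λ w → F w + G w) ≈ ∑-word n F + ∑-word n G
  ∑-word-+ zero    F G = refl
  ∑-word-+ {m} (suc n) F G = trans
    (sum-cong-≋ {m} (λ a → ∑-word-+ n (F ∘ (a Vector.∷_)) (G ∘ (a Vector.∷_)))) (∑-distrib-+ {m} _ _)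

  ∑-word-* : ∀ {m} n k (F : (Fin n → Fin m) → Carrier) →
             ∑-word n (λ w → k * F w) ≈ k * ∑-word n F
  ∑-word-* zero    k F = refl
  ∑-word-* {m} (suc n) k F = trans
    (sum-cong-≋ {m} (λ a → ∑-word-* n k (F ∘ (a Vector.∷_)))) (sym (*-distribˡ-sum {m} k _))

  ∑-word-0 : ∀ {m} n {F : (Fin n → Fin m) → Carrier} → (∀ w → F w ≈ 0#) → ∑-word n F ≈ 0#
  ∑-word-0 n {F} F≈0 = begin
    ∑-word n F                  ≈⟨ ∑-word-cong n (λ w → trans (F≈0 w) (sym (zeroˡ 0#))) ⟩
    ∑-word n (λ _ → 0# * 0#)    ≈⟨ ∑-word-* n 0# _ ⟩
    0# * ∑-word n (λ _ → 0#)    ≈⟨ zeroˡ _ ⟩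
    0#                          ∎

  ∑-pick : ∀ {m} b (f : ℕ → Carrier) → b < m →
           ∑[ a < m ] (if does (toℕ a ℕ.≟ b) then f (toℕ a) else 0#) ≈ f b
  ∑-pick {suc m} zero f _ = begin
    f 0 + ∑[ a < m ] 0#   ≈⟨ +-congˡ (sum-replicate-zero m) ⟩
    f 0 + 0#              ≈⟨ +-identityʳ _ ⟩
    f 0                   ∎
  ∑-pick {suc m} (suc b) f (s≤s b<m) = trans (+-identityˡ _)
    (∑-pick {m} b (f ∘ suc) b<m)

module Transfer {c ℓ : Level} (R : CommutativeRing c ℓ)
                (t u v q s η : CommutativeRing.Carrier R) (M N : ℕ) where
  open CommutativeRing R hiding (zero)
  open SemiringExp semiring
  open SemiringSum semiring
  open SetoidReasoning setoid
  open IntegerSolver R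
  open Words R

  Word : ℕ → Set
  Word n = Fin n → Fin M

  -- A word is read from right to left.  In the state (d , c) all letters so
  -- far are < d, one of them being d - 1, and a letter < c may not follow.
  -- The factor q = 1 + (q - 1) of a left-to-right minimum b is split: with
  -- weight q - 1 the letter is marked, and all letters on its left must
  -- exceed b.
  StateFunction : Set c
  StateFunction = ℕ → ℕ → Carrier

  -- The transition is transposed: the value at the old state is the weighted sum of `f` over the
  -- states reached by reading `b`. The weight `v` is due when `b ≥ d`, since `b` is then a
  -- right-to-left maximum.
  prepend : ℕ → StateFunction → StateFunction
  prepend b f d c =
    if does (c ≤? b)
    then (if does (d ≤? b)
          then v * (f (suc b) c + (q - 1#) * f (suc b) (suc b))
          else (f d c + (q - 1#) * f d (suc b)))
    else 0#

  -- Here `f` weighs the final state. The first letter is read last, so its operator is the first to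
  -- act on `f`.
  val : ∀ {n} → Word n → StateFunction → Carrier
  val {zero}  w f = f 0 0
  val {suc n} w f = val (w ∘ suc) (prepend (toℕ (w zero)) f)

  -- The cuts of w into k weakly increasing, possibly empty rows have weight
  -- u ^ (k - 1); the first row may only use letters ≥ b.
  rows : ∀ {n} → ℕ → Word n → Carrier
  rows {zero}  b w = η
  rows {suc n} b w =
    (if does (b ≤? toℕ (w zero)) then η else u * η) * rows (toℕ (w zero)) (w ∘ suc)

  layer : ℕ → ℕ → StateFunction → Carrier
  layer n b f = ∑-word n (λ w → rows b w * val w f)

  total : ℕ → StateFunction → Carrier
  total b f = ∑< N (λ n → t ^ n * layer n b f)

  infix 4 _≃_
  -- Only states with `c ≤ d ≤ M` are reachable, and the closed form of a full row is established
  -- only on these.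
  _≃_ : StateFunction → StateFunction → Set ℓ
  f ≃ g = ∀ d c → c ≤ d → d ≤ M → f d c ≈ g d c

  comb : Carrier → StateFunction → Carrier → StateFunction → StateFunction
  comb k f l g d c = k * f d c + l * g d c

  prepend-cong : ∀ {f g} b → b < M → f ≃ g → prepend b f ≃ prepend b g
  prepend-cong b b<M f≃g d c c≤d d≤M with does (c ≤? b) | proof (c ≤? b)
  ... | false | _ = refl
  ... | true  | ofʸ c≤b with does (d ≤? b) | proof (d ≤? b)
  ...   | true  | _ = *-congˡ (+-cong (f≃g _ _ (ℕ.m≤n⇒m≤1+n c≤b) b<M)
                                    (*-congˡ (f≃g _ _ ℕ.≤-refl b<M)))
  ...   | false | ofⁿ d≰b = +-cong (f≃g _ _ c≤d d≤M) (*-congˡ (f≃g _ _ (ℕ.≰⇒> d≰b) d≤M))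

  prepend-comb : ∀ b k f l g d c →
    prepend b (comb k f l g) d c ≈ comb k (prepend b f) l (prepend b g) d c
  prepend-comb b k f l g d c with does (c ≤? b)
  ... | false = sym (trans (+-cong (zeroʳ k) (zeroʳ l)) (+-identityˡ 0#))
  ... | true with does (d ≤? b)
  ...   | true = solve 8 (λ v p k l a b e f →
              v :* ((k :* a :+ l :* b) :+ p :* (k :* e :+ l :* f)) :=
              k :* (v :* (a :+ p :* e)) :+ l :* (v :* (b :+ p :* f)))
              refl v (q - 1#) k l _ _ _ _
  ...   | false = solve 7 (λ p k l a b e f →
              ((k :* a :+ l :* b) :+ p :* (k :* e :+ l :* f)) :=
              k :* (a :+ p :* e) :+ l :* (b :+ p :* f))
              refl (q - 1#) k l _ _ _ _

  val-cong : ∀ {n f g} (w : Word n) → f ≃ g → val w f ≈ val w g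
  val-cong {zero}  w f≃g = f≃g 0 0 z≤n z≤n
  val-cong {suc n} w f≃g = val-cong (w ∘ suc) (prepend-cong _ (Fin.toℕ<n (w zero)) f≃g)

  val-comb : ∀ {n} (w : Word n) k f l g → val w (comb k f l g) ≈ k * val w f + l * val w g
  val-comb {zero}  w k f l g = refl
  val-comb {suc n} w k f l g = trans
    (val-cong (w ∘ suc) (λ d c _ _ → prepend-comb (toℕ (w zero)) k f l g d c))
    (val-comb (w ∘ suc) k _ l _)

  total-cong : ∀ {f g} b → f ≃ g → total b f ≈ total b g
  total-cong {f} {g} b f≃g = ∑<-cong N (λ n _ → *-congˡ {t ^ n} {layer n b f} {layer n b g}
    (∑-word-cong n (λ w → *-congˡ (val-cong w f≃g))))

  layer-comb : ∀ n b k f l g → layer n b (comb k f l g) ≈ k * layer n b f + l * layer n b g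
  layer-comb n b k f l g = begin
    layer n b (comb k f l g)
      ≈⟨ ∑-word-cong n (λ w → *-congˡ (val-comb w k f l g)) ⟩
    ∑-word n (λ w → rows b w * (k * val w f + l * val w g))
      ≈⟨ ∑-word-cong n (λ w → solve 5 (λ r k x l y → r :* (k :* x :+ l :* y) :=
           k :* (r :* x) :+ l :* (r :* y)) refl (rows b w) k (val w f) l (val w g)) ⟩
    ∑-word n (λ w → k * (rows b w * val w f) + l * (rows b w * val w g))
      ≈⟨ ∑-word-+ n _ _ ⟩
    ∑-word n (λ w → k * (rows b w * val w f)) + ∑-word n (λ w → l * (rows b w * val w g))
      ≈⟨ +-cong (∑-word-* n k _) (∑-word-* n l _) ⟩
    k * layer n b f + l * layer n b g
      ∎

  total-comb : ∀ b k f l g → total b (comb k f l g) ≈ k * total b f + l * total b g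
  total-comb b k f l g = begin
    total b (comb k f l g)
      ≈⟨ ∑<-cong N (λ n _ → trans (*-congˡ (layer-comb n b k f l g))
           (solve 5 (λ r k x l y → r :* (k :* x :+ l :* y) :=
             k :* (r :* x) :+ l :* (r :* y)) refl (t ^ n) k (layer n b f) l (layer n b g))) ⟩
    ∑< N (λ n → k * (t ^ n * layer n b f) + l * (t ^ n * layer n b g))
      ≈⟨ ∑-distrib-+ {N} _ _ ⟩
    ∑< N (λ n → k * (t ^ n * layer n b f)) + ∑< N (λ n → l * (t ^ n * layer n b g))
      ≈⟨ +-cong (*-distribˡ-sum {N} k _) (*-distribˡ-sum {N} l _) ⟨
    k * total b f + l * total b g
      ∎

  module _ (geometric : η * (1# - u) ≈ 1#) where

    private
      η≈ : ∀ a → η * a ≈ u * η * a + a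
      η≈ a = begin
        η * a                              ≈⟨ solve 3 (λ η u a → η :* a := u :* η :* a :+ (η :* (:1 :- u)) :* a) refl η u a ⟩
        u * η * a + (η * (1# - u)) * a     ≈⟨ +-congˡ (trans (*-congʳ geometric) (*-identityˡ a)) ⟩
        u * η * a + a                      ∎

    -- The bounds `b` and `suc b` differ only for a first letter `b`. There `η = u η + 1`, and the
    -- summand 1 keeps the letter in the current row.
    rows-step : ∀ {n} b (w : Word (suc n)) →
      rows b w ≈ rows (suc b) w +
        (if does (toℕ (w zero) ℕ.≟ b) then rows (toℕ (w zero)) (w ∘ suc) else 0#)
    rows-step b w with does (b ≤? toℕ (w zero)) | proof (b ≤? toℕ (w zero))
                     | does (suc b ≤? toℕ (w zero)) | proof (suc b ≤? toℕ (w zero))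
                     | does (toℕ (w zero) ℕ.≟ b) | proof (toℕ (w zero) ℕ.≟ b)
    ... | true  | _       | true  | _       | false | _       = sym (+-identityʳ _)
    ... | true  | _       | true  | ofʸ b<a | true  | ofʸ a≡b = contradiction (≡.sym a≡b) (ℕ.<⇒≢ b<a)
    ... | true  | _       | false | _       | true  | _       = η≈ _
    ... | true  | ofʸ b≤a | false | ofⁿ b≮a | false | ofⁿ a≢b = contradiction (ℕ.≤∧≢⇒< b≤a (a≢b ∘ ≡.sym)) b≮a
    ... | false | ofⁿ b≰a | true  | ofʸ b<a | _     | _       = contradiction (ℕ.<⇒≤ b<a) b≰a
    ... | false | ofⁿ b≰a | false | _       | true  | ofʸ a≡b = contradiction (ℕ.≤-reflexive (≡.sym a≡b)) b≰a
    ... | false | _       | false | _       | false | _       = sym (+-identityʳ _)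

    layer-step : ∀ n b f → b < M →
      layer (suc n) b f ≈ layer (suc n) (suc b) f + layer n b (prepend b f)
    layer-step n b f b<M = begin
      ∑[ a < M ] ∑-word n (λ w → rows b (a Vector.∷ w) * val (a Vector.∷ w) f)
        ≈⟨ sum-cong-≋ {M} (λ a → trans (∑-word-cong n (λ w →
             trans (*-congʳ (rows-step b (a Vector.∷ w))) (distribʳ _ _ _))) (∑-word-+ n _ _)) ⟩
      ∑[ a < M ] (∑-word n (λ w → rows (suc b) (a Vector.∷ w) * val (a Vector.∷ w) f) +
                  ∑-word n (λ w → (if does (toℕ a ℕ.≟ b) then rows (toℕ a) w else 0#)
                                    * val w (prepend (toℕ a) f)))
        ≈⟨ ∑-distrib-+ {M} _ _ ⟩
      layer (suc n) (suc b) f +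
      ∑[ a < M ] ∑-word n (λ w → (if does (toℕ a ℕ.≟ b) then rows (toℕ a) w else 0#)
                                   * val w (prepend (toℕ a) f))
        ≈⟨ +-congˡ (sum-cong-≋ {M} pull) ⟩
      layer (suc n) (suc b) f +
      ∑[ a < M ] (if does (toℕ a ℕ.≟ b) then layer n (toℕ a) (prepend (toℕ a) f) else 0#)
        ≈⟨ +-congˡ (∑-pick {M} b (λ a → layer n a (prepend a f)) b<M) ⟩
      layer (suc n) (suc b) f + layer n b (prepend b f)
        ∎
      where
      pull : ∀ (a : Fin M) →
        ∑-word n (λ w → (if does (toℕ a ℕ.≟ b) then rows (toℕ a) w else 0#) * val w (prepend (toℕ a) f))
          ≈ (if does (toℕ a ℕ.≟ b) then layer n (toℕ a) (prepend (toℕ a) f) else 0#)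
      pull a with does (toℕ a ℕ.≟ b)
      ... | true  = refl
      ... | false = ∑-word-0 n (λ w → zeroˡ _)

    -- No letter is `≥ M`, so a cut precedes the first letter; it contributes `u`.
    layer-top : ∀ n f → layer (suc n) M f ≈ u * layer (suc n) 0 f
    layer-top n f = trans (∑-word-cong (suc n) row) (∑-word-* (suc n) u (λ w → rows 0 w * val w f))
      where
      row : ∀ w → rows M w * val w f ≈ u * (rows 0 w * val w f)
      row w rewrite dec-false (M ≤? toℕ (w zero)) (ℕ.<⇒≱ (Fin.toℕ<n (w zero))) =
        solve 4 (λ u η a b → u :* η :* a :* b := u :* (η :* a :* b)) refl u η _ _

    module _ (t^N≈0 : t ^ N ≈ 0#) where

      -- The rest of the current row either avoids `b` or begins with a `b`, of weight `t`, after
      -- which further letters `b` are still allowed. The truncation at `N` loses only a term with a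
      -- factor `t ^ N`.
      total-step : ∀ b f → b < M → total b f ≈ total (suc b) f + t * total b (prepend b f)
      total-step = step N t^N≈0
        where
        step : ∀ N → t ^ N ≈ 0# → ∀ b f → b < M →
          ∑< N (λ n → t ^ n * layer n b f) ≈
          ∑< N (λ n → t ^ n * layer n (suc b) f) + t * ∑< N (λ n → t ^ n * layer n b (prepend b f))
        step zero    1≈0 b f _ = sym (trans (+-congˡ (zeroʳ t)) (+-identityʳ 0#))
        step (suc N) t≈0 b f b<M = begin
          first + ∑< N (λ n → t ^ suc n * layer (suc n) b f)
            ≈⟨ +-congˡ (∑<-cong N (λ n _ → trans (*-congˡ {t ^ suc n} (layer-step n b f b<M)) (distribˡ _ _ _))) ⟩
          first + ∑< N (λ n → t ^ suc n * layer (suc n) (suc b) f + t ^ suc n * layer n b Bf)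
            ≈⟨ +-congˡ (∑-distrib-+ {N} _ _) ⟩
          first + (∑< N (λ n → t ^ suc n * layer (suc n) (suc b) f) + ∑< N (λ n → t ^ suc n * layer n b Bf))
            ≈⟨ +-assoc _ _ _ ⟨
          rest + ∑< N (λ n → t ^ suc n * layer n b Bf)
            ≈⟨ +-congˡ (trans (∑<-cong N (λ n _ → *-assoc t (t ^ n) (layer n b Bf))) (sym (*-distribˡ-sum {N} t _))) ⟩
          rest + t * ∑< N (λ n → t ^ n * layer n b Bf)
            ≈⟨ +-congˡ (trans (distribˡ t _ _) (trans (+-congˡ vanish) (+-identityʳ _))) ⟨
          rest + t * (∑< N (λ n → t ^ n * layer n b Bf) + t ^ N * layer N b Bf)
            ≈⟨ +-congˡ (*-congˡ (∑<-last N (λ n → t ^ n * layer n b Bf))) ⟨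
          rest + t * ∑< (suc N) (λ n → t ^ n * layer n b Bf)
            ∎
          where
          Bf    = prepend b f
          first = t ^ 0 * layer 0 b f
          rest  = first + ∑< N (λ n → t ^ suc n * layer (suc n) (suc b) f)
          vanish : t * (t ^ N * layer N b Bf) ≈ 0#
          vanish = trans (sym (*-assoc t _ _)) (trans (*-congʳ t≈0) (zeroˡ _))

      -- At the bound `M` the current row is finished: either it was the last one, or a new row
      -- follows at the cost `u`.
      total-top : 1 ≤ N → ∀ f → total M f ≈ f 0 0 + u * total 0 f
      total-top = top N
        where
        top : ∀ N → 1 ≤ N → ∀ f →
          ∑< N (λ n → t ^ n * layer n M f) ≈ f 0 0 + u * ∑< N (λ n → t ^ n * layer n 0 f)
        top (suc N) _ f = begin
          1# * (η * f 0 0) + ∑< N (λ n → t ^ suc n * layer (suc n) M f)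
            ≈⟨ +-cong (trans (*-identityˡ _) (η≈ (f 0 0)))
                      (∑<-cong N (λ n _ → trans (*-congˡ {t ^ suc n} (layer-top n f))
                        (solve 3 (λ a b c → a :* (b :* c) := b :* (a :* c)) refl (t ^ suc n) u _))) ⟩
          (u * η * f 0 0 + f 0 0) + ∑< N (λ n → u * (t ^ suc n * layer (suc n) 0 f))
            ≈⟨ +-congˡ (sym (*-distribˡ-sum {N} u _)) ⟩
          (u * η * f 0 0 + f 0 0) + u * ∑< N (λ n → t ^ suc n * layer (suc n) 0 f)
            ≈⟨ solve 4 (λ u η f S → (u :* η :* f :+ f) :+ u :* S := f :+ u :* (:1 :* (η :* f) :+ S))
                 refl u η (f 0 0) _ ⟩
          f 0 0 + u * (1# * (η * f 0 0) + ∑< N (λ n → t ^ suc n * layer (suc n) 0 f))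
            ∎

  -- The inverse of f ↦ f - t * prepend b f.
  column : ℕ → StateFunction → StateFunction
  column b f d c =
    if does (c ≤? b)
    then (if does (d ≤? b)
          -- The first `b` raises `d` at the cost `t * v`; unmarked repetitions contribute `s`. A
          -- marked `b` must be the last one, and the sum of `t ^ k` over all `k ≥ 1` is again
          -- `t * s`.
          then f d c + t * v * s * (f (suc b) c + (q - 1#) * f (suc b) (suc b))
          else s * (f d c + (q - 1#) * (t * f d (suc b))))
    else f d c

  -- One row with letters `< b`. It increases weakly, so its smallest letters stand first and act on
  -- `f` first.
  columns : ℕ → StateFunction → StateFunction
  columns zero    f = f
  columns (suc b) f = column b (columns b f)

  column-skip : ∀ b f d c → b < c → column b f d c ≡ f d c
  column-skip b f d c b<c rewrite dec-false (c ≤? b) (ℕ.<⇒≱ b<c) = ≡.refl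

  column-stay : ∀ b f d c → c ≤ b → b < d →
    column b f d c ≡ s * (f d c + (q - 1#) * (t * f d (suc b)))
  column-stay b f d c c≤b b<d rewrite dec-true (c ≤? b) c≤b | dec-false (d ≤? b) (ℕ.<⇒≱ b<d) = ≡.refl

  column-rise : ∀ b f d c → c ≤ b → d ≤ b →
    column b f d c ≡ f d c + t * v * s * (f (suc b) c + (q - 1#) * f (suc b) (suc b))
  column-rise b f d c c≤b d≤b rewrite dec-true (c ≤? b) c≤b | dec-true (d ≤? b) d≤b = ≡.refl

  module _ (rs≈1 : (1# - t) * s ≈ 1#) where

    -- This is the resolvent identity, in the shape of `comb` so that `total-comb` applies. After a
    -- marked `b` the forbidden bound is `suc b`, where both operators at `b` are trivial; hence the
    -- rewriting of `suc b ≤? b`.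
    column-prepend : ∀ b f d c → f d c ≈ 1# * column b f d c + - t * prepend b (column b f) d c
    column-prepend b f d c with does (c ≤? b) | proof (c ≤? b)
    ... | false | ofⁿ c≰b = solve 2 (λ t x → x := :1 :* x :+ :- t :* :0) refl t _
    ... | true  | ofʸ c≤b with does (d ≤? b) | proof (d ≤? b)
    ...   | false | ofⁿ d≰b
      rewrite dec-false (suc b ≤? b) ℕ.1+n≰n = begin
        f d c
          ≈⟨ *-identityˡ _ ⟨
        1# * f d c
          ≈⟨ *-congʳ rs≈1 ⟨
        ((1# - t) * s) * f d c
          -- The solver does not know `rs≈1`; a multiple of `1 - (1 - t) s` is therefore split off
          -- and discarded in the next step.
          ≈⟨ solve 5 (λ t s p x y → ((:1 :- t) :* s) :* x :=
                 (:1 :* (s :* (x :+ p :* (t :* y))) :+ :- t :* (s :* (x :+ p :* (t :* y)) :+ p :* y))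
                   :+ p :* t :* y :* (:1 :- (:1 :- t) :* s))
               refl t s (q - 1#) (f d c) (f d (suc b)) ⟩
        _ + (q - 1#) * t * f d (suc b) * (1# - (1# - t) * s)
          ≈⟨ +-congˡ (trans (*-congˡ (trans (+-congˡ (-‿cong rs≈1)) (-‿inverseʳ 1#))) (zeroʳ _)) ⟩
        _ + 0#
          ≈⟨ +-identityʳ _ ⟩
        1# * (s * (f d c + (q - 1#) * (t * f d (suc b)))) +
          - t * (s * (f d c + (q - 1#) * (t * f d (suc b))) + (q - 1#) * f d (suc b))
          ∎
    ...   | true  | ofʸ d≤b
      rewrite dec-false (suc b ≤? b) ℕ.1+n≰n = begin
        f d c
          ≈⟨ +-identityʳ _ ⟨
        f d c + 0#
          ≈⟨ +-congˡ (trans (*-congˡ (trans (+-congʳ rs≈1) (-‿inverseʳ 1#))) (zeroʳ _)) ⟨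
        f d c + t * v * (q - 1#) * f (suc b) (suc b) * ((1# - t) * s - 1#)
          ≈⟨ solve 7 (λ t v s p x y z →
                 x :+ t :* v :* p :* z :* ((:1 :- t) :* s :- :1) :=
                 :1 :* (x :+ t :* v :* s :* (y :+ p :* z))
                   :+ :- t :* (v :* (s :* (y :+ p :* (t :* z)) :+ p :* z)))
               refl t v s (q - 1#) (f d c) (f (suc b) c) (f (suc b) (suc b)) ⟩
        1# * (f d c + t * v * s * (f (suc b) c + (q - 1#) * f (suc b) (suc b))) +
          - t * (v * (s * (f (suc b) c + (q - 1#) * (t * f (suc b) (suc b))) + (q - 1#) * f (suc b) (suc b)))
          ∎

    module Monomials
      (geometric : η * (1# - u) ≈ 1#) (t^N≈0 : t ^ N ≈ 0#) (1≤N : 1 ≤ N)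
      (x ξ : Carrier) (ξ-inverse : ξ * (1# - x) ≈ 1#) (x^M≈0 : x ^ M ≈ 0#)
      where

      -- For `g = column b f`, `total-step` says that the total of `g - t * prepend b g` at `b` is
      -- the total of `g` at `suc b`; and `g - t * prepend b g` is `f`.
      total-column : ∀ b f → b < M → total b f ≈ total (suc b) (column b f)
      total-column b f b<M = begin
        total b f
          ≈⟨ total-cong {f} {comb 1# (column b f) (- t) (prepend b (column b f))} b
             (λ d c _ _ → column-prepend b f d c) ⟩
        total b (comb 1# (column b f) (- t) (prepend b (column b f)))
          ≈⟨ total-comb b 1# _ (- t) _ ⟩
        1# * total b (column b f) + - t * total b (prepend b (column b f))
          ≈⟨ +-congʳ (*-congˡ (total-step geometric t^N≈0 b (column b f) b<M)) ⟩
        1# * (total (suc b) (column b f) + t * total b (prepend b (column b f)))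
          + - t * total b (prepend b (column b f))
          ≈⟨ solve 3 (λ a t b → :1 :* (a :+ t :* b) :+ :- t :* b := a) refl _ t _ ⟩
        total (suc b) (column b f)
          ∎

      total-columns : ∀ b f → b ≤ M → total 0 f ≈ total b (columns b f)
      total-columns zero    f _   = refl
      total-columns (suc b) f b<M =
        trans (total-columns b f (ℕ.<⇒≤ b<M)) (total-column b (columns b f) b<M)

      -- One full row acting on the monomial weights

      monomial : Carrier → StateFunction
      monomial y d c = x ^ d * y ^ (d ∸ c)

      -- All letters `< b` are forbidden in this state.
      columns-below : ∀ b f d c → b ≤ c → columns b f d c ≡ f d c
      columns-below zero    f d c _   = ≡.refl
      columns-below (suc b) f d c b<c =
        ≡.trans (column-skip b (columns b f) d c b<c) (columns-below b f d c (ℕ.<⇒≤ b<c))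

      -- With `z = y * s`, the scalars stand for `κ = t s / (1 - z)` and `μ = 1 / (1 - x z)`. They
      -- are given by equations because `1 - z` will be a multiple of `t`, which has no inverse.
      module _ (y κ μ : Carrier) (κ-eq : κ * (1# - y * s) ≈ t * s)
               (μ-inverse : μ * (1# - x * (y * s)) ≈ 1#) where

        private
          z p : Carrier
          z = y * s
          p = q - 1#

          f : StateFunction
          f = monomial y

          -- `G` solves `G 0 = 1`, `G (m + 1) = z * G m + p * t * s`, a recursion with fixed point
          -- `p * κ`. `W m` is the closed form of `t v x` times the sum of
          -- `x ^ k * s * (y * G (m + k) + p)` over all `k ≥ 0`: the contribution of all columns
          -- that raise `d`.
          G W : ℕ → Carrier
          G m = z ^ m + p * (κ * (1# - z ^ m))
          W m = t * v * x * (μ * (z * z ^ m) * (1# - p * κ) + p * ((κ + 1#) * ξ))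

          f-diagonal : ∀ e b → f (e ℕ.+ b) b ≈ x ^ (e ℕ.+ b) * y ^ e
          f-diagonal e b = *-congˡ (reflexive (≡.cong (y ^_) (ℕ.m+n∸n≡m e b)))

        -- Induction on the number `m` of columns passed, with `d` fixed, so that `e` drops as `m`
        -- grows. A letter marked in column `b` leads to the bound `suc b`, where the earlier
        -- columns do nothing by `columns-below`.
        columns-inside : ∀ m e c → columns (m ℕ.+ c) f (e ℕ.+ (m ℕ.+ c)) c
                                   ≈ x ^ (e ℕ.+ (m ℕ.+ c)) * (y ^ e * G m)
        columns-inside zero e c = begin
          columns c f (e ℕ.+ c) c        ≡⟨ columns-below c f (e ℕ.+ c) c ℕ.≤-refl ⟩
          f (e ℕ.+ c) c                  ≈⟨ f-diagonal e c ⟩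
          x ^ (e ℕ.+ c) * y ^ e          ≈⟨ solve 4 (λ X Y p κ → X :* Y := X :* (Y :* (:1 :+ p :* (κ :* (:1 :- :1)))))
                                              refl _ _ p κ ⟩
          x ^ (e ℕ.+ c) * (y ^ e * G 0)  ∎
        columns-inside (suc m) e c = begin
          column b F d c
            ≡⟨ column-stay b F d c (ℕ.m≤n+m c m) (ℕ.m≤n+m (suc b) e) ⟩
          s * (F d c + p * (t * F d (suc b)))
            ≈⟨ *-congˡ (+-cong F-dc (*-congˡ (*-congˡ (trans
                 (reflexive (columns-below b f d (suc b) (ℕ.n≤1+n b))) (f-diagonal e (suc b)))))) ⟩
          s * (x ^ d * (y * y ^ e * G m) + p * (t * (x ^ d * y ^ e)))
            ≈⟨ solve 8 (λ s X y Y P p κ t →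
                 s :* (X :* (y :* Y :* (P :+ p :* (κ :* (:1 :- P)))) :+ p :* (t :* (X :* Y)))
                 := X :* (Y :* (y :* s :* P :+ p :* (κ :* (y :* s :- y :* s :* P) :+ t :* s))))
                 refl s (x ^ d) y (y ^ e) (z ^ m) p κ t ⟩
          x ^ d * (y ^ e * (z * z ^ m + p * (κ * (z - z * z ^ m) + t * s)))
            ≈⟨ *-congˡ (*-congˡ (+-congˡ (*-congˡ (+-congˡ κ-eq)))) ⟨
          x ^ d * (y ^ e * (z * z ^ m + p * (κ * (z - z * z ^ m) + κ * (1# - z))))
            ≈⟨ *-congˡ (*-congˡ (+-congˡ (*-congˡ
                 (solve 3 (λ κ z w → κ :* (z :- w) :+ κ :* (:1 :- z) := κ :* (:1 :- w)) refl κ z _)))) ⟩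
          x ^ d * (y ^ e * G (suc m))
            ∎
          where
          b = m ℕ.+ c
          d = e ℕ.+ suc b
          F = columns b f
          F-dc : F d c ≈ x ^ d * (y * y ^ e * G m)
          F-dc = ≡.subst (λ d → F d c ≈ x ^ d * (y * y ^ e * G m)) (≡.sym (ℕ.+-suc e b))
                         (columns-inside m (suc e) c)

        private
          -- The difference equation of `W`, with `P` for `z ^ m` and without the factor `t v x`. It
          -- rests on `κ z + s = κ + 1`, a consequence of `κ-eq` and `rs≈1`.
          G-step : ∀ P → μ * (z * P) * (1# - p * κ) + p * ((κ + 1#) * ξ) ≈
            s * (y * 1# * (P + p * (κ * (1# - P))) + p) +
            x * (μ * (z * (z * P)) * (1# - p * κ) + p * ((κ + 1#) * ξ))
          G-step P = begin
            μ * (z * P) * (1# - p * κ) + p * ((κ + 1#) * ξ)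
              ≈⟨ +-cong expand-μ expand-ξ ⟩
            (z * P * (1# - p * κ) + x * A) + (p * (κ + 1#) + x * B)
              ≈⟨ solve 8 (λ P p κ x A B y s →
                   (y :* s :* P :* (:1 :- p :* κ) :+ x :* A) :+ (p :* (κ :+ :1) :+ x :* B) :=
                   (y :* s :* (P :+ p :* (κ :* (:1 :- P))) :+ p :* (:1 :+ κ :* (:1 :- y :* s)))
                     :+ x :* (A :+ B))
                   refl P p κ x A B y s ⟩
            (z * (P + p * (κ * (1# - P))) + p * (1# + κ * (1# - z))) + x * (A + B)
              ≈⟨ +-congʳ (+-congˡ (*-congˡ (+-cong (sym rs≈1) κ-eq))) ⟩
            (z * (P + p * (κ * (1# - P))) + p * ((1# - t) * s + t * s)) + x * (A + B)
              ≈⟨ +-congʳ (solve 5 (λ y s g p t →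
                   y :* s :* g :+ p :* ((:1 :- t) :* s :+ t :* s) := s :* (y :* :1 :* g :+ p))
                   refl y s _ p t) ⟩
            s * (y * 1# * (P + p * (κ * (1# - P))) + p) + x * (A + B)
              ∎
            where
            A = μ * (z * (z * P)) * (1# - p * κ)
            B = p * ((κ + 1#) * ξ)
            expand-μ : μ * (z * P) * (1# - p * κ) ≈ z * P * (1# - p * κ) + x * A
            expand-μ = begin
              μ * (z * P) * (1# - p * κ)
                ≈⟨ solve 5 (λ μ z P k x → μ :* (z :* P) :* k :=
                     (μ :* (:1 :- x :* z)) :* (z :* P :* k) :+ x :* (μ :* (z :* (z :* P)) :* k))
                     refl μ z P (1# - p * κ) x ⟩
              (μ * (1# - x * z)) * (z * P * (1# - p * κ)) + x * A
                ≈⟨ +-congʳ (trans (*-congʳ μ-inverse) (*-identityˡ _)) ⟩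
              z * P * (1# - p * κ) + x * A
                ∎
            expand-ξ : B ≈ p * (κ + 1#) + x * B
            expand-ξ = begin
              B
                ≈⟨ solve 4 (λ p k ξ x → p :* (k :* ξ) := (ξ :* (:1 :- x)) :* (p :* k) :+ x :* (p :* (k :* ξ)))
                     refl p (κ + 1#) ξ x ⟩
              (ξ * (1# - x)) * (p * (κ + 1#)) + x * B
                ≈⟨ +-congʳ (trans (*-congʳ ξ-inverse) (*-identityˡ _)) ⟩
              p * (κ + 1#) + x * B
                ∎

        -- The columns from `d` on raise `d`, and their contributions telescope into a difference of
        -- two tails. At `M` the second tail disappears with `x ^ M`.
        columns-beyond : ∀ e l c →
          columns (e ℕ.+ (l ℕ.+ c)) f (l ℕ.+ c) c
            ≈ x ^ (l ℕ.+ c) * (G l + W l) - x ^ (e ℕ.+ (l ℕ.+ c)) * W (e ℕ.+ l)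
        columns-beyond zero l c = begin
          columns (l ℕ.+ c) f (l ℕ.+ c) c
            ≈⟨ columns-inside l 0 c ⟩
          x ^ (l ℕ.+ c) * (1# * G l)
            ≈⟨ solve 3 (λ X G W → X :* (:1 :* G) := X :* (G :+ W) :- X :* W) refl _ (G l) (W l) ⟩
          x ^ (l ℕ.+ c) * (G l + W l) - x ^ (l ℕ.+ c) * W l
            ∎
        columns-beyond (suc e) l c = begin
          column b F d c
            ≡⟨ column-rise b F d c (ℕ.≤-trans (ℕ.m≤n+m c l) (ℕ.m≤n+m d e)) (ℕ.m≤n+m d e) ⟩
          F d c + t * v * s * (F (suc b) c + p * F (suc b) (suc b))
            ≈⟨ +-cong (columns-beyond e l c) (*-congˡ (+-cong F-rise (*-congˡ (trans
                 (reflexive (columns-below b f (suc b) (suc b) (ℕ.n≤1+n b))) (f-diagonal 0 (suc b)))))) ⟩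
          (X - x ^ b * (t * v * x * W₁)) + t * v * s * (x * x ^ b * (y * 1# * g) + p * (x * x ^ b * 1#))
            ≈⟨ +-congʳ (+-congˡ (-‿cong (*-congˡ (*-congˡ (G-step (z ^ m)))))) ⟩
          (X - x ^ b * (t * v * x * (s * (y * 1# * g + p) + x * W₂)))
            + t * v * s * (x * x ^ b * (y * 1# * g) + p * (x * x ^ b * 1#))
            ≈⟨ solve 9 (λ X x' k x s yg p w t →
                 (X :- x' :* (k :* x :* (s :* (yg :+ p) :+ x :* w)))
                   :+ k :* s :* (x :* x' :* yg :+ p :* (x :* x' :* :1))
                 := X :- x :* x' :* (k :* x :* w))
                 refl X (x ^ b) (t * v) x s (y * 1# * g) p W₂ t ⟩
          X - x ^ suc b * W (suc e ℕ.+ l)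
            ∎
          where
          d  = l ℕ.+ c
          b  = e ℕ.+ d
          m  = e ℕ.+ l
          F  = columns b f
          X  = x ^ d * (G l + W l)
          g  = z ^ m + p * (κ * (1# - z ^ m))
          W₁ = μ * (z * z ^ m) * (1# - p * κ) + p * ((κ + 1#) * ξ)
          W₂ = μ * (z * (z * z ^ m)) * (1# - p * κ) + p * ((κ + 1#) * ξ)
          F-rise : F (suc b) c ≈ x * x ^ b * (y * 1# * g)
          F-rise = ≡.subst (λ b → columns b f (suc b) c ≈ x * x ^ b * (y * 1# * g))
                           (ℕ.+-assoc e l c) (columns-inside m 1 c)

        -- The coefficients in `G l + W l = α * z ^ l + β`.
        α β : Carrier
        α = (1# - p * κ) * (1# + t * v * x * (μ * z))
        β = p * (κ + (κ + 1#) * ξ * (t * v * x))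

        private
          offset : ∀ {m n} → m ≤ n → ∃ λ o → o ℕ.+ m ≡ n
          offset m≤n = _ , ℕ.m∸n+n≡m m≤n

        columns-monomial : columns M f ≃ comb α (monomial z) β (monomial 1#)
        columns-monomial d c c≤d d≤M
          with l , ≡.refl ← offset c≤d with e , e+d≡M ← offset d≤M = begin
          columns M f (l ℕ.+ c) c
            ≡⟨ ≡.cong (λ M → columns M f (l ℕ.+ c) c) (≡.sym e+d≡M) ⟩
          columns (e ℕ.+ (l ℕ.+ c)) f (l ℕ.+ c) c
            ≈⟨ columns-beyond e l c ⟩
          X * (G l + W l) - x ^ (e ℕ.+ (l ℕ.+ c)) * W (e ℕ.+ l)
            ≈⟨ +-congˡ (-‿cong (trans (*-congʳ (trans (reflexive (≡.cong (x ^_) e+d≡M)) x^M≈0)) (zeroˡ _))) ⟩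
          X * (G l + W l) - 0#
            ≈⟨ solve 8 (λ X P p κ T μ z ξ →
                 X :* ((P :+ p :* (κ :* (:1 :- P)))
                   :+ T :* (μ :* (z :* P) :* (:1 :- p :* κ) :+ p :* ((κ :+ :1) :* ξ))) :- :0 :=
                 (:1 :- p :* κ) :* (:1 :+ T :* (μ :* z)) :* (X :* P) :+ p :* (κ :+ (κ :+ :1) :* ξ :* T) :* (X :* :1))
                 refl X (z ^ l) p κ (t * v * x) μ z ξ ⟩
          α * (X * z ^ l) + β * (X * 1#)
            ≈⟨ +-cong (*-congˡ (*-congˡ (reflexive (≡.cong (z ^_) (ℕ.m+n∸n≡m l c)))))
                      (*-congˡ (*-congˡ (1^n≈1 (l ℕ.+ c ∸ c)))) ⟨
          α * monomial z (l ℕ.+ c) c + β * monomial 1# (l ℕ.+ c) c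
            ∎
          where X = x ^ (l ℕ.+ c)

        total-monomial : total M (monomial y) ≈
          1# + u * (α * total M (monomial z) + β * total M (monomial 1#))
        total-monomial = begin
          total M f
            ≈⟨ total-top geometric t^N≈0 1≤N f ⟩
          1# * 1# + u * total 0 f
            ≈⟨ +-cong (*-identityˡ 1#) (*-congˡ (trans (total-columns M f ℕ.≤-refl)
                 (trans (total-cong M columns-monomial) (total-comb M α _ β _)))) ⟩
          1# + u * (α * total M (monomial z) + β * total M (monomial 1#))
            ∎

private
  variable
    m n : ℕ

-- Statistics of words

module ℕ-Sum = MonoidSum ℕ.+-0-commutativeMonoid

𝟙 : {A : Set} → Dec A → ℕ
𝟙 a? = if does a? then 1 else 0

𝟙-cong : {A B : Set} (a? : Dec A) (b? : Dec B) → A ⇔ B → 𝟙 a? ≡ 𝟙 b?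
𝟙-cong a? b? A⇔B = ≡.cong (if_then 1 else 0) (does-⇔ A⇔B a? b?)

length-filter : {A : Set} {P : Pred A 0ℓ} (P? : Decidable P) (f : Fin n → A) →
                length (filter P? (List.tabulate f)) ≡ ℕ-Sum.sum (λ i → 𝟙 (P? (f i)))
length-filter {zero}  P? f = ≡.refl
length-filter {suc n} P? f with does (P? (f zero))
... | true  = ≡.cong suc (length-filter P? (f ∘ suc))
... | false = length-filter P? (f ∘ suc)

count-sum : {P : Pred (Fin n) 0ℓ} (P? : Decidable P) → count P? ≡ ℕ-Sum.sum (λ i → 𝟙 (P? i))
count-sum P? = length-filter P? (λ i → i)

count-suc : {P : Pred (Fin (suc n)) 0ℓ} (P? : Decidable P) →
            count P? ≡ 𝟙 (P? zero) ℕ.+ count (P? ∘ suc)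
count-suc P? = ≡.trans (count-sum P?) (≡.cong (𝟙 (P? zero) ℕ.+_) (≡.sym (count-sum (P? ∘ suc))))

count-cong : {P Q : Pred (Fin n) 0ℓ} (P? : Decidable P) (Q? : Decidable Q) →
             (∀ i → P i ⇔ Q i) → count P? ≡ count Q?
count-cong P? Q? P⇔Q = ≡.trans (count-sum P?)
  (≡.trans (ℕ-Sum.sum-cong-≗ (λ i → 𝟙-cong (P? i) (Q? i) (P⇔Q i))) (≡.sym (count-sum Q?)))

count-permute : {P : Pred (Fin n) 0ℓ} {Q : Pred (Fin m) 0ℓ} (P? : Decidable P) (Q? : Decidable Q)
                (π : Permutation m n) → (∀ i → P (π ⟨$⟩ʳ i) ⇔ Q i) → count P? ≡ count Q?
count-permute P? Q? π P⇔Q = ≡.trans (count-sum P?) (≡.trans (ℕ-Sum.sum-permute _ π)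
  (≡.trans (ℕ-Sum.sum-cong-≗ (λ i → 𝟙-cong (P? (π ⟨$⟩ʳ i)) (Q? i) (P⇔Q i))) (≡.sym (count-sum Q?))))

descents : (Fin n → Fin m) → ℕ
descents {zero}  w = 0
descents {suc n} w = count (λ (i : Fin n) → w (suc i) <? w (inject₁ i))

minimum? : (w : Fin n → Fin m) → Decidable (λ i → ∀ j → j Fin.< i → w i Fin.< w j)
minimum? w i = all? λ j → (j <? i) →-dec (w i <? w j)

maximum? : (w : Fin n → Fin m) → Decidable (λ i → ∀ j → i Fin.< j → w j Fin.< w i)
maximum? w i = all? λ j → (i <? j) →-dec (w j <? w i)

low? : ∀ e (w : Fin n → Fin m) →
       Decidable (λ i → toℕ (w i) < e × (∀ j → j Fin.< i → w i Fin.< w j))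
low? e w i = (suc (toℕ (w i)) ≤? e) ×-dec minimum? w i

minima maxima : (Fin n → Fin m) → ℕ
minima w = count (minimum? w)
maxima w = count (maximum? w)

-- height w is 0 for the empty word and 1 + max w otherwise.
height : (Fin n → Fin m) → ℕ
height {zero}  w = 0
height {suc n} w =
  if does (height (w ∘ suc) ≤? toℕ (w zero)) then suc (toℕ (w zero)) else height (w ∘ suc)

height-≤⇒ : ∀ (w : Fin n → Fin m) {k} → height w ≤ k → ∀ i → toℕ (w i) < k
height-≤⇒ {suc n} w h≤k i with does (height (w ∘ suc) ≤? toℕ (w zero)) | proof (height (w ∘ suc) ≤? toℕ (w zero))
height-≤⇒ w h≤k zero    | true  | _       = h≤k
height-≤⇒ w h≤k (suc i) | true  | ofʸ h≤w = ℕ.<-≤-trans (height-≤⇒ (w ∘ suc) h≤w i) (ℕ.<⇒≤ h≤k)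
height-≤⇒ w h≤k zero    | false | ofⁿ h≰w = ℕ.<-≤-trans (ℕ.≰⇒> h≰w) h≤k
height-≤⇒ w h≤k (suc i) | false | _       = height-≤⇒ (w ∘ suc) h≤k i

⇒height-≤ : ∀ (w : Fin n → Fin m) {k} → (∀ i → toℕ (w i) < k) → height w ≤ k
⇒height-≤ {zero}  w w<k = z≤n
⇒height-≤ {suc n} w w<k with does (height (w ∘ suc) ≤? toℕ (w zero))
... | true  = w<k zero
... | false = ⇒height-≤ (w ∘ suc) (w<k ∘ suc)

-- The bound `e` is the least letter to the left (`m` at the start), so a left-to-right minimum is
-- recognised by `w zero < e`.
lows : ℕ → (Fin n → Fin m) → ℕ
lows {zero}  e w = 0
lows {suc n} e w = 𝟙 (suc (toℕ (w zero)) ≤? e) ℕ.+ lows (e ⊓ toℕ (w zero)) (w ∘ suc)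

highs : (Fin n → Fin m) → ℕ
highs {zero}  w = 0
highs {suc n} w = 𝟙 (height (w ∘ suc) ≤? toℕ (w zero)) ℕ.+ highs (w ∘ suc)

lows≡count : ∀ e (w : Fin n → Fin m) → lows e w ≡ count (low? e w)
lows≡count {zero}  e w = ≡.refl
lows≡count {suc n} e w = ≡.sym (≡.trans (count-suc (low? e w)) (≡.cong₂ ℕ._+_
  (𝟙-cong (low? e w zero) (suc (toℕ (w zero)) ≤? e) (mk⇔ proj₁ (λ w<e → w<e , λ j ())))
  (≡.trans (count-cong (low? e w ∘ suc) (low? (e ⊓ toℕ (w zero)) (w ∘ suc)) (λ i → mk⇔
    (λ (w<e , w<) → ℕ.⊓-glb w<e (w< zero (s≤s z≤n)) , λ j j<i → w< (suc j) (s≤s j<i))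
    (λ (w<e , w<) → ℕ.m≤n⊓o⇒m≤n e _ w<e ,
      λ { zero _ → ℕ.m≤n⊓o⇒m≤o e _ w<e ; (suc j) (s≤s j<i) → w< j j<i })))
    (≡.sym (lows≡count (e ⊓ toℕ (w zero)) (w ∘ suc))))))

lows≡minima : (w : Fin n → Fin m) → lows m w ≡ minima w
lows≡minima {m = m} w = ≡.trans (lows≡count m w)
  (count-cong (low? m w) (minimum? w) (λ i → mk⇔ proj₂ (Fin.toℕ<n (w i) ,_)))

highs≡maxima : (w : Fin n → Fin m) → highs w ≡ maxima w
highs≡maxima {zero}  w = ≡.refl
highs≡maxima {suc n} w = ≡.sym (≡.trans (count-suc (maximum? w)) (≡.cong₂ ℕ._+_
  (𝟙-cong (maximum? w zero) (height (w ∘ suc) ≤? toℕ (w zero)) (mk⇔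
    (λ w< → ⇒height-≤ (w ∘ suc) (λ j → w< (suc j) (s≤s z≤n)))
    (λ { h≤w (suc j) _ → height-≤⇒ (w ∘ suc) h≤w j })))
  (≡.trans (count-cong (maximum? w ∘ suc) (maximum? (w ∘ suc)) (λ i → mk⇔
    (λ w< j i<j → w< (suc j) (s≤s i<j))
    (λ { w< (suc j) (s≤s i<j) → w< j i<j })))
    (≡.sym (highs≡maxima (w ∘ suc))))))

descents-suc : (w : Fin (suc (suc n)) → Fin m) →
               descents w ≡ 𝟙 (w (suc zero) <? w zero) ℕ.+ descents (w ∘ suc)
descents-suc w = count-suc (λ i → w (suc i) <? w (inject₁ i))

module Statistics {c ℓ : Level} (R : CommutativeRing c ℓ)
                  (t u v q s η : CommutativeRing.Carrier R) (M N : ℕ) where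
  open CommutativeRing R hiding (zero)
  open SemiringExp semiring
  open SetoidReasoning setoid
  open IntegerSolver R
  open Transfer R t u v q s η M N

  -- A family closed under `prepend`. If `e` is the least letter on the left, `c ≤ e` says that none
  -- of the letters there breaks a promise.
  bounded : (ℕ → Carrier) → ℕ → StateFunction
  bounded φ e d c = if does (c ≤? e) then φ d else 0#

  raise : (ℕ → Carrier) → ℕ → ℕ → Carrier
  raise φ b d = if does (d ≤? b) then v * φ (suc b) else φ d

  -- The marked and the unmarked branch recombine: a mark at `b` is honoured exactly if `b < e`,
  -- that is, at a left-to-right minimum, which then has weight `1 + (q - 1)`; any other letter
  -- keeps weight 1.
  prepend-bounded : ∀ φ e b d c →
    prepend b (bounded φ e) d c ≈ q ^ 𝟙 (suc b ≤? e) * bounded (raise φ b) (e ⊓ b) d c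
  prepend-bounded φ e b d c with does (suc b ≤? e) | proof (suc b ≤? e)
  ... | true | ofʸ b<e
    rewrite ℕ.m≥n⇒m⊓n≡n (ℕ.<⇒≤ b<e)
    with does (c ≤? b) | proof (c ≤? b)
  ...   | false | _ = sym (zeroʳ _)
  ...   | true  | ofʸ c≤b
    rewrite dec-true (c ≤? e) (ℕ.≤-trans c≤b (ℕ.<⇒≤ b<e))
    with does (d ≤? b)
  ...     | true  = solve 3 (λ v q f → v :* (f :+ (q :- :1) :* f) := q :* :1 :* (v :* f)) refl v q _
  ...     | false = solve 2 (λ q f → f :+ (q :- :1) :* f := q :* :1 :* f) refl q _
  prepend-bounded φ e b d c | false | ofⁿ b≮e
    rewrite ℕ.m≤n⇒m⊓n≡m (ℕ.≮⇒≥ b≮e)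
    with does (c ≤? b) | proof (c ≤? b)
  ...   | false | ofⁿ c≰b
    rewrite dec-false (c ≤? e) (λ c≤e → c≰b (ℕ.≤-trans c≤e (ℕ.≮⇒≥ b≮e))) = sym (zeroʳ _)
  ...   | true  | ofʸ c≤b
    with does (d ≤? b) | does (c ≤? e)
  ...     | true  | true  = solve 3 (λ v q f → v :* (f :+ (q :- :1) :* :0) := :1 :* (v :* f)) refl v q _
  ...     | true  | false = solve 2 (λ v q → v :* (:0 :+ (q :- :1) :* :0) := :1 :* :0) refl v q
  ...     | false | true  = solve 2 (λ q f → f :+ (q :- :1) :* :0 := :1 :* f) refl q _
  ...     | false | false = solve 1 (λ q → :0 :+ (q :- :1) :* :0 := :1 :* :0) refl q

  val-scale : ∀ {n} (w : Word n) k f → val w (λ d c → k * f d c) ≈ k * val w f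
  val-scale w k f = begin
    val w (λ d c → k * f d c)    ≈⟨ val-cong w (λ d c _ _ → sym (trans (+-congˡ (zeroˡ _)) (+-identityʳ _))) ⟩
    val w (comb k f 0# f)        ≈⟨ val-comb w k f 0# f ⟩
    k * val w f + 0# * val w f   ≈⟨ trans (+-congˡ (zeroˡ _)) (+-identityʳ _) ⟩
    k * val w f                  ∎

  val-bounded : ∀ {n} φ e (w : Word n) →
    val w (bounded φ e) ≈ q ^ lows e w * (v ^ highs w * φ (height w))
  val-bounded {zero}  φ e w = sym (trans (*-identityˡ _) (*-identityˡ _))
  val-bounded {suc n} φ e w = begin
    val w′ (prepend b (bounded φ e))
      ≈⟨ val-cong w′ (λ d c _ _ → prepend-bounded φ e b d c) ⟩
    val w′ (λ d c → q ^ k * bounded (raise φ b) (e ⊓ b) d c)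
      ≈⟨ val-scale w′ (q ^ k) (bounded (raise φ b) (e ⊓ b)) ⟩
    q ^ k * val w′ (bounded (raise φ b) (e ⊓ b))
      ≈⟨ *-congˡ (val-bounded (raise φ b) (e ⊓ b) w′) ⟩
    q ^ k * (q ^ lows (e ⊓ b) w′ * (v ^ highs w′ * raise φ b (height w′)))
      ≈⟨ trans (sym (*-assoc _ _ _)) (*-congʳ (sym (^-homo-* q k (lows (e ⊓ b) w′)))) ⟩
    q ^ (k ℕ.+ lows (e ⊓ b) w′) * (v ^ highs w′ * raise φ b (height w′))
      ≈⟨ *-congˡ top ⟩
    q ^ lows e w * (v ^ highs w * φ (height w))
      ∎
    where
    w′ = w ∘ suc
    b  = toℕ (w zero)
    k  = 𝟙 (suc b ≤? e)
    top : v ^ highs w′ * raise φ b (height w′) ≈ v ^ highs w * φ (height w)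
    top with does (height w′ ≤? b)
    ... | true  = solve 3 (λ V v f → V :* (v :* f) := v :* V :* f) refl _ v _
    ... | false = refl

  -- On reachable states `c ≤ d ≤ M`, so the bound `M` is no restriction.
  val-minima-maxima : ∀ {n} φ (w : Word n) →
    val w (λ d c → φ d) ≈ q ^ minima w * (v ^ maxima w * φ (height w))
  val-minima-maxima φ w = begin
    val w (λ d c → φ d)
      ≈⟨ val-cong w (λ d c c≤d d≤M → reflexive (≡.sym (≡.cong (if_then φ d else 0#)
           (dec-true (c ≤? M) (ℕ.≤-trans c≤d d≤M))))) ⟩
    val w (bounded φ M)
      ≈⟨ val-bounded φ M w ⟩
    q ^ lows M w * (v ^ highs w * φ (height w))
      ≡⟨ ≡.cong₂ (λ k l → q ^ k * (v ^ l * φ (height w))) (lows≡minima w) (highs≡maxima w) ⟩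
    q ^ minima w * (v ^ maxima w * φ (height w))
      ∎

  -- A cut is forced exactly at a descent. Each place after a letter, the end of the word included,
  -- admits any number of further cuts and gives one `η`.
  rows-descents : ∀ {n} (w : Word (suc n)) →
    rows (toℕ (w zero)) (w ∘ suc) ≈ u ^ descents w * η ^ suc n
  rows-descents {zero}  w = sym (trans (*-identityˡ _) (*-identityʳ η))
  rows-descents {suc n} w rewrite descents-suc w
    with does (toℕ (w zero) ≤? toℕ (w (suc zero))) | proof (toℕ (w zero) ≤? toℕ (w (suc zero)))
       | does (w (suc zero) <? w zero) | proof (w (suc zero) <? w zero)
  ... | true  | ofʸ w₀≤w₁ | true  | ofʸ w₁<w₀ = contradiction w₀≤w₁ (ℕ.<⇒≱ w₁<w₀)
  ... | true  | _         | false | _         = trans (*-congˡ (rows-descents (w ∘ suc)))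
    (solve 3 (λ η U H → η :* (U :* H) := U :* (η :* H)) refl η _ _)
  ... | false | _         | true  | _         = trans (*-congˡ (rows-descents (w ∘ suc)))
    (solve 4 (λ u η U H → u :* η :* (U :* H) := u :* U :* (η :* H)) refl u η _ _)
  ... | false | ofⁿ w₀≰w₁ | false | ofⁿ w₁≮w₀ = contradiction (ℕ.≮⇒≥ w₁≮w₀) w₀≰w₁

private
  variable
    k : ℕ

-- Standardisation

-- Agree w π: π is the standardisation of the word w.
Agree : (Fin n → Fin m) → (Fin n → Fin k) → Set
Agree w π = ∀ i j → i Fin.< j →
  (π i Fin.< π j → w i Fin.≤ w j) × (w i Fin.≤ w j → π i Fin.< π j)

agree? : (w : Fin n → Fin m) (π : Fin n → Fin k) → Dec (Agree w π)
agree? w π = all? λ i → all? λ j → (i <? j) →-dec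
  (((π i <? π j) →-dec (w i Fin.≤? w j)) ×-dec ((w i Fin.≤? w j) →-dec (π i <? π j)))

agree-resp : ∀ {w w′ : Fin n → Fin m} {π : Fin n → Fin k} → w ≗ w′ → Agree w π → Agree w′ π
agree-resp w≗w′ agree i j i<j
  rewrite ≡.sym (w≗w′ i) | ≡.sym (w≗w′ j) = agree i j i<j

module _ {n m : ℕ} {w : Fin n → Fin m} (π : Permutation′ n) (agree : Agree w (π ⟨$⟩ʳ_)) where

  private
    π-injective : ∀ {i j} → π ⟨$⟩ʳ i ≡ π ⟨$⟩ʳ j → i ≡ j
    π-injective {i} {j} eq = ≡.trans (≡.sym (Perm.inverseˡ π)) (≡.trans (≡.cong (π ⟨$⟩ˡ_) eq) (Perm.inverseˡ π))

  agree-< : ∀ i j → i Fin.< j → w j Fin.< w i ⇔ π ⟨$⟩ʳ j Fin.< π ⟨$⟩ʳ i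
  agree-< i j i<j = mk⇔
    (λ wj<wi → ℕ.≤∧≢⇒< (ℕ.≮⇒≥ λ πi<πj → ℕ.<⇒≱ wj<wi (proj₁ (agree i j i<j) πi<πj))
      λ πj≡πi → ℕ.<⇒≢ i<j (≡.cong toℕ (≡.sym (π-injective (Fin.toℕ-injective πj≡πi)))))
    (λ πj<πi → ℕ.≰⇒> λ wi≤wj → ℕ.<⇒≯ πj<πi (proj₂ (agree i j i<j) wi≤wj))

  agree-maxima : maxima w ≡ maxima (π ⟨$⟩ʳ_)
  agree-maxima = count-cong (maximum? w) (maximum? (π ⟨$⟩ʳ_)) (λ i → mk⇔
    (λ w< j i<j → Equivalence.to (agree-< i j i<j) (w< j i<j))
    (λ π< j i<j → Equivalence.from (agree-< i j i<j) (π< j i<j)))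

  agree-minima : minima w ≡ minima (π ⟨$⟩ʳ_)
  agree-minima = count-cong (minimum? w) (minimum? (π ⟨$⟩ʳ_)) (λ i → mk⇔
    (λ w< j j<i → Equivalence.to (agree-< j i j<i) (w< j j<i))
    (λ π< j j<i → Equivalence.from (agree-< j i j<i) (π< j j<i)))

agree-descents : ∀ {w : Fin (suc n) → Fin m} (π : Permutation′ (suc n)) → Agree w (π ⟨$⟩ʳ_) →
                 descents w ≡ descents (π ⟨$⟩ʳ_)
agree-descents {w = w} π agree =
  count-cong (λ i → w (suc i) <? w (inject₁ i)) (λ i → π ⟨$⟩ʳ suc i <? π ⟨$⟩ʳ inject₁ i)
    (λ i → agree-< π agree (inject₁ i) (suc i) (s≤s (ℕ.≤-reflexive (Fin.toℕ-inject₁ i))))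

<-punchIn : ∀ (j : Fin (suc n)) k → j Fin.< punchIn j k ⇔ j Fin.≤ k
<-punchIn zero    k       = mk⇔ (λ _ → z≤n) (λ _ → s≤s z≤n)
<-punchIn (suc j) zero    = mk⇔ (λ ()) (λ ())
<-punchIn (suc j) (suc k) = mk⇔ (λ { (s≤s j<) → s≤s (Equivalence.to (<-punchIn j k) j<) })
                                (λ { (s≤s j≤) → s≤s (Equivalence.from (<-punchIn j k) j≤) })

punchIn-< : ∀ (j : Fin (suc n)) k l → punchIn j k Fin.< punchIn j l ⇔ k Fin.< l
punchIn-< j k l = mk⇔
  (λ p → ℕ.≰⇒> (λ l≤k → ℕ.<⇒≱ p (Fin.punchIn-mono-≤ j l k l≤k)))
  (λ k<l → ℕ.≰⇒> (λ p → ℕ.<⇒≱ k<l (Fin.punchIn-cancel-≤ j l k p)))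

Cut : (Fin n → Set) → Fin (suc n) → Set
Cut U j = ∀ k → (toℕ j ≤ toℕ k → U k) × (U k → toℕ j ≤ toℕ k)

cut? : {U : Fin n → Set} → Decidable U → Decidable (Cut U)
cut? U? j = all? λ k → ((toℕ j ≤? toℕ k) →-dec U? k) ×-dec (U? k →-dec (toℕ j ≤? toℕ k))

-- Here `b` is the sorted rearrangement of the word. A new first letter `a` is ranked before all its
-- equals, so it gets rank `j` precisely if the entries of `b` from `j` on are those `≥ a`.
agree-insert : ∀ (π : Permutation′ n) (b : Fin n → Fin m) a j →
  Agree (a Vector.∷ (b ∘ (π ⟨$⟩ʳ_))) (insert zero j π ⟨$⟩ʳ_) ⇔
  (Agree (b ∘ (π ⟨$⟩ʳ_)) (π ⟨$⟩ʳ_) × Cut (λ k → a Fin.≤ b k) j)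
agree-insert π b a j = mk⇔
  (λ agree →
    (λ i l i<l →
      (λ πi<πl → proj₁ (agree (suc i) (suc l) (s≤s i<l)) (Equivalence.from (punchIn-< j _ _) πi<πl)) ,
      (λ bi≤bl → Equivalence.to (punchIn-< j _ _) (proj₂ (agree (suc i) (suc l) (s≤s i<l)) bi≤bl))) ,
    (λ k → ≡.subst (λ k → (toℕ j ≤ toℕ k → a Fin.≤ b k) × (a Fin.≤ b k → toℕ j ≤ toℕ k))
      (Perm.inverseʳ π {k})
      ((λ j≤k → proj₁ (agree zero (suc (π ⟨$⟩ˡ k)) (s≤s z≤n)) (Equivalence.from (<-punchIn j _) j≤k)) ,
       (λ a≤b → Equivalence.to (<-punchIn j _) (proj₂ (agree zero (suc (π ⟨$⟩ˡ k)) (s≤s z≤n)) a≤b)))))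
  (λ (agree , cut) →
    λ { zero zero ()
      ; zero (suc l) _ →
          (λ j<π → proj₁ (cut (π ⟨$⟩ʳ l)) (Equivalence.to (<-punchIn j _) j<π)) ,
          (λ a≤b → Equivalence.from (<-punchIn j _) (proj₂ (cut (π ⟨$⟩ʳ l)) a≤b))
      ; (suc i) zero ()
      ; (suc i) (suc l) (s≤s i<l) →
          (λ πi<πl → proj₁ (agree i l i<l) (Equivalence.to (punchIn-< j _ _) πi<πl)) ,
          (λ bi≤bl → Equivalence.from (punchIn-< j _ _) (proj₂ (agree i l i<l) bi≤bl)) })

agree-sorted : ∀ (π : Permutation′ n) (b : Fin n → Fin m) → Agree (b ∘ (π ⟨$⟩ʳ_)) (π ⟨$⟩ʳ_) →
               ∀ k l → k Fin.≤ l → b k Fin.≤ b l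
agree-sorted π b agree k l k≤l with Fin.<-cmp (π ⟨$⟩ˡ k) (π ⟨$⟩ˡ l)
... | tri≈ _ eq _ = ℕ.≤-reflexive (≡.cong (toℕ ∘ b)
        (≡.trans (≡.sym (Perm.inverseʳ π)) (≡.trans (≡.cong (π ⟨$⟩ʳ_) eq) (Perm.inverseʳ π))))
... | tri< i<j i≢j _ = ≡.subst₂ (λ k l → b k Fin.≤ b l) (Perm.inverseʳ π) (Perm.inverseʳ π)
        (proj₁ (agree _ _ i<j) (≡.subst₂ Fin._<_ (≡.sym (Perm.inverseʳ π)) (≡.sym (Perm.inverseʳ π))
          (ℕ.≤∧≢⇒< k≤l (λ k≡l → i≢j (≡.cong (π ⟨$⟩ˡ_) (Fin.toℕ-injective k≡l))))))
... | tri> _ _ j<i = ≡.subst₂ (λ k l → b k Fin.≤ b l) (Perm.inverseʳ π) (Perm.inverseʳ π)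
        (ℕ.<⇒≤ (ℕ.≰⇒> λ bl≤bk → ℕ.<⇒≱
          (≡.subst₂ Fin._<_ (Perm.inverseʳ π) (Perm.inverseʳ π) (proj₂ (agree _ _ j<i) bl≤bk)) k≤l))

module Standardisation {c ℓ : Level} (R : CommutativeRing c ℓ) where
  open CommutativeRing R hiding (zero)
  open SemiringSum semiring
  open SetoidReasoning setoid
  open IntegerSolver R
  open Words R

  ind : {A : Set} → Dec A → Carrier
  ind a? = if does a? then 1# else 0#

  ind-cong : {A B : Set} (a? : Dec A) (b? : Dec B) → A ⇔ B → ind a? ≈ ind b?
  ind-cong a? b? A⇔B = reflexive (≡.cong (if_then 1# else 0#) (does-⇔ A⇔B a? b?))

  ind-× : {A B : Set} (a? : Dec A) (b? : Dec B) → ind (a? ×-dec b?) ≈ ind a? * ind b?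
  ind-× a? b? with does a?
  ... | true  = sym (*-identityˡ _)
  ... | false = sym (zeroˡ _)

  ind-weaken : {A : Set} (a? : Dec A) {x y : Carrier} → (A → x ≈ y) → ind a? * x ≈ ind a? * y
  ind-weaken a? x≈y with does a? | proof a?
  ... | true  | ofʸ a = *-congˡ (x≈y a)
  ... | false | _     = trans (zeroˡ _) (sym (zeroˡ _))

  ∑-list : {A : Set} → List A → (A → Carrier) → Carrier
  ∑-list as f = foldr (λ a s → f a + s) 0# as

  ∑-list-cong : {A : Set} (as : List A) {f g : A → Carrier} → (∀ a → f a ≈ g a) → ∑-list as f ≈ ∑-list as g
  ∑-list-cong []       f≈g = refl
  ∑-list-cong (a ∷ as) f≈g = +-cong (f≈g a) (∑-list-cong as f≈g)

  ∑-list-++ : {A : Set} (as bs : List A) (f : A → Carrier) →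
              ∑-list (as List.++ bs) f ≈ ∑-list as f + ∑-list bs f
  ∑-list-++ []       bs f = sym (+-identityˡ _)
  ∑-list-++ (a ∷ as) bs f = trans (+-congˡ (∑-list-++ as bs f)) (sym (+-assoc _ _ _))

  ∑-list-map : {A B : Set} (g : A → B) (as : List A) (f : B → Carrier) →
               ∑-list (List.map g as) f ≈ ∑-list as (f ∘ g)
  ∑-list-map g []       f = refl
  ∑-list-map g (a ∷ as) f = +-congˡ (∑-list-map g as f)

  ∑-list-* : {A : Set} (as : List A) (k : Carrier) (f : A → Carrier) →
             ∑-list as (λ a → k * f a) ≈ k * ∑-list as f
  ∑-list-* []       k f = sym (zeroʳ k)
  ∑-list-* (a ∷ as) k f = trans (+-congˡ (∑-list-* as k f)) (sym (distribˡ k _ _))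

  ∑-list-+ : {A : Set} (as : List A) (f g : A → Carrier) →
             ∑-list as (λ a → f a + g a) ≈ ∑-list as f + ∑-list as g
  ∑-list-+ []       f g = sym (+-identityˡ 0#)
  ∑-list-+ (a ∷ as) f g = trans (+-congˡ (∑-list-+ as f g))
    (solve 4 (λ a b c d → (a :+ b) :+ (c :+ d) := (a :+ c) :+ (b :+ d)) refl (f a) (g a) _ _)

  ∑-list-0 : {A : Set} (as : List A) → ∑-list as (λ _ → 0#) ≈ 0#
  ∑-list-0 []       = refl
  ∑-list-0 (a ∷ as) = trans (+-identityˡ _) (∑-list-0 as)

  ∑-list-comm : {A B : Set} (as : List A) (bs : List B) (f : A → B → Carrier) →
                ∑-list as (λ a → ∑-list bs (f a)) ≈ ∑-list bs (λ b → ∑-list as (λ a → f a b))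
  ∑-list-comm []       bs f = sym (∑-list-0 bs)
  ∑-list-comm (a ∷ as) bs f = trans (+-congˡ (∑-list-comm as bs f))
                                    (sym (∑-list-+ bs (f a) _))

  ∑-list-∑ : {A : Set} (as : List A) (f : Fin n → A → Carrier) →
             ∑[ j < n ] ∑-list as (f j) ≈ ∑-list as (λ a → ∑[ j < n ] f j a)
  ∑-list-∑ {n} []       f = sum-replicate-zero n
  ∑-list-∑ {n} (a ∷ as) f = trans (∑-distrib-+ {n} (λ j → f j a) (λ j → ∑-list as (f j)))
                                  (+-congˡ (∑-list-∑ as f))

  ∑-word-∑ : ∀ n (f : Fin k → (Fin n → Fin m) → Carrier) →
             ∑[ j < k ] ∑-word n (f j) ≈ ∑-word n (λ w → ∑[ j < k ] f j w)
  ∑-word-∑ zero f = refl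
  ∑-word-∑ {k} {m} (suc n) f = trans (∑-comm {k} {m} (λ j a → ∑-word n (λ w → f j (a Vector.∷ w))))
    (sum-cong-≋ {m} (λ a → ∑-word-∑ n (λ j w → f j (a Vector.∷ w))))

  ∑-perm : ∀ n → (Permutation′ n → Carrier) → Carrier
  ∑-perm n = ∑-list (permutations n)

  ∑-perm-suc : ∀ n (f : Permutation′ (suc n) → Carrier) →
               ∑-perm (suc n) f ≈ ∑[ j < suc n ] ∑-perm n (f ∘ insert zero j)
  ∑-perm-suc n f = product {suc n} (λ j → j)
    where
    product : (g : Fin k → Fin (suc n)) →
      ∑-list (cartesianProductWith (insert zero) (List.tabulate g) (permutations n)) f
        ≈ ∑[ j < k ] ∑-perm n (f ∘ insert zero (g j))
    product {zero}  g = refl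
    product {suc k} g = trans (∑-list-++ (List.map (insert zero (g zero)) (permutations n)) _ f)
      (+-cong (∑-list-map (insert zero (g zero)) (permutations n) f) (product (g ∘ suc)))

  -- Any letter may be summed first. Words are functions compared pointwise, so `F` has to respect
  -- `_≗_`.
  ∑-word-insertAt : ∀ n (j : Fin (suc n)) (F : (Fin (suc n) → Fin m) → Carrier) →
    (∀ {w w′} → w ≗ w′ → F w ≈ F w′) →
    ∑-word (suc n) F ≈ ∑[ a < m ] ∑-word n (λ w → F (insertAt w j a))
  ∑-word-insertAt {m} n zero F F-cong =
    sum-cong-≋ {m} (λ a → ∑-word-cong n (λ w → F-cong (λ { zero → ≡.refl ; (suc i) → ≡.refl })))
  ∑-word-insertAt {m} (suc n) (suc j) F F-cong = begin
    ∑[ a < m ] ∑-word (suc n) (λ w → F (a Vector.∷ w))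
      ≈⟨ sum-cong-≋ {m} (λ a → ∑-word-insertAt n j (λ w → F (a Vector.∷ w))
           (λ w≗w′ → F-cong (λ { zero → ≡.refl ; (suc i) → w≗w′ i }))) ⟩
    ∑[ a < m ] ∑[ a′ < m ] ∑-word n (λ w → F (a Vector.∷ insertAt w j a′))
      ≈⟨ ∑-comm {m} {m} (λ a a′ → ∑-word n (λ w → F (a Vector.∷ insertAt w j a′))) ⟩
    ∑[ a′ < m ] ∑[ a < m ] ∑-word n (λ w → F (a Vector.∷ insertAt w j a′))
      ≈⟨ sum-cong-≋ {m} (λ a′ → sum-cong-≋ {m} (λ a → ∑-word-cong n (λ w →
           F-cong (λ { zero → ≡.refl ; (suc i) → ≡.refl })))) ⟩
    ∑[ a′ < m ] ∑[ a < m ] ∑-word n (λ w → F (insertAt (a Vector.∷ w) (suc j) a′))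
      ∎

  -- A final segment has exactly one starting point; this gives existence and uniqueness of the rank
  -- of a new letter.
  ∑-cut : {U : Fin n → Set} (U? : Decidable U) → (∀ k l → k Fin.≤ l → U k → U l) →
          ∑[ j < suc n ] ind (cut? U? j) ≈ 1#
  ∑-cut {zero}  U? mono = +-identityʳ 1#
  ∑-cut {suc n} {U} U? mono = go (U? zero)
    where
    go : Dec (U zero) → ∑[ j < suc (suc n) ] ind (cut? U? j) ≈ 1#
    go (yes U₀) = begin
      ind (cut? U? zero) + ∑[ j < suc n ] ind (cut? U? (suc j))
        ≈⟨ +-cong (reflexive (≡.cong (if_then 1# else 0#) (dec-true (cut? U? zero)
             (λ k → (λ _ → mono zero k z≤n U₀) , (λ _ → z≤n)))))
           (sum-cong-≋ {suc n} (λ j → reflexive (≡.cong (if_then 1# else 0#) (dec-false (cut? U? (suc j))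
             (λ cut → contradiction (proj₂ (cut zero) U₀) (λ ())))))) ⟩
      1# + ∑[ j < suc n ] 0#
        ≈⟨ +-congˡ (sum-replicate-zero (suc n)) ⟩
      1# + 0#
        ≈⟨ +-identityʳ 1# ⟩
      1#
        ∎
    go (no ¬U₀) = begin
      ind (cut? U? zero) + ∑[ j < suc n ] ind (cut? U? (suc j))
        ≈⟨ +-cong (reflexive (≡.cong (if_then 1# else 0#) (dec-false (cut? U? zero)
             (λ cut → ¬U₀ (proj₁ (cut zero) z≤n)))))
           (sum-cong-≋ {suc n} (λ j → ind-cong (cut? U? (suc j)) (cut? (U? ∘ suc) j) (mk⇔
             (λ cut k → (λ j≤k → proj₁ (cut (suc k)) (s≤s j≤k)) , (λ Uk → ℕ.s≤s⁻¹ (proj₂ (cut (suc k)) Uk)))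
             (λ { cut zero → (λ ()) , (λ U₀ → contradiction U₀ ¬U₀)
                ; cut (suc k) → (λ { (s≤s j≤k) → proj₁ (cut k) j≤k }) , (λ Uk → s≤s (proj₂ (cut k) Uk)) })))) ⟩
      0# + ∑[ j < suc n ] ind (cut? (U? ∘ suc) j)
        ≈⟨ +-identityˡ _ ⟩
      ∑[ j < suc n ] ind (cut? (U? ∘ suc) j)
        ≈⟨ ∑-cut {n} (U? ∘ suc) (λ k l k≤l → mono (suc k) (suc l) (s≤s k≤l)) ⟩
      1#
        ∎

  -- Words become pairs of a permutation and a sorted word `b`. In the induction on the first letter
  -- `a`, `choose` supplies its rank `j`, and `reindex` absorbs `a` into `b` at position `j`.
  standardise : ∀ n (F : (Fin n → Fin m) → Carrier) → (∀ {w w′} → w ≗ w′ → F w ≈ F w′) →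
    ∑-word n F ≈ ∑-perm n (λ π → ∑-word n (λ b →
      ind (agree? (b ∘ (π ⟨$⟩ʳ_)) (π ⟨$⟩ʳ_)) * F (b ∘ (π ⟨$⟩ʳ_))))
  standardise zero F F-cong = sym (trans (+-identityʳ _) (trans (*-identityˡ _) (F-cong (λ ()))))
  standardise {m} (suc n) F F-cong = begin
    ∑[ a < m ] ∑-word n (λ w → F (a Vector.∷ w))
      ≈⟨ sum-cong-≋ {m} (λ a → standardise n (λ w → F (a Vector.∷ w)) (λ w≗w′ → F-cong (∷-cong w≗w′))) ⟩
    ∑[ a < m ] ∑-perm n (λ π → ∑-word n (λ b → A b π * F (a Vector.∷ (b ∘ (π ⟨$⟩ʳ_)))))
      ≈⟨ sum-cong-≋ {m} (λ a → ∑-list-cong (permutations n) (λ π → ∑-word-cong n (λ b →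
           trans (*-congʳ (choose π b a)) (*-distribʳ-sum {suc n} _ (λ j → A′ j π a b))))) ⟩
    ∑[ a < m ] ∑-perm n (λ π → ∑-word n (λ b → ∑[ j < suc n ] T j π a b))
      ≈⟨ sum-cong-≋ {m} (λ a → trans
           (∑-list-cong (permutations n) (λ π → sym (∑-word-∑ {suc n} {m} n (λ j b → T j π a b))))
           (sym (∑-list-∑ {suc n} (permutations n) (λ j π → ∑-word n (T j π a))))) ⟩
    ∑[ a < m ] ∑[ j < suc n ] ∑-perm n (λ π → ∑-word n (T j π a))
      ≈⟨ ∑-comm {m} {suc n} (λ a j → ∑-perm n (λ π → ∑-word n (T j π a))) ⟩
    ∑[ j < suc n ] ∑[ a < m ] ∑-perm n (λ π → ∑-word n (T j π a))
      ≈⟨ sum-cong-≋ {suc n} (λ j → ∑-list-∑ {m} (permutations n) (λ a π → ∑-word n (T j π a))) ⟩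
    ∑[ j < suc n ] ∑-perm n (λ π → ∑[ a < m ] ∑-word n (T j π a))
      ≈⟨ sum-cong-≋ {suc n} (λ j → ∑-list-cong (permutations n) (reindex j)) ⟨
    ∑[ j < suc n ] ∑-perm n (λ π → ∑-word (suc n) (S (insert zero j π)))
      ≈⟨ ∑-perm-suc n (λ π → ∑-word (suc n) (S π)) ⟨
    ∑-perm (suc n) (λ π → ∑-word (suc n) (S π))
      ∎
    where
    ∷-cong : ∀ {a : Fin m} {w w′ : Fin k → Fin m} → w ≗ w′ → a Vector.∷ w ≗ a Vector.∷ w′
    ∷-cong w≗w′ zero    = ≡.refl
    ∷-cong w≗w′ (suc i) = w≗w′ i

    A : ∀ {k} → (Fin k → Fin m) → Permutation′ k → Carrier
    A b π = ind (agree? (b ∘ (π ⟨$⟩ʳ_)) (π ⟨$⟩ʳ_))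

    S : Permutation′ (suc n) → (Fin (suc n) → Fin m) → Carrier
    S π b = A b π * F (b ∘ (π ⟨$⟩ʳ_))

    A′ : Fin (suc n) → Permutation′ n → Fin m → (Fin n → Fin m) → Carrier
    A′ j π a b = ind (agree? (a Vector.∷ (b ∘ (π ⟨$⟩ʳ_))) (insert zero j π ⟨$⟩ʳ_))

    T : Fin (suc n) → Permutation′ n → Fin m → (Fin n → Fin m) → Carrier
    T j π a b = A′ j π a b * F (a Vector.∷ (b ∘ (π ⟨$⟩ʳ_)))

    choose : ∀ π b a → A b π ≈ ∑[ j < suc n ] A′ j π a b
    choose π b a = begin
      A b π
        ≈⟨ *-identityʳ _ ⟨
      A b π * 1#
        -- The cut is unique only for sorted `b`, which is known under the indicator `A b π`.
        ≈⟨ ind-weaken (agree? (b ∘ (π ⟨$⟩ʳ_)) (π ⟨$⟩ʳ_)) (λ agree →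
             ∑-cut (λ k → a Fin.≤? b k) (λ k l k≤l a≤bk → ℕ.≤-trans a≤bk (agree-sorted π b agree k l k≤l))) ⟨
      A b π * ∑[ j < suc n ] ind (cut? (λ k → a Fin.≤? b k) j)
        ≈⟨ *-distribˡ-sum {suc n} (A b π) (λ j → ind (cut? (λ k → a Fin.≤? b k) j)) ⟩
      ∑[ j < suc n ] (A b π * ind (cut? (λ k → a Fin.≤? b k) j))
        ≈⟨ sum-cong-≋ {suc n} (λ j → trans
             (ind-cong (agree? (a Vector.∷ (b ∘ (π ⟨$⟩ʳ_))) (insert zero j π ⟨$⟩ʳ_))
                       (agree? (b ∘ (π ⟨$⟩ʳ_)) (π ⟨$⟩ʳ_) ×-dec cut? (λ k → a Fin.≤? b k) j)
                       (agree-insert π b a j))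
             (ind-× (agree? (b ∘ (π ⟨$⟩ʳ_)) (π ⟨$⟩ʳ_)) (cut? (λ k → a Fin.≤? b k) j))) ⟨
      ∑[ j < suc n ] A′ j π a b
        ∎

    S-cong : ∀ π {b b′} → b ≗ b′ → S π b ≈ S π b′
    S-cong π b≗b′ = *-cong
      (ind-cong (agree? _ (π ⟨$⟩ʳ_)) (agree? _ (π ⟨$⟩ʳ_))
        (mk⇔ (agree-resp (b≗b′ ∘ (π ⟨$⟩ʳ_))) (agree-resp (≡.sym ∘ b≗b′ ∘ (π ⟨$⟩ʳ_)))))
      (F-cong (b≗b′ ∘ (π ⟨$⟩ʳ_)))

    reindex : ∀ j π → ∑-word (suc n) (S (insert zero j π)) ≈ ∑[ a < m ] ∑-word n (T j π a)
    reindex j π = trans (∑-word-insertAt {m} n j (S (insert zero j π)) (S-cong (insert zero j π)))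
      (sum-cong-≋ {m} (λ a → ∑-word-cong n (λ b → *-cong
        (ind-cong (agree? _ (insert zero j π ⟨$⟩ʳ_)) (agree? _ (insert zero j π ⟨$⟩ʳ_))
          (mk⇔ (agree-resp (inserted a b)) (agree-resp (≡.sym ∘ inserted a b))))
        (F-cong (inserted a b)))))
      where
      inserted : ∀ a b → insertAt b j a ∘ (insert zero j π ⟨$⟩ʳ_) ≗ a Vector.∷ (b ∘ (π ⟨$⟩ʳ_))
      inserted a b zero    = Vector.insertAt-lookup b j a
      inserted a b (suc i) = Vector.insertAt-punchIn b j a (π ⟨$⟩ʳ i)

-- Words with a given standardisation

Chain : ℕ → (Fin n → ℕ) → (Fin n → Fin m) → Set
Chain {zero}  e δ b = ⊤
Chain {suc n} e δ b = e ℕ.+ δ zero ≤ toℕ (b zero) × Chain (toℕ (b zero)) (δ ∘ suc) (b ∘ suc)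

chain? : ∀ e (δ : Fin n → ℕ) (b : Fin n → Fin m) → Dec (Chain e δ b)
chain? {zero}  e δ b = yes tt
chain? {suc n} e δ b = (e ℕ.+ δ zero ≤? toℕ (b zero)) ×-dec chain? (toℕ (b zero)) (δ ∘ suc) (b ∘ suc)

chain-step : ∀ (δ : Fin n → ℕ) (b : Fin (suc n) → Fin m) →
  Chain (toℕ (b zero)) δ (b ∘ suc) ⇔ (∀ k → toℕ (b (inject₁ k)) ℕ.+ δ k ≤ toℕ (b (suc k)))
chain-step {zero}  δ b = mk⇔ (λ _ ()) (λ _ → tt)
chain-step {suc n} δ b = mk⇔
  (λ { (p , c) zero → p ; (p , c) (suc k) → Equivalence.to (chain-step (δ ∘ suc) (b ∘ suc)) c k })
  (λ p → p zero , Equivalence.from (chain-step (δ ∘ suc) (b ∘ suc)) (p ∘ suc))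

final : ℕ → (Fin n → Fin m) → ℕ
final {zero}  e b = e
final {suc n} e b = final (toℕ (b zero)) (b ∘ suc)

final-last : ∀ e (b : Fin (suc n) → Fin m) → final e b ≡ toℕ (b (fromℕ n))
final-last {zero}  e b = ≡.refl
final-last {suc n} e b = final-last (toℕ (b zero)) (b ∘ suc)

steps⇒< : (_≺_ : Fin (suc n) → Fin (suc n) → Set) → (∀ {i j k} → i ≺ j → j ≺ k → i ≺ k) →
          (∀ k → inject₁ k ≺ suc k) → ∀ k l → k Fin.< l → k ≺ l
steps⇒< _≺_ ≺-trans step zero (suc zero) _ = step zero
steps⇒< _≺_ ≺-trans step zero (suc (suc l)) _ = ≺-trans (step zero)
  (steps⇒< (λ i j → suc i ≺ suc j) ≺-trans (step ∘ suc) zero (suc l) (s≤s z≤n))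
steps⇒< {suc n} _≺_ ≺-trans step (suc k) (suc l) (s≤s k<l) =
  steps⇒< (λ i j → suc i ≺ suc j) ≺-trans (step ∘ suc) k l k<l

module _ {n : ℕ} (π : Permutation′ (suc n)) where

  -- Equal letters are numbered from left to right, so `b` must increase strictly at `k` exactly if
  -- the value `suc k` stands to the left of `k` in `π`: an inverse descent.
  gap : Fin n → ℕ
  gap k = 𝟙 (π ⟨$⟩ˡ suc k <? π ⟨$⟩ˡ inject₁ k)

  ides-gap : ides π ≡ ℕ-Sum.sum gap
  ides-gap = count-sum (λ k → π ⟨$⟩ˡ suc k <? π ⟨$⟩ˡ inject₁ k)

  private
    module _ {m : ℕ} (b : Fin (suc n) → Fin m) where

      -- The order that standardisation sorts by: first the letter, then its position. Being
      -- transitive, it can be checked on neighbours.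
      _≺_ : Fin (suc n) → Fin (suc n) → Set
      k ≺ l = b k Fin.< b l ⊎ (toℕ (b k) ≡ toℕ (b l) × π ⟨$⟩ˡ k Fin.< π ⟨$⟩ˡ l)

      ≺-trans : ∀ {k l j} → k ≺ l → l ≺ j → k ≺ j
      ≺-trans (inj₁ p) (inj₁ q)           = inj₁ (ℕ.<-trans p q)
      ≺-trans (inj₁ p) (inj₂ (e , _))     = inj₁ (ℕ.<-≤-trans p (ℕ.≤-reflexive e))
      ≺-trans (inj₂ (e , _)) (inj₁ q)     = inj₁ (ℕ.≤-<-trans (ℕ.≤-reflexive e) q)
      ≺-trans (inj₂ (e , p)) (inj₂ (e′ , q)) = inj₂ (≡.trans e e′ , ℕ.<-trans p q)

      ≺-step : (∀ k → toℕ (b (inject₁ k)) ℕ.+ gap k ≤ toℕ (b (suc k))) → ∀ k → inject₁ k ≺ suc k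
      ≺-step steps k with does (π ⟨$⟩ˡ suc k <? π ⟨$⟩ˡ inject₁ k) | proof (π ⟨$⟩ˡ suc k <? π ⟨$⟩ˡ inject₁ k) | steps k
      ... | true  | _ | p = inj₁ (≡.subst (_≤ toℕ (b (suc k))) (ℕ.+-comm (toℕ (b (inject₁ k))) 1) p)
      ... | false | ofⁿ ≮ | p with ℕ.m≤n⇒m<n∨m≡n (≡.subst (_≤ toℕ (b (suc k))) (ℕ.+-identityʳ _) p)
      ...   | inj₁ lt = inj₁ lt
      ...   | inj₂ eq = inj₂ (eq , ℕ.≤∧≢⇒< (ℕ.≮⇒≥ ≮) (λ e → ℕ.1+n≢n (≡.trans
        (≡.sym (≡.cong toℕ (π⁻¹-injective (Fin.toℕ-injective e)))) (Fin.toℕ-inject₁ k))))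
        where
        π⁻¹-injective : ∀ {i j} → π ⟨$⟩ˡ i ≡ π ⟨$⟩ˡ j → i ≡ j
        π⁻¹-injective e = ≡.trans (≡.sym (Perm.inverseʳ π)) (≡.trans (≡.cong (π ⟨$⟩ʳ_) e) (Perm.inverseʳ π))

      steps⇒agree : (∀ k → toℕ (b (inject₁ k)) ℕ.+ gap k ≤ toℕ (b (suc k))) →
                    Agree (b ∘ (π ⟨$⟩ʳ_)) (π ⟨$⟩ʳ_)
      steps⇒agree steps i j i<j = to , from
        where
        ordered = steps⇒< _≺_ (λ {i} {j} {k} → ≺-trans {i} {j} {k}) (≺-step steps)

        to : π ⟨$⟩ʳ i Fin.< π ⟨$⟩ʳ j → b (π ⟨$⟩ʳ i) Fin.≤ b (π ⟨$⟩ʳ j)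
        to πi<πj with ordered _ _ πi<πj
        ... | inj₁ lt       = ℕ.<⇒≤ lt
        ... | inj₂ (eq , _) = ℕ.≤-reflexive eq

        from : b (π ⟨$⟩ʳ i) Fin.≤ b (π ⟨$⟩ʳ j) → π ⟨$⟩ʳ i Fin.< π ⟨$⟩ʳ j
        from bi≤bj with Fin.<-cmp (π ⟨$⟩ʳ i) (π ⟨$⟩ʳ j)
        ... | tri< lt _ _ = lt
        ... | tri≈ _ eq _ = contradiction
          (≡.cong toℕ (≡.trans (≡.sym (Perm.inverseˡ π)) (≡.trans (≡.cong (π ⟨$⟩ˡ_) eq) (Perm.inverseˡ π))))
          (ℕ.<⇒≢ i<j)
        ... | tri> _ _ gt with ordered _ _ gt
        ...   | inj₁ bj<bi    = contradiction bi≤bj (ℕ.<⇒≱ bj<bi)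
        ...   | inj₂ (_ , lt) = contradiction
          (≡.subst₂ Fin._<_ (Perm.inverseˡ π) (Perm.inverseˡ π) lt) (ℕ.<⇒≯ i<j)

      agree⇒steps : Agree (b ∘ (π ⟨$⟩ʳ_)) (π ⟨$⟩ʳ_) →
                    ∀ k → toℕ (b (inject₁ k)) ℕ.+ gap k ≤ toℕ (b (suc k))
      agree⇒steps agree k with does (π ⟨$⟩ˡ suc k <? π ⟨$⟩ˡ inject₁ k) | proof (π ⟨$⟩ˡ suc k <? π ⟨$⟩ˡ inject₁ k)
      ... | false | _ = ≡.subst (_≤ toℕ (b (suc k))) (≡.sym (ℕ.+-identityʳ _))
        (agree-sorted π b agree (inject₁ k) (suc k) (Fin.i≤inject₁[j]⇒i≤1+j ℕ.≤-refl))
      ... | true | ofʸ lt = ≡.subst (_≤ toℕ (b (suc k))) (ℕ.+-comm 1 (toℕ (b (inject₁ k)))) (ℕ.≰⇒> λ b≤ →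
        ℕ.<⇒≱ (≡.subst₂ Fin._<_ (Perm.inverseʳ π) (Perm.inverseʳ π)
                (proj₂ (agree _ _ lt) (≡.subst₂ (λ i j → b i Fin.≤ b j)
                  (≡.sym (Perm.inverseʳ π)) (≡.sym (Perm.inverseʳ π)) b≤)))
          (Fin.i≤inject₁[j]⇒i≤1+j (ℕ.≤-refl {toℕ (inject₁ k)})))

  agree⇔chain : ∀ (b : Fin (suc n) → Fin m) →
    Agree (b ∘ (π ⟨$⟩ʳ_)) (π ⟨$⟩ʳ_) ⇔ Chain 0 (0 Vector.∷ gap) b
  agree⇔chain b = mk⇔
    (λ agree → z≤n , Equivalence.from (chain-step gap b) (agree⇒steps b agree))
    (λ (_ , chain) → steps⇒agree b (Equivalence.to (chain-step gap b) chain))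

  agree-height : ∀ (b : Fin (suc n) → Fin m) → Agree (b ∘ (π ⟨$⟩ʳ_)) (π ⟨$⟩ʳ_) →
                 height (b ∘ (π ⟨$⟩ʳ_)) ≡ suc (final 0 b)
  agree-height b agree = ≡.trans (ℕ.≤-antisym
    (⇒height-≤ (b ∘ (π ⟨$⟩ʳ_)) (λ i → s≤s (agree-sorted π b agree _ (fromℕ n) (Fin.≤fromℕ _))))
    (≡.subst (λ k → toℕ (b k) < height (b ∘ (π ⟨$⟩ʳ_))) (Perm.inverseʳ π)
      (height-≤⇒ (b ∘ (π ⟨$⟩ʳ_)) ℕ.≤-refl (π ⟨$⟩ˡ fromℕ n))))
    (≡.cong suc (≡.sym (final-last 0 b)))

descents-cong : {w w′ : Fin n → Fin m} → w ≗ w′ → descents w ≡ descents w′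
descents-cong {zero}  w≗w′ = ≡.refl
descents-cong {suc n} {w = w} {w′} w≗w′ = count-cong (λ i → w (suc i) <? w (inject₁ i)) (λ i → w′ (suc i) <? w′ (inject₁ i))
  (λ i → mk⇔ (≡.subst₂ Fin._<_ (w≗w′ (suc i)) (w≗w′ (inject₁ i)))
             (≡.subst₂ Fin._<_ (≡.sym (w≗w′ (suc i))) (≡.sym (w≗w′ (inject₁ i)))))

minima-cong : {w w′ : Fin n → Fin m} → w ≗ w′ → minima w ≡ minima w′
minima-cong {w = w} {w′} w≗w′ = count-cong (minimum? w) (minimum? w′)
  (λ i → mk⇔ (λ p j j<i → ≡.subst₂ Fin._<_ (w≗w′ i) (w≗w′ j) (p j j<i))
             (λ p j j<i → ≡.subst₂ Fin._<_ (≡.sym (w≗w′ i)) (≡.sym (w≗w′ j)) (p j j<i)))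

maxima-cong : {w w′ : Fin n → Fin m} → w ≗ w′ → maxima w ≡ maxima w′
maxima-cong {w = w} {w′} w≗w′ = count-cong (maximum? w) (maximum? w′)
  (λ i → mk⇔ (λ p j i<j → ≡.subst₂ Fin._<_ (w≗w′ j) (w≗w′ i) (p j i<j))
             (λ p j i<j → ≡.subst₂ Fin._<_ (≡.sym (w≗w′ j)) (≡.sym (w≗w′ i)) (p j i<j)))

height-cong : {w w′ : Fin n → Fin m} → w ≗ w′ → height w ≡ height w′
height-cong {w = w} {w′} w≗w′ = ℕ.≤-antisym
  (⇒height-≤ w (λ i → ≡.subst (λ a → toℕ a < height w′) (≡.sym (w≗w′ i)) (height-≤⇒ w′ ℕ.≤-refl i)))
  (⇒height-≤ w′ (λ i → ≡.subst (λ a → toℕ a < height w) (w≗w′ i) (height-≤⇒ w ℕ.≤-refl i)))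

module WordsToPermutations {c ℓ : Level} (R : CommutativeRing c ℓ) where
  open CommutativeRing R hiding (zero)
  open SemiringExp semiring
  open SemiringSum semiring
  open SetoidReasoning setoid
  open IntegerSolver R
  open Words R
  open Standardisation R

  module _ (x ξ : Carrier) (M : ℕ) (ξ-inverse : ξ * (1# - x) ≈ 1#) (x^M≈0 : x ^ M ≈ 0#) where

    ∑-threshold : ∀ k → ∑[ a < M ] (ind (k ≤? toℕ a) * x ^ toℕ a) ≈ ξ * x ^ k
    ∑-threshold k = begin
      ∑[ a < M ] (ind (k ≤? toℕ a) * x ^ toℕ a)
        ≈⟨ +-identityʳ _ ⟨
      ∑[ a < M ] (ind (k ≤? toℕ a) * x ^ toℕ a) + 0#
        ≈⟨ +-congˡ (trans (*-congˡ vanish) (zeroʳ ξ)) ⟨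
      ∑[ a < M ] (ind (k ≤? toℕ a) * x ^ toℕ a) + ξ * x ^ (k ⊔ M)
        ≈⟨ threshold M k ⟩
      ξ * x ^ k
        ∎
      where
      vanish : x ^ (k ⊔ M) ≈ 0#
      vanish = begin
        x ^ (k ⊔ M)                      ≡⟨ ≡.cong (x ^_) (≡.sym (ℕ.m+[n∸m]≡n (ℕ.m≤n⊔m k M))) ⟩
        x ^ (M ℕ.+ (k ⊔ M ∸ M))          ≈⟨ ^-homo-* x M (k ⊔ M ∸ M) ⟩
        x ^ M * x ^ (k ⊔ M ∸ M)          ≈⟨ trans (*-congʳ x^M≈0) (zeroˡ _) ⟩
        0#                               ∎

      shift : ∀ k M → ∑[ a < M ] (ind (k ≤? toℕ a) * (x * x ^ toℕ a)) ≈ x * ∑[ a < M ] (ind (k ≤? toℕ a) * x ^ toℕ a)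
      shift k M = trans (sum-cong-≋ {M} (λ a → solve 3 (λ i x y → i :* (x :* y) := x :* (i :* y)) refl (ind (k ≤? toℕ a)) x _))
                        (sym (*-distribˡ-sum {M} x (λ a → ind (k ≤? toℕ a) * x ^ toℕ a)))

      -- The exact finite geometric sum. The exponent `k ⊔ M` of the missing tail also covers
      -- `k > M`, where the sum is empty.
      threshold : ∀ M k → ∑[ a < M ] (ind (k ≤? toℕ a) * x ^ toℕ a) + ξ * x ^ (k ⊔ M) ≈ ξ * x ^ k
      threshold zero    k       = trans (+-identityˡ _) (*-congˡ (reflexive (≡.cong (x ^_) (ℕ.⊔-identityʳ k))))
      threshold (suc M) zero    = begin
        (1# * 1# + ∑[ a < M ] (ind (0 ≤? suc (toℕ a)) * (x * x ^ toℕ a))) + ξ * (x * x ^ M)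
          ≈⟨ +-congʳ (+-congˡ (shift 0 M)) ⟩
        (1# * 1# + x * ∑[ a < M ] (ind (0 ≤? toℕ a) * x ^ toℕ a)) + ξ * (x * x ^ M)
          ≈⟨ solve 4 (λ x S ξ X → (:1 :* :1 :+ x :* S) :+ ξ :* (x :* X) := :1 :+ x :* (S :+ ξ :* X)) refl x _ ξ _ ⟩
        1# + x * (∑[ a < M ] (ind (0 ≤? toℕ a) * x ^ toℕ a) + ξ * x ^ M)
          ≈⟨ +-cong (sym ξ-inverse) (*-congˡ (threshold M 0)) ⟩
        ξ * (1# - x) + x * (ξ * 1#)
          ≈⟨ solve 2 (λ ξ x → ξ :* (:1 :- x) :+ x :* (ξ :* :1) := ξ :* :1) refl ξ x ⟩
        ξ * 1#
          ∎
      threshold (suc M) (suc k) = begin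
        (0# * 1# + ∑[ a < M ] (ind (suc k ≤? suc (toℕ a)) * (x * x ^ toℕ a))) + ξ * (x * x ^ (k ⊔ M))
          ≈⟨ +-congʳ (+-congˡ (trans (sum-cong-≋ {M} (λ a → *-congʳ (ind-cong (suc k ≤? suc (toℕ a)) (k ≤? toℕ a)
               (mk⇔ ℕ.s≤s⁻¹ s≤s)))) (shift k M))) ⟩
        (0# * 1# + x * ∑[ a < M ] (ind (k ≤? toℕ a) * x ^ toℕ a)) + ξ * (x * x ^ (k ⊔ M))
          ≈⟨ solve 4 (λ x S ξ X → (:0 :* :1 :+ x :* S) :+ ξ :* (x :* X) := x :* (S :+ ξ :* X)) refl x _ ξ _ ⟩
        x * (∑[ a < M ] (ind (k ≤? toℕ a) * x ^ toℕ a) + ξ * x ^ (k ⊔ M))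
          ≈⟨ *-congˡ (threshold M k) ⟩
        x * (ξ * x ^ k)
          ≈⟨ solve 3 (λ x ξ X → x :* (ξ :* X) := ξ :* (x :* X)) refl x ξ _ ⟩
        ξ * (x * x ^ k)
          ∎

    -- The count of P-partitions along a chain: a letter summed from its lower bound on gives `ξ`
    -- and the power of `x` at that bound, so the increments add up in the exponent.
    ∑-chain : ∀ n e (δ : Fin n → ℕ) →
      ∑-word {M} n (λ b → ind (chain? e δ b) * x ^ final e b) ≈ x ^ (e ℕ.+ ℕ-Sum.sum δ) * ξ ^ n
    ∑-chain zero    e δ = trans (*-identityˡ _)
      (trans (reflexive (≡.cong (x ^_) (≡.sym (ℕ.+-identityʳ e)))) (sym (*-identityʳ _)))
    ∑-chain (suc n) e δ = begin
      ∑[ a < M ] ∑-word n (λ b → ind ((e ℕ.+ δ zero ≤? toℕ a) ×-dec chain? (toℕ a) (δ ∘ suc) b) * x ^ final (toℕ a) b)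
        ≈⟨ sum-cong-≋ {M} (λ a → ∑-word-cong n (λ b → trans
             (*-congʳ (ind-× (e ℕ.+ δ zero ≤? toℕ a) (chain? (toℕ a) (δ ∘ suc) b))) (*-assoc _ _ _))) ⟩
      ∑[ a < M ] ∑-word n (λ b → ind (e ℕ.+ δ zero ≤? toℕ a) * (ind (chain? (toℕ a) (δ ∘ suc) b) * x ^ final (toℕ a) b))
        ≈⟨ sum-cong-≋ {M} (λ a → trans (∑-word-* n _ _) (*-congˡ (∑-chain n (toℕ a) (δ ∘ suc)))) ⟩
      ∑[ a < M ] (ind (e ℕ.+ δ zero ≤? toℕ a) * (x ^ (toℕ a ℕ.+ Σδ) * ξ ^ n))
        ≈⟨ sum-cong-≋ {M} (λ a → trans (*-congˡ (*-congʳ (^-homo-* x (toℕ a) Σδ)))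
             (solve 4 (λ i a d k → i :* (a :* d :* k) := i :* a :* (d :* k)) refl
               (ind (e ℕ.+ δ zero ≤? toℕ a)) (x ^ toℕ a) (x ^ Σδ) (ξ ^ n))) ⟩
      ∑[ a < M ] (ind (e ℕ.+ δ zero ≤? toℕ a) * x ^ toℕ a * (x ^ Σδ * ξ ^ n))
        ≈⟨ *-distribʳ-sum {M} (x ^ Σδ * ξ ^ n) (λ a → ind (e ℕ.+ δ zero ≤? toℕ a) * x ^ toℕ a) ⟨
      ∑[ a < M ] (ind (e ℕ.+ δ zero ≤? toℕ a) * x ^ toℕ a) * (x ^ Σδ * ξ ^ n)
        ≈⟨ *-congʳ (∑-threshold (e ℕ.+ δ zero)) ⟩
      ξ * x ^ (e ℕ.+ δ zero) * (x ^ Σδ * ξ ^ n)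
        ≈⟨ solve 4 (λ ξ a d k → ξ :* a :* (d :* k) := a :* d :* (ξ :* k)) refl ξ _ _ _ ⟩
      x ^ (e ℕ.+ δ zero) * x ^ Σδ * (ξ * ξ ^ n)
        ≈⟨ *-congʳ (^-homo-* x (e ℕ.+ δ zero) Σδ) ⟨
      x ^ (e ℕ.+ δ zero ℕ.+ Σδ) * (ξ * ξ ^ n)
        ≡⟨ ≡.cong (λ k → x ^ k * (ξ * ξ ^ n)) (ℕ.+-assoc e (δ zero) Σδ) ⟩
      x ^ (e ℕ.+ (δ zero ℕ.+ Σδ)) * (ξ * ξ ^ n)
        ∎
      where Σδ = ℕ-Sum.sum (δ ∘ suc)

    -- The increments are the gaps, whose sum is `ides π`; the extra `x` appears because `height` is
    -- one more than the last letter of `b`.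
    ∑-agree : ∀ n (π : Permutation′ (suc n)) →
      ∑-word {M} (suc n) (λ b → ind (agree? (b ∘ (π ⟨$⟩ʳ_)) (π ⟨$⟩ʳ_)) * x ^ height (b ∘ (π ⟨$⟩ʳ_)))
        ≈ x * (x ^ ides π * ξ ^ suc n)
    ∑-agree n π = begin
      ∑-word (suc n) F
        ≈⟨ ∑-word-cong (suc n) {F} {G} F≈G ⟩
      ∑-word (suc n) G
        ≈⟨ ∑-word-* (suc n) x H ⟩
      x * ∑-word (suc n) H
        ≈⟨ *-congˡ (∑-chain (suc n) 0 (0 Vector.∷ gap π)) ⟩
      x * (x ^ ℕ-Sum.sum (gap π) * ξ ^ suc n)
        ≡⟨ ≡.cong (λ k → x * (x ^ k * ξ ^ suc n)) (≡.sym (ides-gap π)) ⟩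
      x * (x ^ ides π * ξ ^ suc n)
        ∎
      where
      F G H : (Fin (suc n) → Fin M) → Carrier
      F b = ind (agree? (b ∘ (π ⟨$⟩ʳ_)) (π ⟨$⟩ʳ_)) * x ^ height (b ∘ (π ⟨$⟩ʳ_))
      H b = ind (chain? 0 (0 Vector.∷ gap π) b) * x ^ final 0 b
      G b = x * H b

      F≈G : ∀ b → F b ≈ G b
      F≈G b = begin
        ind (agree? (b ∘ (π ⟨$⟩ʳ_)) (π ⟨$⟩ʳ_)) * x ^ height (b ∘ (π ⟨$⟩ʳ_))
          ≈⟨ ind-weaken (agree? (b ∘ (π ⟨$⟩ʳ_)) (π ⟨$⟩ʳ_))
               (λ agree → reflexive (≡.cong (x ^_) (agree-height π b agree))) ⟩
        ind (agree? (b ∘ (π ⟨$⟩ʳ_)) (π ⟨$⟩ʳ_)) * (x * x ^ final 0 b)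
          ≈⟨ *-congʳ (ind-cong (agree? (b ∘ (π ⟨$⟩ʳ_)) (π ⟨$⟩ʳ_)) (chain? 0 (0 Vector.∷ gap π) b)
               (agree⇔chain π b)) ⟩
        ind (chain? 0 (0 Vector.∷ gap π) b) * (x * x ^ final 0 b)
          ≈⟨ solve 3 (λ i x y → i :* (x :* y) := x :* (i :* y)) refl
               (ind (chain? 0 (0 Vector.∷ gap π) b)) x (x ^ final 0 b) ⟩
        x * (ind (chain? 0 (0 Vector.∷ gap π) b) * x ^ final 0 b)
          ∎

    -- A word shares its descents, minima and maxima with its standardisation, so for a fixed
    -- permutation only the height varies.
    ∑-word-∑-perm : ∀ n (W : ℕ → ℕ → ℕ → Carrier) →
      ∑-word {M} (suc n) (λ w → W (descents w) (minima w) (maxima w) * x ^ height w)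
        ≈ ∑-perm (suc n) (λ π → W (des π) (lmin π) (rmax π) * (x * (x ^ ides π * ξ ^ suc n)))
    ∑-word-∑-perm n W = begin
      ∑-word (suc n) F
        ≈⟨ standardise (suc n) F F-cong ⟩
      ∑-perm (suc n) (λ π → ∑-word (suc n) (λ b → A b π * F (b ∘ (π ⟨$⟩ʳ_))))
        ≈⟨ ∑-list-cong (permutations (suc n)) (λ π → trans
             (∑-word-cong (suc n) {λ b → A b π * F (b ∘ (π ⟨$⟩ʳ_))} {λ b → V π * G π b} (F≈G π))
             (trans (∑-word-* (suc n) (V π) (G π)) (*-congˡ (∑-agree n π)))) ⟩
      ∑-perm (suc n) (λ π → V π * (x * (x ^ ides π * ξ ^ suc n)))
        ∎
      where
      A : (Fin (suc n) → Fin M) → Permutation′ (suc n) → Carrier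
      A b π = ind (agree? (b ∘ (π ⟨$⟩ʳ_)) (π ⟨$⟩ʳ_))

      F : (Fin (suc n) → Fin M) → Carrier
      F w = W (descents w) (minima w) (maxima w) * x ^ height w

      V : Permutation′ (suc n) → Carrier
      V π = W (des π) (lmin π) (rmax π)

      G : Permutation′ (suc n) → (Fin (suc n) → Fin M) → Carrier
      G π b = A b π * x ^ height (b ∘ (π ⟨$⟩ʳ_))

      F-cong : ∀ {w w′} → w ≗ w′ → F w ≈ F w′
      F-cong w≗w′ rewrite descents-cong w≗w′ | minima-cong w≗w′ | maxima-cong w≗w′ | height-cong w≗w′ = refl

      F≈G : ∀ π b → A b π * F (b ∘ (π ⟨$⟩ʳ_)) ≈ V π * G π b
      F≈G π b = trans
        (ind-weaken (agree? (b ∘ (π ⟨$⟩ʳ_)) (π ⟨$⟩ʳ_)) (λ agree → *-congʳ (reflexive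
          (≡.cong₂ (λ f k → f k) (≡.cong₂ W (agree-descents π agree) (agree-minima π agree))
                                 (agree-maxima π agree)))))
        (solve 3 (λ a w h → a :* (w :* h) := w :* (a :* h)) refl (A b π) (V π) (x ^ height (b ∘ (π ⟨$⟩ʳ_))))

-- The functional equation and its solution

module Resolvent {c ℓ : Level} (R : CommutativeRing c ℓ) where
  open CommutativeRing R hiding (zero)
  open RingProperties ring
  open SemiringExp semiring
  open SemiringSum semiring
  open RawSemiringDefs (Semiring.rawSemiring semiring) using (product)
  open SetoidReasoning setoid
  open IntegerSolver R
  open Words R
  open Standardisation R
  open WordsToPermutations R

  ∏< : ℕ → (ℕ → Carrier) → Carrier
  ∏< n f = product {n} (λ i → f (toℕ i))

  ∏<-cong : ∀ n {f g : ℕ → Carrier} → (∀ i → f i ≈ g i) → ∏< n f ≈ ∏< n g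
  ∏<-cong zero    f≈g = refl
  ∏<-cong (suc n) f≈g = *-cong (f≈g 0) (∏<-cong n (f≈g ∘ suc))

  ∏<-last : ∀ n f → ∏< (suc n) f ≈ ∏< n f * f n
  ∏<-last zero    f = *-comm _ _
  ∏<-last (suc n) f = trans (*-congˡ (∏<-last n (f ∘ suc))) (sym (*-assoc _ _ _))

  ∏<-scale : ∀ n k f → ∏< n (λ i → k * f i) ≈ k ^ n * ∏< n f
  ∏<-scale zero    k f = sym (*-identityˡ 1#)
  ∏<-scale (suc n) k f = trans (*-congˡ (∏<-scale n k (f ∘ suc)))
    (solve 4 (λ k a K b → k :* a :* (K :* b) := k :* K :* (a :* b)) refl k (f 0) (k ^ n) _)

  private
    -- Equations modulo known relations `l ≈ r` are proved by certificates: `a` equals `b` plus a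
    -- combination of differences `l - r` as a polynomial identity. `_×̇_` and `_∔_` show that the
    -- combination vanishes.
    drop : ∀ {a b e} → e ≈ 0# → a ≈ b + e → a ≈ b
    drop e≈0 a≈b+e = trans a≈b+e (trans (+-congˡ e≈0) (+-identityʳ _))

    infixr 6 _∔_
    _∔_ : ∀ {a b} → a ≈ 0# → b ≈ 0# → a + b ≈ 0#
    a≈0 ∔ b≈0 = trans (+-cong a≈0 b≈0) (+-identityˡ 0#)

    infix 7 _×̇_
    _×̇_ : ∀ {a b} k → a ≈ b → k * (a - b) ≈ 0#
    k ×̇ a≈b = trans (*-congˡ (trans (+-congʳ a≈b) (-‿inverseʳ _))) (zeroʳ k)

  -- Repeated substitution for `p n` only; the occurrences of `p 0` are collected in the second sum.
  unroll : (p φ β : ℕ → Carrier) → (∀ i → p i ≈ 1# + (φ i * p (suc i) + β i * p 0)) → ∀ n →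
    p 0 ≈ ∑< n (λ i → ∏< i φ) + ∑< n (λ i → β i * ∏< i φ) * p 0 + ∏< n φ * p n
  unroll p φ β step zero = solve 1 (λ p → p := :0 :+ :0 :* p :+ :1 :* p) refl (p 0)
  unroll p φ β step (suc n) = begin
    p 0
      ≈⟨ unroll p φ β step n ⟩
    S + T * p 0 + ∏< n φ * p n
      ≈⟨ +-congˡ (*-congˡ (step n)) ⟩
    S + T * p 0 + ∏< n φ * (1# + (φ n * p (suc n) + β n * p 0))
      ≈⟨ solve 7 (λ S T p₀ P φ p β →
           S :+ T :* p₀ :+ P :* (:1 :+ (φ :* p :+ β :* p₀)) :=
           (S :+ P) :+ (T :+ β :* P) :* p₀ :+ (P :* φ) :* p)
           refl S T (p 0) (∏< n φ) (φ n) (p (suc n)) (β n) ⟩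
    (S + ∏< n φ) + (T + β n * ∏< n φ) * p 0 + (∏< n φ * φ n) * p (suc n)
      ≈⟨ +-cong (+-cong (∑<-last n (λ i → ∏< i φ)) (*-congʳ (∑<-last n (λ i → β i * ∏< i φ))))
                (*-congʳ (∏<-last n φ)) ⟨
    ∑< (suc n) (λ i → ∏< i φ) + ∑< (suc n) (λ i → β i * ∏< i φ) * p 0 + ∏< (suc n) φ * p (suc n)
      ∎
    where
    S = ∑< n (λ i → ∏< i φ)
    T = ∑< n (λ i → β i * ∏< i φ)

  module Coefficients
    (t u v q x s ξ χ P ζ ω g ι : Carrier)
    (rs≈1 : (1# - t) * s ≈ 1#)
    (ξ-inverse : ξ * (1# - x) ≈ 1#)
    (χ-inverse : χ * (x - 1#) ≈ 1#)
    (ζ-inverse : ζ * P ≈ 1#)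
    (ω-inverse : ω * (x - (1# - t) * P) ≈ 1#)
    (g-eq : t * g ≈ (1# - t) * P - 1#)
    (ι-inverse : ι * g ≈ 1#)
    where

    -- For `P = rⁱ` and `y = ζ = r^(-i)` one has `g = (r^(i+1) - 1) / t`. Thus `t s / (1 - y s)`
    -- becomes `P / g`, and `1 / (1 - x y s)` becomes `r^(i+1) / (r^(i+1) - x)`. `δ` is the quotient
    -- of `(1 - q t) P - 1` by `r P - 1`, with `t` cancelled.
    κ μ δ T : Carrier
    κ = P * ι
    μ = - ((1# - t) * P * ω)
    δ = (g + (1# - q) * P) * ι
    T = t * v * x

    κ-eq : κ * (1# - ζ * s) ≈ t * s
    κ-eq = drop ((- (ι * s)) ×̇ ζ-inverse ∔ (- (P * ι)) ×̇ rs≈1 ∔ (- (ι * s)) ×̇ g-eq ∔ (t * s) ×̇ ι-inverse)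
      (solve 6 (λ t s P ζ g ι → P :* ι :* (:1 :- ζ :* s) :=
        t :* s :+ (:- (ι :* s) :* (ζ :* P :- :1) :+ (:- (P :* ι) :* ((:1 :- t) :* s :- :1)
          :+ (:- (ι :* s) :* (t :* g :- ((:1 :- t) :* P :- :1)) :+ t :* s :* (ι :* g :- :1)))))
        refl t s P ζ g ι)

    μ-inverse : μ * (1# - x * (ζ * s)) ≈ 1#
    μ-inverse = drop (1# ×̇ ω-inverse ∔ (ω * x) ×̇ ζ-inverse ∔ (ω * x * (P * ζ)) ×̇ rs≈1)
      (solve 6 (λ t s P ζ x ω → :- ((:1 :- t) :* P :* ω) :* (:1 :- x :* (ζ :* s)) :=
        :1 :+ (:1 :* (ω :* (x :- (:1 :- t) :* P) :- :1) :+ (ω :* x :* (ζ :* P :- :1)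
          :+ ω :* x :* (P :* ζ) :* ((:1 :- t) :* s :- :1))))
        refl t s P ζ x ω)

    μζs : μ * (ζ * s) ≈ - ω
    μζs = drop ((- ω) ×̇ ζ-inverse ∔ (- (ω * (P * ζ))) ×̇ rs≈1)
      (solve 5 (λ t s P ζ ω → :- ((:1 :- t) :* P :* ω) :* (ζ :* s) :=
        :- ω :+ (:- ω :* (ζ :* P :- :1) :+ :- (ω :* (P :* ζ)) :* ((:1 :- t) :* s :- :1)))
        refl t s P ζ ω)

    δ-eq : δ ≈ 1# - (q - 1#) * κ
    δ-eq = drop (1# ×̇ ι-inverse)
      (solve 4 (λ P g ι q → (g :+ (:1 :- q) :* P) :* ι :=
        (:1 :- (q :- :1) :* (P :* ι)) :+ :1 :* (ι :* g :- :1)) refl P g ι q)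

    χ≈-ξ : χ ≈ - ξ
    χ≈-ξ = drop ((- ξ) ×̇ χ-inverse ∔ (- χ) ×̇ ξ-inverse)
      (solve 3 (λ x ξ χ → χ := :- ξ :+ (:- ξ :* (χ :* (x :- :1) :- :1) :+ :- χ :* (ξ :* (:1 :- x) :- :1)))
        refl x ξ χ)

    φ : Carrier
    φ = u * (x - (1# - t) * P - x * v * t) * δ * ω

    φ-eq′ : φ ≈ u * (δ * (1# + T * (- ω)))
    φ-eq′ = drop ((u * δ) ×̇ ω-inverse)
      (solve 7 (λ t u v x P ω δ → u :* (x :- (:1 :- t) :* P :- x :* v :* t) :* δ :* ω :=
        u :* (δ :* (:1 :+ t :* v :* x :* :- ω)) :+ u :* δ :* (ω :* (x :- (:1 :- t) :* P) :- :1))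
        refl t u v x P ω δ)

    φ-eq : u * ((1# - (q - 1#) * κ) * (1# + T * (μ * (ζ * s)))) ≈ φ
    φ-eq = trans (*-congˡ (*-cong (sym δ-eq) (+-congˡ (*-congˡ μζs)))) (sym φ-eq′)

    β B : Carrier
    β = (q - 1#) * (κ + (κ + 1#) * ξ * T)
    B = u * (q - 1#) * χ * (((x - 1# - x * v) * P + x * v) * ι)

    β-eq : u * β ≈ B
    β-eq = begin
      u * β
        ≈⟨ drop ((- (u * (q - 1#) * (ξ * T))) ×̇ ι-inverse ∔ (- (u * (q - 1#) * (P * ι))) ×̇ ξ-inverse
                 ∔ (u * (q - 1#) * (ξ * (v * x) * ι)) ×̇ g-eq)
           (solve 9 (λ t u v p x P ξ g ι →
             u :* (p :* (P :* ι :+ (P :* ι :+ :1) :* ξ :* (t :* v :* x))) :=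
             u :* p :* :- ξ :* (((x :- :1 :- x :* v) :* P :+ x :* v) :* ι) :+
               (:- (u :* p :* (ξ :* (t :* v :* x))) :* (ι :* g :- :1)
                 :+ (:- (u :* p :* (P :* ι)) :* (ξ :* (:1 :- x) :- :1)
                 :+ u :* p :* (ξ :* (v :* x) :* ι) :* (t :* g :- ((:1 :- t) :* P :- :1)))))
             refl t u v (q - 1#) x P ξ g ι) ⟩
      u * (q - 1#) * (- ξ) * (((x - 1# - x * v) * P + x * v) * ι)
        ≈⟨ *-congʳ (*-congˡ χ≈-ξ) ⟨
      B
        ∎

    -- The terms of index `i` of the three sums in `(1 - u) S - 1 + SB` combine into the term of the
    -- first sum of the formula; this is where its numerator comes from.
    numerator : φ - u + B ≈ u * x * (v * t * ξ * ((q * x - 1# + (1# - q) * P) * ω))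
    numerator = begin
      φ - u + B
        ≈⟨ +-cong (+-congʳ (trans φ-eq′ (*-congˡ (*-congʳ δ-eq)))) (sym β-eq) ⟩
      u * ((1# - (q - 1#) * κ) * (1# + T * (- ω))) - u + u * β
        ≈⟨ solve 7 (λ u q k T ω ξ p → u :* ((:1 :- p :* k) :* (:1 :+ T :* :- ω)) :- u :+ u :* (p :* (k :+ (k :+ :1) :* ξ :* T))
             := u :* T :* (:- ((:1 :- p :* k) :* ω) :+ p :* (k :+ :1) :* ξ))
             refl u q κ T ω ξ (q - 1#) ⟩
      u * T * (- ((1# - (q - 1#) * κ) * ω) + (q - 1#) * (κ + 1#) * ξ)
        ≈⟨ *-congˡ core ⟩
      u * T * (ξ * (q * x - 1# + (1# - q) * P) * ω)
        ≈⟨ solve 7 (λ u t v x ξ a ω → u :* (t :* v :* x) :* (ξ :* a :* ω) := u :* x :* (v :* t :* ξ :* (a :* ω)))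
             refl u t v x ξ _ ω ⟩
      u * x * (v * t * ξ * ((q * x - 1# + (1# - q) * P) * ω))
        ∎
      where
      core : - ((1# - (q - 1#) * κ) * ω) + (q - 1#) * (κ + 1#) * ξ ≈ ξ * (q * x - 1# + (1# - q) * P) * ω
      core = drop ((- (ξ * ω * (q - 1#) * (P * t))) ×̇ ι-inverse ∔ (ξ * ω * (q - 1#) * (P * ι)) ×̇ g-eq
                   ∔ ((1# - (q - 1#) * κ) * ω) ×̇ ξ-inverse ∔ (- ((q - 1#) * (κ + 1#) * ξ)) ×̇ ω-inverse)
        (solve 8 (λ t q x P ξ ω g ι →
          :- ((:1 :- (q :- :1) :* (P :* ι)) :* ω) :+ (q :- :1) :* (P :* ι :+ :1) :* ξ :=
          ξ :* (q :* x :- :1 :+ (:1 :- q) :* P) :* ω :+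
            (:- (ξ :* ω :* (q :- :1) :* (P :* t)) :* (ι :* g :- :1)
            :+ (ξ :* ω :* (q :- :1) :* (P :* ι) :* (t :* g :- ((:1 :- t) :* P :- :1))
            :+ ((:1 :- (q :- :1) :* (P :* ι)) :* ω :* (ξ :* (:1 :- x) :- :1)
            :+ :- ((q :- :1) :* (P :* ι :+ :1) :* ξ) :* (ω :* (x :- (:1 :- t) :* P) :- :1)))))
          refl t q x P ξ ω g ι)

  module Identity
    (t u v q x s η ξ χ : Carrier) (ω g ι : ℕ → Carrier) (D : ℕ)
    (rs≈1 : (1# - t) * s ≈ 1#)
    (η-inverse : η * (1# - u) ≈ 1#)
    (ξ-inverse : ξ * (1# - x) ≈ 1#)
    (χ-inverse : χ * (x - 1#) ≈ 1#)
    (ω-inverse : ∀ i → ω i * (x - (1# - t) ^ suc i) ≈ 1#)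
    (g-eq : ∀ i → t * g i ≈ (1# - t) ^ suc i - 1#)
    (ι-inverse : ∀ i → ι i * g i ≈ 1#)
    (t^D≈0 : t ^ D ≈ 0#) (u^D≈0 : u ^ D ≈ 0#) (x^D≈0 : x ^ D ≈ 0#)
    where

    weight : ∀ {n} → Permutation′ n → Carrier
    weight {n} π = u ^ des π * x ^ ides π * q ^ lmin π * v ^ rmax π * (η ^ n * ξ ^ n)

    𝒢 : Carrier
    𝒢 = ∑< D (λ m → t ^ suc m * ∑-perm (suc m) weight)

    φ B : ℕ → Carrier
    φ i = u * (x - (1# - t) ^ suc i - x * v * t) * ((g i + (1# - q) * (1# - t) ^ i) * ι i) * ω i
    B i = u * (q - 1#) * χ * (((x - 1# - x * v) * (1# - t) ^ i + x * v) * ι i)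

    private
      -- Letters are `< D` because `x ^ D` vanishes. Lengths run from 0 to `D`: the empty word and
      -- the `D` terms of `𝒢`.
      open Transfer R t u v q s η D (suc D)
      open Statistics R t u v q s η D (suc D)

      t^1+D≈0 : t ^ suc D ≈ 0#
      t^1+D≈0 = trans (*-congˡ t^D≈0) (zeroʳ t)

      open Monomials rs≈1 η-inverse t^1+D≈0 (s≤s z≤n) x ξ ξ-inverse x^D≈0

      ζ p : ℕ → Carrier
      ζ zero    = 1#
      ζ (suc i) = ζ i * s
      p i = total D (monomial (ζ i))

      ζ-inverse : ∀ i → ζ i * (1# - t) ^ i ≈ 1#
      ζ-inverse zero    = *-identityˡ 1#
      ζ-inverse (suc i) = begin
        ζ i * s * ((1# - t) * (1# - t) ^ i)     ≈⟨ solve 4 (λ z s r P → z :* s :* (r :* P) := z :* P :* (r :* s)) refl _ s (1# - t) _ ⟩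
        ζ i * (1# - t) ^ i * ((1# - t) * s)     ≈⟨ *-cong (ζ-inverse i) rs≈1 ⟩
        1# * 1#                                 ≈⟨ *-identityˡ 1# ⟩
        1#                                      ∎

      module C (i : ℕ) = Coefficients t u v q x s ξ χ ((1# - t) ^ i) (ζ i) (ω i) (g i) (ι i)
        rs≈1 ξ-inverse χ-inverse (ζ-inverse i) (ω-inverse i) (g-eq i) (ι-inverse i)

      p-step : ∀ i → p i ≈ 1# + (φ i * p (suc i) + B i * p 0)
      p-step i = begin
        p i
          ≈⟨ total-monomial (ζ i) (C.κ i) (C.μ i) (C.κ-eq i) (C.μ-inverse i) ⟩
        1# + u * (a * p (suc i) + C.β i * p 0)
          ≈⟨ +-congˡ (solve 5 (λ u a b x y → u :* (a :* x :+ b :* y) := u :* a :* x :+ u :* b :* y)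
               refl u a (C.β i) (p (suc i)) (p 0)) ⟩
        1# + (u * a * p (suc i) + u * C.β i * p 0)
          ≈⟨ +-congˡ (+-cong (*-congʳ (C.φ-eq i)) (*-congʳ (C.β-eq i))) ⟩
        1# + (φ i * p (suc i) + B i * p 0)
          ∎
        where a = (1# - (q - 1#) * C.κ i) * (1# + C.T i * (C.μ i * (ζ i * s)))

      ∏φ≈0 : ∏< D φ ≈ 0#
      ∏φ≈0 = begin
        ∏< D φ
          ≈⟨ ∏<-cong D (λ i → solve 4 (λ u a b c → u :* a :* b :* c := u :* (a :* b :* c)) refl u
               (x - (1# - t) ^ suc i - x * v * t) ((g i + (1# - q) * (1# - t) ^ i) * ι i) (ω i)) ⟩
        ∏< D (λ i → u * φ′ i)
          ≈⟨ ∏<-scale D u φ′ ⟩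
        u ^ D * ∏< D φ′
          ≈⟨ trans (*-congʳ u^D≈0) (zeroˡ _) ⟩
        0#
          ∎
        where
        φ′ : ℕ → Carrier
        φ′ i = (x - (1# - t) ^ suc i - x * v * t) * ((g i + (1# - q) * (1# - t) ^ i) * ι i) * ω i

      S S′ SB Sφ : Carrier
      S  = ∑< D (λ i → ∏< i φ)
      SB = ∑< D (λ i → B i * ∏< i φ)
      Sφ = ∑< D (λ i → φ i * ∏< i φ)
      S′ = ∑< D (λ i → ((q * x - 1# + (1# - q) * (1# - t) ^ i) * ω i) * ∏< i φ)

      p₀-eq : p 0 ≈ S + SB * p 0
      p₀-eq = trans (unroll p φ B p-step D)
        (trans (+-congˡ (trans (*-congʳ ∏φ≈0) (zeroˡ _))) (+-identityʳ _))

      -- Multiplication by `φ i` shifts the products by one index, and the product reached at the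
      -- end is zero.
      Sφ-eq : 1# + Sφ ≈ S
      Sφ-eq = begin
        1# + Sφ
          ≈⟨ +-congˡ (∑<-cong D (λ i _ → trans (*-comm _ _) (sym (∏<-last i φ)))) ⟩
        ∑< (suc D) (λ i → ∏< i φ)
          ≈⟨ ∑<-last D (λ i → ∏< i φ) ⟩
        S + ∏< D φ
          ≈⟨ trans (+-congˡ ∏φ≈0) (+-identityʳ _) ⟩
        S
          ∎

      S-numerator : Sφ - u * S + SB ≈ u * x * (v * t * ξ * S′)
      S-numerator = begin
        Sφ - u * S + SB
          ≈⟨ +-congʳ (+-congˡ (trans (-‿distribˡ-* u S) (*-distribˡ-sum {D} (- u) (λ i → ∏< (toℕ i) φ)))) ⟩
        Sφ + ∑< D (λ i → - u * ∏< i φ) + SB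
          ≈⟨ +-congʳ (∑-distrib-+ {D} (λ i → φ (toℕ i) * ∏< (toℕ i) φ) (λ i → - u * ∏< (toℕ i) φ)) ⟨
        ∑< D (λ i → φ i * ∏< i φ + - u * ∏< i φ) + SB
          ≈⟨ ∑-distrib-+ {D} (λ i → φ (toℕ i) * ∏< (toℕ i) φ + - u * ∏< (toℕ i) φ) (λ i → B (toℕ i) * ∏< (toℕ i) φ) ⟨
        ∑< D (λ i → φ i * ∏< i φ + - u * ∏< i φ + B i * ∏< i φ)
          ≈⟨ ∑<-cong D (λ i _ → begin
               φ i * ∏< i φ + - u * ∏< i φ + B i * ∏< i φ
                 ≈⟨ solve 4 (λ f u b P → f :* P :+ :- u :* P :+ b :* P := (f :- u :+ b) :* P) refl (φ i) u (B i) (∏< i φ) ⟩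
               (φ i - u + B i) * ∏< i φ
                 ≈⟨ *-congʳ (C.numerator i) ⟩
               u * x * (v * t * ξ * A i) * ∏< i φ
                 ≈⟨ solve 7 (λ u x v t ξ a P → u :* x :* (v :* t :* ξ :* a) :* P := u :* x :* (v :* t :* ξ) :* (a :* P))
                      refl u x v t ξ (A i) (∏< i φ) ⟩
               u * x * (v * t * ξ) * (A i * ∏< i φ)
                 ∎) ⟩
        ∑< D (λ i → u * x * (v * t * ξ) * (A i * ∏< i φ))
          ≈⟨ *-distribˡ-sum {D} (u * x * (v * t * ξ)) (λ i → A (toℕ i) * ∏< (toℕ i) φ) ⟨
        u * x * (v * t * ξ) * S′
          ≈⟨ *-assoc _ _ _ ⟩
        u * x * (v * t * ξ * S′)
          ∎
        where
        A : ℕ → Carrier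
        A i = (q * x - 1# + (1# - q) * (1# - t) ^ i) * ω i

      -- For `y = 1` the weight `x ^ d` ignores `c`, so a word contributes its minima, maxima and
      -- height. The leading `u` is the cut forced by the bound `D`, and `η` stands for the free
      -- cuts before the first letter.
      layer-perm : ∀ m → layer (suc m) D (monomial 1#) ≈ u * η * (x * ∑-perm (suc m) weight)
      layer-perm m = begin
        layer (suc m) D (monomial 1#)
          ≈⟨ layer-top η-inverse m (monomial 1#) ⟩
        u * layer (suc m) 0 (monomial 1#)
          ≈⟨ *-congˡ (∑-word-cong (suc m) {λ w → rows 0 w * val w (monomial 1#)} {λ w → η * F w} word) ⟩
        u * ∑-word (suc m) (λ w → η * F w)
          ≈⟨ *-congˡ (∑-word-* (suc m) η F) ⟩
        u * (η * ∑-word (suc m) F)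
          ≈⟨ *-congˡ (*-congˡ (∑-word-∑-perm x ξ D ξ-inverse x^D≈0 m W)) ⟩
        u * (η * ∑-perm (suc m) (λ π → W (des π) (lmin π) (rmax π) * (x * (x ^ ides π * ξ ^ suc m))))
          ≈⟨ *-congˡ (*-congˡ (∑-list-cong (permutations (suc m)) (λ π →
               solve 7 (λ U H Q V x X Ξ → U :* H :* Q :* V :* (x :* (X :* Ξ)) := x :* (U :* X :* Q :* V :* (H :* Ξ)))
                 refl (u ^ des π) (η ^ suc m) (q ^ lmin π) (v ^ rmax π) x (x ^ ides π) (ξ ^ suc m)))) ⟩
        u * (η * ∑-perm (suc m) (λ π → x * weight π))
          ≈⟨ *-congˡ (*-congˡ (∑-list-* (permutations (suc m)) x weight)) ⟩
        u * (η * (x * ∑-perm (suc m) weight))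
          ≈⟨ *-assoc _ _ _ ⟨
        u * η * (x * ∑-perm (suc m) weight)
          ∎
        where
        W : ℕ → ℕ → ℕ → Carrier
        W d i j = u ^ d * η ^ suc m * q ^ i * v ^ j

        F : Word (suc m) → Carrier
        F w = W (descents w) (minima w) (maxima w) * x ^ height w

        word : ∀ w → rows 0 w * val w (monomial 1#) ≈ η * F w
        word w = begin
          η * rows (toℕ (w zero)) (w ∘ suc) * val w (monomial 1#)
            ≈⟨ *-cong (*-congˡ (rows-descents w)) (trans
                 (val-cong w (λ d c _ _ → trans (*-congˡ (1^n≈1 (d ℕ.∸ c))) (*-identityʳ _)))
                 (val-minima-maxima (x ^_) w)) ⟩
          η * (u ^ descents w * η ^ suc m) * (q ^ minima w * (v ^ maxima w * x ^ height w))
            ≈⟨ solve 6 (λ η U H Q V X → η :* (U :* H) :* (Q :* (V :* X)) := η :* (U :* H :* Q :* V :* X))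
                 refl η (u ^ descents w) (η ^ suc m) (q ^ minima w) (v ^ maxima w) (x ^ height w) ⟩
          η * F w
            ∎

      p₀-𝒢 : (1# - u) * p 0 ≈ 1# + u * x * 𝒢
      p₀-𝒢 = begin
        (1# - u) * p 0
          ≈⟨ *-congˡ (+-congˡ (∑<-cong D (λ m _ → trans (*-congˡ {t ^ suc m} (layer-perm m))
               (solve 4 (λ t k x S → t :* (k :* (x :* S)) := k :* x :* (t :* S)) refl (t ^ suc m) (u * η) x
                 (∑-perm (suc m) weight))))) ⟩
        (1# - u) * (1# * (η * (1# * 1#)) + ∑< D (λ m → u * η * x * (t ^ suc m * ∑-perm (suc m) weight)))
          ≈⟨ *-congˡ (+-congˡ (*-distribˡ-sum {D} (u * η * x) (λ m → t ^ suc (toℕ m) * ∑-perm (suc (toℕ m)) weight))) ⟨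
        (1# - u) * (1# * (η * (1# * 1#)) + u * η * x * 𝒢)
          ≈⟨ solve 4 (λ u η x G → (:1 :- u) :* (:1 :* (η :* (:1 :* :1)) :+ u :* η :* x :* G)
               := η :* (:1 :- u) :* (:1 :+ u :* x :* G)) refl u η x 𝒢 ⟩
        η * (1# - u) * (1# + u * x * 𝒢)
          ≈⟨ trans (*-congʳ η-inverse) (*-identityˡ _) ⟩
        1# + u * x * 𝒢
          ∎

    -- Eliminate `p₀` from `p₀ (1 - SB) = S` and `(1 - u) p₀ = 1 + u x 𝒢`. The factor `u x` must
    -- stay, since `u` and `x` are nilpotent here.
    identity :
      u * x * (𝒢 * (1# - u * (q - 1#) * χ * ∑< D (λ i → ((x - 1# - x * v) * (1# - t) ^ i + x * v) * ι i * ∏< i φ)))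
        ≈ u * x * (v * t * ξ * ∑< D (λ i → (q * x - 1# + (1# - q) * (1# - t) ^ i) * ω i * ∏< i φ))
    identity = begin
      u * x * (𝒢 * (1# - u * (q - 1#) * χ * ∑< D (λ i → b i * ι i * ∏< i φ)))
        ≈⟨ *-congˡ (*-congˡ (+-congˡ (-‿cong (trans (*-distribˡ-sum {D} (u * (q - 1#) * χ) (λ i → b (toℕ i) * ι (toℕ i) * ∏< (toℕ i) φ))
             (∑<-cong D (λ i _ → sym (*-assoc _ (b i * ι i) (∏< i φ)))))))) ⟩
      u * x * (𝒢 * (1# - SB))
        ≈⟨ solve 3 (λ k G b → k :* (G :* (:1 :- b)) := (:1 :+ k :* G) :* (:1 :- b) :- (:1 :- b)) refl (u * x) 𝒢 SB ⟩
      (1# + u * x * 𝒢) * (1# - SB) - (1# - SB)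
        ≈⟨ +-congʳ (*-congʳ p₀-𝒢) ⟨
      (1# - u) * p 0 * (1# - SB) - (1# - SB)
        ≈⟨ drop ((1# - u) ×̇ p₀-eq ∔ (- 1#) ×̇ Sφ-eq)
           (solve 5 (λ u p b S f →
             (:1 :- u) :* p :* (:1 :- b) :- (:1 :- b) :=
             (f :- u :* S :+ b) :+
               ((:1 :- u) :* (p :- (S :+ b :* p)) :+ :- :1 :* ((:1 :+ f) :- S)))
             refl u (p 0) SB S Sφ) ⟩
      Sφ - u * S + SB
        ≈⟨ S-numerator ⟩
      u * x * (v * t * ξ * S′)
        ∎
      where
      b : ℕ → Carrier
      b i = (x - 1# - x * v) * (1# - t) ^ i + x * v

  -- The stuck term a ^ n of the ring R mentions the equality of R, so that it
  -- differs from the power of the same elements in a quotient of R.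
  module PowerIdentity
    (_↑_ : Carrier → ℕ → Carrier) (↑≡^ : ∀ a n → a ↑ n ≡ a ^ n)
    (t u v q x s η ξ χ : Carrier) (ω g ι : ℕ → Carrier) (D : ℕ)
    (rs≈1 : (1# - t) * s ≈ 1#)
    (η-inverse : η * (1# - u) ≈ 1#)
    (ξ-inverse : ξ * (1# - x) ≈ 1#)
    (χ-inverse : χ * (x - 1#) ≈ 1#)
    (ω-inverse : ∀ i → ω i * (x - (1# - t) ↑ suc i) ≈ 1#)
    (g-eq : ∀ i → t * g i ≈ (1# - t) ↑ suc i - 1#)
    (ι-inverse : ∀ i → ι i * g i ≈ 1#)
    (t^D≈0 : t ↑ D ≈ 0#) (u^D≈0 : u ↑ D ≈ 0#) (x^D≈0 : x ↑ D ≈ 0#)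
    where

    private
      module I = Identity t u v q x s η ξ χ ω g ι D rs≈1 η-inverse ξ-inverse χ-inverse
        (λ i → ≡.subst (λ P → ω i * (x - P) ≈ 1#) (↑≡^ (1# - t) (suc i)) (ω-inverse i))
        (λ i → ≡.subst (λ P → t * g i ≈ P - 1#) (↑≡^ (1# - t) (suc i)) (g-eq i))
        ι-inverse
        (≡.subst (_≈ 0#) (↑≡^ t D) t^D≈0) (≡.subst (_≈ 0#) (↑≡^ u D) u^D≈0)
        (≡.subst (_≈ 0#) (↑≡^ x D) x^D≈0)

      ↑≈^ : ∀ a n → a ↑ n ≈ a ^ n
      ↑≈^ a n = reflexive (↑≡^ a n)

    weight : ∀ n → Permutation′ n → Carrier
    weight n π = u ↑ des π * x ↑ ides π * q ↑ lmin π * v ↑ rmax π * (η ↑ n * ξ ↑ n)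

    φ : ℕ → Carrier
    φ i = u * (x - (1# - t) ↑ suc i - x * v * t) * ((g i + (1# - q) * (1# - t) ↑ i) * ι i) * ω i

    power-identity :
      u * x * (∑< D (λ m → t ↑ suc m * ∑-perm (suc m) (weight (suc m))) *
        (1# - u * (q - 1#) * χ * ∑< D (λ i → ((x - 1# - x * v) * (1# - t) ↑ i + x * v) * ι i * ∏< i φ)))
        ≈ u * x * (v * t * ξ * ∑< D (λ i → (q * x - 1# + (1# - q) * (1# - t) ↑ i) * ω i * ∏< i φ))
    power-identity = trans
      (*-congˡ (*-cong
        (∑<-cong D (λ m _ → *-cong (↑≈^ t (suc m)) (∑-list-cong (permutations (suc m)) (weight≈ (suc m)))))
        (+-congˡ (-‿cong (*-congˡ (∑<-cong D (λ i _ →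
          *-cong (*-congʳ {ι i} (+-congʳ (*-congˡ (↑≈^ (1# - t) i)))) (∏<-cong i φ≈))))))))
      (trans I.identity (*-congˡ (*-congˡ (∑<-cong D (λ i _ →
        *-cong (*-congʳ {ω i} (+-congˡ (*-congˡ (sym (↑≈^ (1# - t) i))))) (∏<-cong i (sym ∘ φ≈)))))))
      where
      weight≈ : ∀ n (π : Permutation′ n) → weight n π ≈ I.weight π
      weight≈ n π = *-cong (*-cong (*-cong (*-cong (↑≈^ u (des π)) (↑≈^ x (ides π))) (↑≈^ q (lmin π)))
        (↑≈^ v (rmax π))) (*-cong (↑≈^ η n) (↑≈^ ξ n))

      φ≈ : ∀ i → φ i ≈ I.φ i
      φ≈ i = *-congʳ (*-cong (*-congˡ (+-congʳ (+-congˡ (-‿cong (↑≈^ (1# - t) (suc i))))))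
        (*-congʳ (+-congˡ (*-congˡ (↑≈^ (1# - t) i)))))

-- Rings of power series and polynomials

IsCommutative : {c ℓ : Level} → RawRing c ℓ → Set (c Level.⊔ ℓ)
IsCommutative A = IsCommutativeRing _≈_ _+_ _*_ -_ 0# 1#
  where open RawRing A

toBundle : {c ℓ : Level} {C : Set c} {_≈_ : C → C → Set ℓ} {_+_ _*_ : C → C → C} { -_ : C → C} {0# 1# : C} →
           IsCommutativeRing _≈_ _+_ _*_ -_ 0# 1# → CommutativeRing c ℓ
toBundle isCommutativeRing = record { isCommutativeRing = isCommutativeRing }

bundle : {c ℓ : Level} (A : RawRing c ℓ) → IsCommutative A → CommutativeRing c ℓ
bundle A isA = toBundle isA

module PowerSeries {c ℓ : Level} (A : RawRing c ℓ) (isA : IsCommutative A) where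
  open CommutativeRing (bundle A isA) hiding (zero; isCommutativeRing; rawRing)
  open SemiringSum semiring
  open SetoidReasoning setoid
  open IntegerSolver (bundle A isA)
  open RawRing (powerSeries A) using () renaming
    (Carrier to Series; _≈_ to _≈ₛ_; _+_ to _+ₛ_; _*_ to _*ₛ_; -_ to -ₛ_; 0# to 0ₛ; 1# to 1ₛ)

  private
    constant : Carrier → Series
    constant = constₛ A

  *ₛ-cong : ∀ {f f′ g g′} → f ≈ₛ f′ → g ≈ₛ g′ → f *ₛ g ≈ₛ f′ *ₛ g′
  *ₛ-cong f≈f′ g≈g′ n = sum-cong-≋ {suc n} (λ k → *-cong (f≈f′ (toℕ k)) (g≈g′ (n ∸ toℕ k)))

  *ₛ-distribʳ : ∀ f g h → (g +ₛ h) *ₛ f ≈ₛ g *ₛ f +ₛ h *ₛ f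
  *ₛ-distribʳ f g h n = trans
    (sum-cong-≋ {suc n} (λ k → distribʳ (f (n ∸ toℕ k)) (g (toℕ k)) (h (toℕ k))))
    (∑-distrib-+ {suc n} (λ k → g (toℕ k) * f (n ∸ toℕ k)) (λ k → h (toℕ k) * f (n ∸ toℕ k)))

  scale-*ₛ : ∀ a f g → (λ n → a * f n) *ₛ g ≈ₛ (λ n → a * (f *ₛ g) n)
  scale-*ₛ a f g n = trans (sum-cong-≋ {suc n} (λ k → *-assoc a (f (toℕ k)) (g (n ∸ toℕ k))))
    (sym (*-distribˡ-sum {suc n} a (λ k → f (toℕ k) * g (n ∸ toℕ k))))

  -- The product unfolds from the first coefficient of `f`; unfolding it from the other end is what
  -- commutativity needs.
  *ₛ-last : ∀ f g n → (f *ₛ g) (suc n) ≈ (f *ₛ (g ∘ suc)) n + f (suc n) * g 0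
  *ₛ-last f g zero    = solve 2 (λ a b → a :+ (b :+ :0) := (a :+ :0) :+ b) refl _ _
  *ₛ-last f g (suc n) = trans (+-congˡ (*ₛ-last (f ∘ suc) g n)) (sym (+-assoc _ _ _))

  *ₛ-comm : ∀ f g → f *ₛ g ≈ₛ g *ₛ f
  *ₛ-comm f g zero    = +-congʳ (*-comm (f 0) (g 0))
  *ₛ-comm f g (suc n) = begin
    f 0 * g (suc n) + ((f ∘ suc) *ₛ g) n   ≈⟨ +-comm _ _ ⟩
    ((f ∘ suc) *ₛ g) n + f 0 * g (suc n)   ≈⟨ +-cong (*ₛ-comm (f ∘ suc) g n) (*-comm (f 0) _) ⟩
    (g *ₛ (f ∘ suc)) n + g (suc n) * f 0   ≈⟨ *ₛ-last g f n ⟨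
    (g *ₛ f) (suc n)                       ∎

  0ₛ-*ₛ : ∀ f → 0ₛ *ₛ f ≈ₛ 0ₛ
  0ₛ-*ₛ f n = trans (sum-cong-≋ {suc n} (λ k → zeroˡ (f (n ∸ toℕ k)))) (sum-replicate-zero (suc n))

  constant-*ₛ : ∀ a f n → (constant a *ₛ f) n ≈ a * f n
  constant-*ₛ a f zero    = +-identityʳ _
  constant-*ₛ a f (suc n) = trans (+-congˡ (0ₛ-*ₛ f n)) (+-identityʳ _)

  *ₛ-assoc : ∀ f g h → (f *ₛ g) *ₛ h ≈ₛ f *ₛ (g *ₛ h)
  *ₛ-assoc f g h zero    = solve 3 (λ a b c → (a :* b :+ :0) :* c :+ :0 := a :* (b :* c :+ :0) :+ :0) refl (f 0) (g 0) (h 0)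
  *ₛ-assoc f g h (suc n) = begin
    (f 0 * g 0 + 0#) * h (suc n) + (((f *ₛ g) ∘ suc) *ₛ h) n
      ≈⟨ +-congˡ (trans (*ₛ-distribʳ h (λ n → f 0 * g (suc n)) ((f ∘ suc) *ₛ g) n)
           (+-cong (scale-*ₛ (f 0) (g ∘ suc) h n) (*ₛ-assoc (f ∘ suc) g h n))) ⟩
    (f 0 * g 0 + 0#) * h (suc n) + (f 0 * ((g ∘ suc) *ₛ h) n + ((f ∘ suc) *ₛ (g *ₛ h)) n)
      ≈⟨ solve 5 (λ a b c d e → (a :* b :+ :0) :* c :+ (a :* d :+ e) := a :* (b :* c :+ d) :+ e)
           refl (f 0) (g 0) (h (suc n)) _ _ ⟩
    f 0 * (g 0 * h (suc n) + ((g ∘ suc) *ₛ h) n) + ((f ∘ suc) *ₛ (g *ₛ h)) n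
      ∎

  *ₛ-identityˡ : ∀ f → 1ₛ *ₛ f ≈ₛ f
  *ₛ-identityˡ f n = trans (constant-*ₛ 1# f n) (*-identityˡ (f n))

  isCommutativeRing : IsCommutative (powerSeries A)
  isCommutativeRing = record
    { isRing = record
      { +-isAbelianGroup = Pointwise.isAbelianGroup ℕ +-isAbelianGroup
      ; *-cong           = *ₛ-cong
      ; *-assoc          = *ₛ-assoc
      ; *-identity       = *ₛ-identityˡ , λ f n → trans (*ₛ-comm f 1ₛ n) (*ₛ-identityˡ f n)
      ; distrib          = (λ f g h n → trans (*ₛ-comm f (g +ₛ h) n) (trans (*ₛ-distribʳ f g h n)
                              (+-cong (*ₛ-comm g f n) (*ₛ-comm h f n)))) , *ₛ-distribʳ
      }
    ; *-comm = *ₛ-comm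
    }

  variable-*ₛ : ∀ f n → (varₛ A *ₛ f) (suc n) ≈ f n
  variable-*ₛ f n = trans (+-cong (zeroˡ _) (*ₛ-identityˡ′ n)) (+-identityˡ _)
    where
    *ₛ-identityˡ′ : ∀ n → ((varₛ A ∘ suc) *ₛ f) n ≈ f n
    *ₛ-identityˡ′ n = trans (*ₛ-cong {varₛ A ∘ suc} {1ₛ} {f} {f} (λ { zero → refl ; (suc _) → refl }) (λ _ → refl) n) (*ₛ-identityˡ f n)

module Polynomials {c ℓ : Level} (A : RawRing c ℓ) (isA : IsCommutative A) where
  open CommutativeRing (bundle A isA) hiding (zero; isCommutativeRing; rawRing)
  open RingProperties ring
  open PowerSeries A isA using (0ₛ-*ₛ) renaming (isCommutativeRing to powerSeries-isCommutativeRing)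
  private
    module S = RawRing (powerSeries A)
    module P = RawRing (polynomials A)

    coefficient : List Carrier → ℕ → Carrier
    coefficient = coeff A

  coeff-+ : ∀ f g n → coefficient (f P.+ g) n ≈ coefficient f n + coefficient g n
  coeff-+ []      g       n       = sym (+-identityˡ _)
  coeff-+ (a ∷ f) []      n       = sym (+-identityʳ _)
  coeff-+ (a ∷ f) (b ∷ g) zero    = refl
  coeff-+ (a ∷ f) (b ∷ g) (suc n) = coeff-+ f g n

  coeff-map : ∀ {h : Carrier → Carrier} → h 0# ≈ 0# → ∀ f n → coefficient (List.map h f) n ≈ h (coefficient f n)
  coeff-map h0≈0 []      n       = sym h0≈0
  coeff-map h0≈0 (a ∷ f) zero    = refl
  coeff-map h0≈0 (a ∷ f) (suc n) = coeff-map h0≈0 f n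

  coeff-* : ∀ f g n → coefficient (f P.* g) n ≈ (coefficient f S.* coefficient g) n
  coeff-* []      g n       = sym (0ₛ-*ₛ (coefficient g) n)
  coeff-* (a ∷ f) g zero    = trans (coeff-+ (List.map (a *_) g) _ zero) (+-congʳ (coeff-map (zeroʳ a) g zero))
  coeff-* (a ∷ f) g (suc n) = trans (coeff-+ (List.map (a *_) g) _ (suc n))
    (+-cong (coeff-map (zeroʳ a) g (suc n)) (coeff-* f g n))

  -- Equality of lists is equality of coefficients, so injectivity is immediate and all ring laws
  -- are inherited from power series.
  coeff-isRingMonomorphism : IsRingMonomorphism (polynomials A) (powerSeries A) coefficient
  coeff-isRingMonomorphism = record
    { isRingHomomorphism = record
      { isSemiringHomomorphism = record
        { isNearSemiringHomomorphism = record
          { +-isMonoidHomomorphism = record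
            { isMagmaHomomorphism = record
              { isRelHomomorphism = record { cong = λ f≈g → f≈g }
              ; homo = coeff-+
              }
            ; ε-homo = λ n → refl
            }
          ; *-homo = coeff-*
          }
        ; 1#-homo = λ { zero → refl ; (suc n) → refl }
        }
      ; -‿homo = coeff-map -0#≈0#
      }
    ; injective = λ f≈g → f≈g
    }

  isCommutativeRing : IsCommutative (polynomials A)
  isCommutativeRing = RingMonomorphism.isCommutativeRing coeff-isRingMonomorphism powerSeries-isCommutativeRing

-- Congruences modulo the ideals of a decreasing filtration I₀ ⊇ I₁ ⊇ ⋯ of
-- the ring with I₀ the whole ring, I_D I_E ⊆ I_{D+E} and ⋂ I_D = 0.
record Filtration {c ℓ : Level} (A : CommutativeRing c ℓ) : Set (Level.suc Level.zero Level.⊔ c Level.⊔ Level.suc ℓ) where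
  open CommutativeRing A hiding (isEquivalence; +-cong)
  field
    _≈[_]_        : Carrier → ℕ → Carrier → Set ℓ
    isEquivalence : ∀ D → IsEquivalence (_≈[ D ]_)
    +-cong-mod    : ∀ {D f f′ g g′} → f ≈[ D ] f′ → g ≈[ D ] g′ → (f + g) ≈[ D ] (f′ + g′)
    *-cong-mod    : ∀ {D f f′ g g′} → f ≈[ D ] f′ → g ≈[ D ] g′ → (f * g) ≈[ D ] (f′ * g′)
    -‿cong-mod    : ∀ {D f f′} → f ≈[ D ] f′ → (- f) ≈[ D ] (- f′)
    weaken        : ∀ {D E f g} → D ≤ E → f ≈[ E ] g → f ≈[ D ] g
    reduce        : ∀ {D f g} → f ≈ g → f ≈[ D ] g
    trivial       : ∀ {f g} → f ≈[ 0 ] g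
    separated     : ∀ {f g} → (∀ D → f ≈[ D ] g) → f ≈ g
    *-order       : ∀ {D E f g} → f ≈[ D ] 0# → g ≈[ E ] 0# → (f * g) ≈[ D ℕ.+ E ] 0#

  quotient : ℕ → CommutativeRing c ℓ
  quotient D = record
    { _≈_ = _≈[ D ]_
    ; _+_ = _+_
    ; _*_ = _*_
    ; -_  = -_
    ; 0#  = 0#
    ; 1#  = 1#
    ; isCommutativeRing = record
      { isRing = record
        { +-isAbelianGroup = record
          { isGroup = record
            { isMonoid = record
              { isSemigroup = record
                { isMagma = record { isEquivalence = isEquivalence D ; ∙-cong = +-cong-mod }
                ; assoc = λ f g h → reduce (+-assoc f g h)
                }
              ; identity = (λ f → reduce (+-identityˡ f)) , (λ f → reduce (+-identityʳ f))
              }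
            ; inverse = (λ f → reduce (-‿inverseˡ f)) , (λ f → reduce (-‿inverseʳ f))
            ; ⁻¹-cong = -‿cong-mod
            }
          ; comm = λ f g → reduce (+-comm f g)
          }
        ; *-cong     = *-cong-mod
        ; *-assoc    = λ f g h → reduce (*-assoc f g h)
        ; *-identity = (λ f → reduce (*-identityˡ f)) , (λ f → reduce (*-identityʳ f))
        ; distrib    = (λ f g h → reduce (distribˡ f g h)) , (λ f g h → reduce (distribʳ f g h))
        }
      ; *-comm = λ f g → reduce (*-comm f g)
      }
    }

  open SemiringExp semiring using (_^_)

  ^-order : ∀ {f} → f ≈[ 1 ] 0# → ∀ n → (f ^ n) ≈[ n ] 0#
  ^-order f≈0 zero    = trivial
  ^-order f≈0 (suc n) = *-order f≈0 (^-order f≈0 n)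

-- The filtration of the coefficient ring, whose elements all have degree 0: the ideals are zero
-- from `D = 1` on.
discrete : {c ℓ : Level} (A : CommutativeRing c ℓ) → Filtration A
discrete A = record
  { _≈[_]_        = λ f D g → 0 < D → f ≈ g
  ; isEquivalence = λ D → record
    { refl  = λ _ → refl
    ; sym   = λ f≈g 0<D → sym (f≈g 0<D)
    ; trans = λ f≈g g≈h 0<D → trans (f≈g 0<D) (g≈h 0<D)
    }
  ; +-cong-mod    = λ f≈f′ g≈g′ 0<D → +-cong (f≈f′ 0<D) (g≈g′ 0<D)
  ; *-cong-mod    = λ f≈f′ g≈g′ 0<D → *-cong (f≈f′ 0<D) (g≈g′ 0<D)
  ; -‿cong-mod    = λ f≈f′ 0<D → -‿cong (f≈f′ 0<D)
  ; weaken        = λ D≤E f≈g 0<D → f≈g (ℕ.≤-trans 0<D D≤E)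
  ; reduce        = λ f≈g _ → f≈g
  ; trivial       = λ ()
  ; separated     = λ f≈g → f≈g 1 (s≤s z≤n)
  ; *-order       = λ
    { {zero}  f≈0 g≈0 0<E → trans (*-congˡ (g≈0 0<E)) (zeroʳ _)
    ; {suc D} f≈0 g≈0 _   → trans (*-congʳ (f≈0 (s≤s z≤n))) (zeroˡ _)
    }
  }
  where open CommutativeRing A

module ℕ-Semigroup = CommutativeSemigroupProperties ℕ.+-commutativeSemigroup

module PowerSeriesFiltration {c ℓ : Level} (A : RawRing c ℓ) (isA : IsCommutative A)
                             (F : Filtration (bundle A isA)) where
  open Filtration F
  private
    module Q (D : ℕ) where
      open CommutativeRing (quotient D) public
      open SemiringSum semiring public

    ∸-superadditive : ∀ D E k l → D ℕ.+ E ∸ (k ℕ.+ l) ≤ (D ∸ k) ℕ.+ (E ∸ l)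
    ∸-superadditive D E k l = ℕ.m≤n+o⇒m∸n≤o (D ℕ.+ E) (k ℕ.+ l) (ℕ.≤-trans
      (ℕ.+-mono-≤ (ℕ.m≤n+m∸n D k) (ℕ.m≤n+m∸n E l))
      (ℕ.≤-reflexive (ℕ-Semigroup.interchange k (D ∸ k) l (E ∸ l))))
    toℕ≤ : ∀ {n} (k : Fin (suc n)) → toℕ k ≤ n
    toℕ≤ k = ℕ.s≤s⁻¹ (Fin.toℕ<n k)

  -- The new variable has degree 1, so the coefficient of its `n`-th power is compared modulo degree
  -- `D ∸ n`. Applied three times to `discrete`, this measures the total degree in `t`, `x`, `u`.
  filtration : Filtration (bundle (powerSeries A) (PowerSeries.isCommutativeRing A isA))
  filtration = record
    { _≈[_]_        = λ f D g → ∀ n → f n ≈[ D ∸ n ] g n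
    ; isEquivalence = λ D → record
      { refl  = λ n → IsEquivalence.refl (isEquivalence (D ∸ n))
      ; sym   = λ f≈g n → IsEquivalence.sym (isEquivalence (D ∸ n)) (f≈g n)
      ; trans = λ f≈g g≈h n → IsEquivalence.trans (isEquivalence (D ∸ n)) (f≈g n) (g≈h n)
      }
    ; +-cong-mod    = λ f≈f′ g≈g′ n → +-cong-mod (f≈f′ n) (g≈g′ n)
    ; *-cong-mod    = λ {D} f≈f′ g≈g′ n → Q.sum-cong-≋ (D ∸ n) {suc n} (λ k → *-cong-mod
        (weaken (ℕ.∸-monoʳ-≤ D (toℕ≤ k)) (f≈f′ (toℕ k)))
        (weaken (ℕ.∸-monoʳ-≤ D (ℕ.m∸n≤m n (toℕ k))) (g≈g′ (n ∸ toℕ k))))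
    ; -‿cong-mod    = λ f≈f′ n → -‿cong-mod (f≈f′ n)
    ; weaken        = λ D≤E f≈g n → weaken (ℕ.∸-monoˡ-≤ n D≤E) (f≈g n)
    ; reduce        = λ f≈g n → reduce (f≈g n)
    ; trivial       = λ {f} {g} n → ≡.subst (λ D → f n ≈[ D ] g n) (≡.sym (ℕ.0∸n≡0 n)) trivial
    ; separated     = λ {f} {g} f≈g n → separated (λ D →
        ≡.subst (λ E → f n ≈[ E ] g n) (ℕ.m+n∸n≡m D n) (f≈g (D ℕ.+ n) n))
    ; *-order       = λ {D} {E} {f} {g} f≈0 g≈0 n → Q.trans (D ℕ.+ E ∸ n)
        (Q.sum-cong-≋ (D ℕ.+ E ∸ n) {suc n} (λ k → weaken
          (≡.subst (λ m → D ℕ.+ E ∸ m ≤ (D ∸ toℕ k) ℕ.+ (E ∸ (n ∸ toℕ k))) (ℕ.m+[n∸m]≡n (toℕ≤ k))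
            (∸-superadditive D E (toℕ k) (n ∸ toℕ k)))
          (*-order (f≈0 (toℕ k)) (g≈0 (n ∸ toℕ k)))))
        (Q.sum-replicate-zero (D ℕ.+ E ∸ n) (suc n))
    }

-- Inversion and reverse-complement of permutations

opposite-< : ∀ {i j : Fin n} → i Fin.< j → opposite j Fin.< opposite i
opposite-< {i = i} {j} i<j = ≡.subst₂ _<_ (≡.sym (Fin.opposite-prop j)) (≡.sym (Fin.opposite-prop i))
  (ℕ.∸-monoʳ-< (s≤s i<j) (Fin.toℕ<n j))

opposite-<⁻¹ : ∀ {i j : Fin n} → opposite j Fin.< opposite i → i Fin.< j
opposite-<⁻¹ oj<oi = ≡.subst₂ Fin._<_ (Fin.opposite-involutive _) (Fin.opposite-involutive _) (opposite-< oj<oi)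

opposite-suc-opposite : ∀ (k : Fin n) → opposite (suc (opposite k)) ≡ inject₁ k
opposite-suc-opposite k = Fin.toℕ-injective (≡.trans (Fin.opposite-suc (opposite k))
  (≡.trans (≡.cong toℕ (Fin.opposite-involutive k)) (≡.sym (Fin.toℕ-inject₁ k))))

opposite-inject₁-opposite : ∀ (k : Fin n) → opposite (inject₁ (opposite k)) ≡ suc k
opposite-inject₁-opposite k = ≡.trans
  (≡.cong opposite (≡.trans (≡.sym (opposite-suc-opposite (opposite k)))
    (≡.cong (opposite ∘ suc) (Fin.opposite-involutive k))))
  (Fin.opposite-involutive (suc k))

module _ {n : ℕ} (π : Permutation′ n) where

  -- A left-to-right minimum is a point of the diagram with no point to its lower left, a property
  -- invariant under reflection in the diagonal. Positions are matched along `π` itself.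
  lmin-flip : lmin (flip π) ≡ lmin π
  lmin-flip = count-permute (minimum? (flip π ⟨$⟩ʳ_)) (minimum? (π ⟨$⟩ʳ_)) π (λ i → mk⇔ (to i) (from i))
    where
    to : ∀ i → (∀ j → j Fin.< π ⟨$⟩ʳ i → π ⟨$⟩ˡ (π ⟨$⟩ʳ i) Fin.< π ⟨$⟩ˡ j) →
         ∀ j → j Fin.< i → π ⟨$⟩ʳ i Fin.< π ⟨$⟩ʳ j
    to i min j j<i = ℕ.≤∧≢⇒< (ℕ.≮⇒≥ λ πj<πi → ℕ.<⇒≯ j<i
        (≡.subst₂ Fin._<_ (Perm.inverseˡ π) (Perm.inverseˡ π) (min _ πj<πi)))
      (λ eq → ℕ.<⇒≢ j<i (≡.cong toℕ (≡.sym (≡.trans (≡.sym (Perm.inverseˡ π))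
        (≡.trans (≡.cong (π ⟨$⟩ˡ_) (Fin.toℕ-injective eq)) (Perm.inverseˡ π))))))
    from : ∀ i → (∀ j → j Fin.< i → π ⟨$⟩ʳ i Fin.< π ⟨$⟩ʳ j) →
           ∀ j → j Fin.< π ⟨$⟩ʳ i → π ⟨$⟩ˡ (π ⟨$⟩ʳ i) Fin.< π ⟨$⟩ˡ j
    from i min j j<πi rewrite Perm.inverseˡ π {i} = ℕ.≤∧≢⇒<
      (ℕ.≮⇒≥ λ π⁻¹j<i → ℕ.<⇒≯ j<πi (≡.subst (π ⟨$⟩ʳ i Fin.<_) (Perm.inverseʳ π) (min _ π⁻¹j<i)))
      (λ eq → ℕ.<⇒≢ j<πi (≡.cong toℕ (≡.sym (≡.trans (≡.cong (π ⟨$⟩ʳ_) (Fin.toℕ-injective eq)) (Perm.inverseʳ π)))))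

  -- The same argument with points to the upper right.
  rmax-flip : rmax (flip π) ≡ rmax π
  rmax-flip = count-permute (maximum? (flip π ⟨$⟩ʳ_)) (maximum? (π ⟨$⟩ʳ_)) π (λ i → mk⇔ (to i) (from i))
    where
    to : ∀ i → (∀ j → π ⟨$⟩ʳ i Fin.< j → π ⟨$⟩ˡ j Fin.< π ⟨$⟩ˡ (π ⟨$⟩ʳ i)) →
         ∀ j → i Fin.< j → π ⟨$⟩ʳ j Fin.< π ⟨$⟩ʳ i
    to i max j i<j = ℕ.≤∧≢⇒< (ℕ.≮⇒≥ λ πi<πj → ℕ.<⇒≯ i<j
        (≡.subst₂ Fin._<_ (Perm.inverseˡ π) (Perm.inverseˡ π) (max _ πi<πj)))
      (λ eq → ℕ.<⇒≢ i<j (≡.cong toℕ (≡.trans (≡.sym (Perm.inverseˡ π))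
        (≡.trans (≡.cong (π ⟨$⟩ˡ_) (≡.sym (Fin.toℕ-injective eq))) (Perm.inverseˡ π)))))
    from : ∀ i → (∀ j → i Fin.< j → π ⟨$⟩ʳ j Fin.< π ⟨$⟩ʳ i) →
           ∀ j → π ⟨$⟩ʳ i Fin.< j → π ⟨$⟩ˡ j Fin.< π ⟨$⟩ˡ (π ⟨$⟩ʳ i)
    from i max j πi<j rewrite Perm.inverseˡ π {i} = ℕ.≤∧≢⇒<
      (ℕ.≮⇒≥ λ i<π⁻¹j → ℕ.<⇒≯ πi<j (≡.subst (Fin._< π ⟨$⟩ʳ i) (Perm.inverseʳ π) (max _ i<π⁻¹j)))
      (λ eq → ℕ.<⇒≢ πi<j (≡.cong toℕ (≡.trans (≡.cong (π ⟨$⟩ʳ_) (≡.sym (Fin.toℕ-injective eq))) (Perm.inverseʳ π))))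

-- A half-turn of the diagram: it exchanges lower left with upper right and preserves descents.
reverseComplement : Permutation′ n → Permutation′ n
reverseComplement π = reverse ∘ₚ (π ∘ₚ reverse)

module _ {n : ℕ} (π : Permutation′ n) where

  private
    opposite-swap : ∀ {i j : Fin n} → i Fin.< opposite j → j Fin.< opposite i
    opposite-swap {i} {j} i<oj = opposite-<⁻¹ (≡.subst (Fin._< opposite j) (≡.sym (Fin.opposite-involutive i)) i<oj)

    opposite-swap′ : ∀ {i j : Fin n} → opposite j Fin.< i → opposite i Fin.< j
    opposite-swap′ {i} {j} oj<i = opposite-<⁻¹ (≡.subst (opposite j Fin.<_) (≡.sym (Fin.opposite-involutive i)) oj<i)

  lmin-reverseComplement : lmin (reverseComplement π) ≡ rmax π
  lmin-reverseComplement = count-permute (minimum? (reverseComplement π ⟨$⟩ʳ_)) (maximum? (π ⟨$⟩ʳ_)) reverse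
    (λ i → mk⇔
      (λ min j i<j → ≡.subst₂ (λ i j → π ⟨$⟩ʳ i Fin.< π ⟨$⟩ʳ j) (Fin.opposite-involutive j) (Fin.opposite-involutive i)
        (opposite-<⁻¹ (min (opposite j) (opposite-< i<j))))
      (λ max j j<oi → opposite-< (≡.subst (λ i → π ⟨$⟩ʳ opposite j Fin.< π ⟨$⟩ʳ i) (≡.sym (Fin.opposite-involutive i))
        (max (opposite j) (opposite-swap j<oi)))))

  rmax-reverseComplement : rmax (reverseComplement π) ≡ lmin π
  rmax-reverseComplement = count-permute (maximum? (reverseComplement π ⟨$⟩ʳ_)) (minimum? (π ⟨$⟩ʳ_)) reverse
    (λ i → mk⇔
      (λ max j j<i → ≡.subst₂ (λ i j → π ⟨$⟩ʳ i Fin.< π ⟨$⟩ʳ j) (Fin.opposite-involutive i) (Fin.opposite-involutive j)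
        (opposite-<⁻¹ (max (opposite j) (opposite-< j<i))))
      (λ min j oi<j → opposite-< (≡.subst (λ i → π ⟨$⟩ʳ i Fin.< π ⟨$⟩ʳ opposite j) (≡.sym (Fin.opposite-involutive i))
        (min (opposite j) (opposite-swap′ oi<j)))))

des-reverseComplement : (π : Permutation′ n) → des (reverseComplement π) ≡ des π
des-reverseComplement {zero}  π = ≡.refl
des-reverseComplement {suc n} π = count-permute
  (λ i → reverseComplement π ⟨$⟩ʳ suc i <? reverseComplement π ⟨$⟩ʳ inject₁ i)
  (λ i → π ⟨$⟩ʳ suc i <? π ⟨$⟩ʳ inject₁ i) reverse
  (λ i → mk⇔
    (λ lt → ≡.subst₂ (λ i j → π ⟨$⟩ʳ i Fin.< π ⟨$⟩ʳ j) (opposite-inject₁-opposite i) (opposite-suc-opposite i) (opposite-<⁻¹ lt))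
    (λ lt → opposite-< (≡.subst₂ (λ i j → π ⟨$⟩ʳ i Fin.< π ⟨$⟩ʳ j)
      (≡.sym (opposite-inject₁-opposite i)) (≡.sym (opposite-suc-opposite i)) lt)))

ides-reverseComplement : (π : Permutation′ n) → ides (reverseComplement π) ≡ ides π
ides-reverseComplement {zero}  π = ≡.refl
ides-reverseComplement {suc n} π = ≡.trans
  (descents-cong {w = flip (reverseComplement π) ⟨$⟩ʳ_} {reverseComplement (flip π) ⟨$⟩ʳ_} (λ i → ≡.refl))
  (des-reverseComplement (flip π))

des-cong : (π σ : Permutation′ n) → π Perm.≈ σ → des π ≡ des σ
des-cong {zero}  π σ π≈σ = ≡.refl
des-cong {suc n} π σ π≈σ = descents-cong {w = π ⟨$⟩ʳ_} {σ ⟨$⟩ʳ_} π≈σ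

flip-cong : (π σ : Permutation′ n) → π Perm.≈ σ → flip π Perm.≈ flip σ
flip-cong π σ π≈σ i = ≡.trans (≡.cong (π ⟨$⟩ˡ_) (≡.sym (Perm.inverseʳ σ)))
  (≡.trans (≡.cong (π ⟨$⟩ˡ_) (≡.sym (π≈σ (σ ⟨$⟩ˡ i)))) (Perm.inverseˡ π))

reverseComplement-cong : (π σ : Permutation′ n) → π Perm.≈ σ → reverseComplement π Perm.≈ reverseComplement σ
reverseComplement-cong π σ π≈σ i = ≡.cong opposite (π≈σ (opposite i))

reverseComplement-involutive : (π : Permutation′ n) → reverseComplement (reverseComplement π) Perm.≈ π
reverseComplement-involutive π i = ≡.trans (Fin.opposite-involutive _) (≡.cong (π ⟨$⟩ʳ_) (Fin.opposite-involutive i))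

statistics : (Permutation′ n → ℕ × ℕ × ℕ × ℕ)
statistics π = des π , ides π , lmin π , rmax π

statistics-cong : (π σ : Permutation′ n) → π Perm.≈ σ → statistics π ≡ statistics σ
statistics-cong π σ π≈σ = ≡.cong₂ _,_ (des-cong π σ π≈σ)
  (≡.cong₂ _,_ (des-cong (flip π) (flip σ) (flip-cong π σ π≈σ))
  (≡.cong₂ _,_ (minima-cong {w = π ⟨$⟩ʳ_} {σ ⟨$⟩ʳ_} π≈σ) (maxima-cong {w = π ⟨$⟩ʳ_} {σ ⟨$⟩ʳ_} π≈σ)))

-- Invariance of sums over all permutations

module PermutationSums {c ℓ : Level} (R : CommutativeRing c ℓ) where
  open CommutativeRing R hiding (zero)
  open SemiringSum semiring
  open SetoidReasoning setoid
  open Standardisation R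

  infix 4 _≈?_
  _≈?_ : (σ π : Permutation′ n) → Dec (σ Perm.≈ π)
  σ ≈? π = all? λ i → σ ⟨$⟩ʳ i Fin.≟ π ⟨$⟩ʳ i

  ∑-≟ : ∀ (k : Fin n) → ∑[ j < n ] ind (j Fin.≟ k) ≈ 1#
  ∑-≟ {suc n} zero    = trans (+-congˡ (sum-replicate-zero n)) (+-identityʳ 1#)
  ∑-≟ {suc n} (suc k) = trans (+-identityˡ _) (trans
    (sum-cong-≋ {n} (λ j → ind-cong (suc j Fin.≟ suc k) (j Fin.≟ k) (mk⇔ Fin.suc-injective (≡.cong suc))))
    (∑-≟ k))

  insert≈ : ∀ j (σ : Permutation′ n) π →
            insert zero j σ Perm.≈ π ⇔ (j ≡ π ⟨$⟩ʳ zero × σ Perm.≈ remove zero π)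
  insert≈ j σ π = mk⇔
    (λ eq → eq zero , λ i → Fin.punchIn-injective j _ _ (≡.trans (eq (suc i))
      (≡.trans (Perm.punchIn-permute π zero i) (≡.cong (λ j → punchIn j (remove zero π ⟨$⟩ʳ i)) (≡.sym (eq zero))))))
    (λ { (j≡ , eq) zero    → j≡
       ; (j≡ , eq) (suc i) → ≡.trans (≡.cong₂ punchIn j≡ (eq i)) (≡.sym (Perm.punchIn-permute π zero i)) })

  ∑-perm-≈? : ∀ n (π : Permutation′ n) → ∑-perm n (λ σ → ind (σ ≈? π)) ≈ 1#
  ∑-perm-≈? zero    π = +-identityʳ 1#
  ∑-perm-≈? (suc n) π = begin
    ∑-perm (suc n) (λ σ → ind (σ ≈? π))
      ≈⟨ ∑-perm-suc n (λ σ → ind (σ ≈? π)) ⟩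
    ∑[ j < suc n ] ∑-perm n (λ σ → ind (insert zero j σ ≈? π))
      ≈⟨ sum-cong-≋ {suc n} (λ j → trans
           (∑-list-cong (permutations n) (λ σ → trans
             (ind-cong (insert zero j σ ≈? π) ((j Fin.≟ π ⟨$⟩ʳ zero) ×-dec (σ ≈? remove zero π)) (insert≈ j σ π))
             (ind-× (j Fin.≟ π ⟨$⟩ʳ zero) (σ ≈? remove zero π))))
           (∑-list-* (permutations n) (ind (j Fin.≟ π ⟨$⟩ʳ zero)) (λ σ → ind (σ ≈? remove zero π)))) ⟩
    ∑[ j < suc n ] (ind (j Fin.≟ π ⟨$⟩ʳ zero) * ∑-perm n (λ σ → ind (σ ≈? remove zero π)))
      ≈⟨ sum-cong-≋ {suc n} (λ j → trans
           (*-congˡ {ind (j Fin.≟ π ⟨$⟩ʳ zero)} (∑-perm-≈? n (remove zero π))) (*-identityʳ _)) ⟩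
    ∑[ j < suc n ] ind (j Fin.≟ π ⟨$⟩ʳ zero)
      ≈⟨ ∑-≟ (π ⟨$⟩ʳ zero) ⟩
    1#
      ∎

  -- The image of the list under `φ` agrees with it only up to order and pointwise equality.
  -- Instead, both sides become a sum over the pairs with `σ ≈ φ π`, a relation symmetric in `σ` and
  -- `π` because `φ` is an involution.
  ∑-perm-involution : (φ : Permutation′ n → Permutation′ n) →
    (∀ π σ → π Perm.≈ σ → φ π Perm.≈ φ σ) → (∀ π → φ (φ π) Perm.≈ π) →
    (f : Permutation′ n → Carrier) → (∀ π σ → π Perm.≈ σ → f π ≈ f σ) →
    ∑-perm n (f ∘ φ) ≈ ∑-perm n f
  ∑-perm-involution {n} φ φ-cong φ-involutive f f-cong = begin
    ∑-perm n (f ∘ φ)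
      ≈⟨ ∑-list-cong (permutations n) (λ π → expand (f ∘ φ) (λ σ → σ ≈? φ π) (∑-perm-≈? n (φ π)) π) ⟩
    ∑-perm n (λ π → ∑-perm n (λ σ → ind (σ ≈? φ π) * f (φ π)))
      ≈⟨ ∑-list-cong (permutations n) (λ π → ∑-list-cong (permutations n) (λ σ → trans
           (ind-weaken (σ ≈? φ π) (λ σ≈φπ → sym (f-cong σ (φ π) σ≈φπ)))
           (*-congʳ (ind-cong (σ ≈? φ π) (π ≈? φ σ) (mk⇔ (swap σ π) (swap π σ)))))) ⟩
    ∑-perm n (λ π → ∑-perm n (λ σ → ind (π ≈? φ σ) * f σ))
      ≈⟨ ∑-list-comm (permutations n) (permutations n) (λ π σ → ind (π ≈? φ σ) * f σ) ⟩
    ∑-perm n (λ σ → ∑-perm n (λ π → ind (π ≈? φ σ) * f σ))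
      ≈⟨ ∑-list-cong (permutations n) (λ σ → expand f (λ π → π ≈? φ σ) (∑-perm-≈? n (φ σ)) σ) ⟨
    ∑-perm n f
      ∎
    where
    swap : ∀ π σ → π Perm.≈ φ σ → σ Perm.≈ φ π
    swap π σ π≈φσ i = ≡.sym (≡.trans (φ-cong π (φ σ) π≈φσ i) (φ-involutive σ i))

    expand : ∀ (g : Permutation′ n → Carrier) {P : Permutation′ n → Set} (P? : ∀ σ → Dec (P σ)) →
      ∑-perm n (λ σ → ind (P? σ)) ≈ 1# → ∀ π → g π ≈ ∑-perm n (λ σ → ind (P? σ) * g π)
    expand g P? ∑≈1 π = begin
      g π                                  ≈⟨ *-identityʳ _ ⟨
      g π * 1#                             ≈⟨ *-congˡ ∑≈1 ⟨
      g π * ∑-perm n (λ σ → ind (P? σ))    ≈⟨ ∑-list-* (permutations n) (g π) (λ σ → ind (P? σ)) ⟨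
      ∑-perm n (λ σ → g π * ind (P? σ))    ≈⟨ ∑-list-cong (permutations n) (λ σ → *-comm _ _) ⟩
      ∑-perm n (λ σ → ind (P? σ) * g π)    ∎

  ∑-perm-reverseComplement : ∀ n (W : ℕ × ℕ × ℕ × ℕ → Carrier) →
    ∑-perm n (λ π → W (des π , ides π , rmax π , lmin π)) ≈ ∑-perm n (W ∘ statistics)
  ∑-perm-reverseComplement n W = trans
    (∑-list-cong (permutations n) (λ π → reflexive (≡.cong W (≡.sym
      (≡.cong₂ _,_ (des-reverseComplement π) (≡.cong₂ _,_ (ides-reverseComplement π)
        (≡.cong₂ _,_ (lmin-reverseComplement π) (rmax-reverseComplement π))))))))
    (∑-perm-involution {n} reverseComplement reverseComplement-cong reverseComplement-involutive
      (W ∘ statistics) (λ π σ π≈σ → reflexive (≡.cong W (statistics-cong π σ π≈σ))))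

  ∑-perm-flip : ∀ n (W : ℕ × ℕ × ℕ × ℕ → Carrier) →
    ∑-perm n (λ π → W (ides π , des π , lmin π , rmax π)) ≈ ∑-perm n (W ∘ statistics)
  ∑-perm-flip n W = trans
    (∑-list-cong (permutations n) (λ π → reflexive (≡.cong W (≡.sym
      (≡.cong₂ _,_ (≡.refl {x = ides π}) (≡.cong₂ _,_ (des-cong (flip (flip π)) π (λ i → ≡.refl))
        (≡.cong₂ _,_ (lmin-flip π) (rmax-flip π))))))))
    (∑-perm-involution {n} flip flip-cong (λ π i → ≡.refl)
      (W ∘ statistics) (λ π σ π≈σ → reflexive (≡.cong W (statistics-cong π σ π≈σ))))

module _ where
  open Standardisation ℤ.+-*-commutativeRing

  -- Counting in ℤ makes the lemmas on sums in a commutative ring available.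
  length-filter-∑ : {A : Set} {P : Pred A 0ℓ} (P? : Decidable P) (as : List A) →
                    ℤ.+ length (filter P? as) ≡ ∑-list as (ind ∘ P?)
  length-filter-∑ P? []       = ≡.refl
  length-filter-∑ P? (a ∷ as) with does (P? a)
  ... | true  = ≡.cong (λ k → ℤ.1ℤ ℤ.+ k) (length-filter-∑ P? as)
  ... | false = ≡.trans (length-filter-∑ P? as) (≡.sym (ℤ.+-identityˡ _))

-- The formula in a filtered ring

module Inverses {c ℓ : Level} (A : CommutativeRing c ℓ) where
  open CommutativeRing A hiding (zero)
  open SemiringExp semiring
  open SemiringSum semiring
  open SetoidReasoning setoid
  open IntegerSolver A
  open Words A

  ∑<-extend : ∀ {m n} → m ≤ n → (f : ℕ → Carrier) → (∀ i → m ≤ i → f i ≈ 0#) → ∑< m f ≈ ∑< n f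
  ∑<-extend {n = n} z≤n f f≈0 = sym (trans (∑<-cong n (λ i _ → f≈0 i z≤n)) (sum-replicate-zero n))
  ∑<-extend (s≤s m≤n) f f≈0 = +-congˡ (∑<-extend m≤n (f ∘ suc) (λ i m≤i → f≈0 (suc i) (s≤s m≤i)))

  geometric-sum : ∀ b f n → f * (b * ∑< n ((1# - b * f) ^_)) ≈ 1# - (1# - b * f) ^ n
  geometric-sum b f zero    = solve 2 (λ b f → f :* (b :* :0) := :1 :- :1) refl b f
  geometric-sum b f (suc n) = begin
    f * (b * (1# + ∑< n (λ k → g * g ^ k)))     ≈⟨ *-congˡ (*-congˡ (+-congˡ (*-distribˡ-sum {n} g (λ k → g ^ toℕ k)))) ⟨
    f * (b * (1# + g * ∑< n (g ^_)))            ≈⟨ solve 4 (λ f b g S → f :* (b :* (:1 :+ g :* S)) := b :* f :+ g :* (f :* (b :* S))) refl f b g _ ⟩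
    b * f + g * (f * (b * ∑< n (g ^_)))         ≈⟨ +-congˡ (*-congˡ (geometric-sum b f n)) ⟩
    b * f + g * (1# - g ^ n)                    ≈⟨ solve 3 (λ b f G → b :* f :+ (:1 :- b :* f) :* (:1 :- G) := :1 :- (:1 :- b :* f) :* G) refl b f (g ^ n) ⟩
    1# - g * g ^ n                              ∎
    where g = 1# - b * f

  inverse-unique : ∀ {a b b′} → a * b ≈ 1# → a * b′ ≈ 1# → b ≈ b′
  inverse-unique {a} {b} {b′} ab≈1 ab′≈1 = begin
    b               ≈⟨ *-identityʳ b ⟨
    b * 1#          ≈⟨ *-congˡ ab′≈1 ⟨
    b * (a * b′)    ≈⟨ solve 3 (λ a b c → b :* (a :* c) := a :* b :* c) refl a b b′ ⟩
    a * b * b′      ≈⟨ *-congʳ ab≈1 ⟩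
    1# * b′         ≈⟨ *-identityˡ b′ ⟩
    b′              ∎

  inverse-* : ∀ {a b a′ b′} → a * a′ ≈ 1# → b * b′ ≈ 1# → (a * b) * (a′ * b′) ≈ 1#
  inverse-* {a} {b} {a′} {b′} aa′≈1 bb′≈1 = begin
    (a * b) * (a′ * b′)   ≈⟨ solve 4 (λ a b a′ b′ → (a :* b) :* (a′ :* b′) := (a :* a′) :* (b :* b′)) refl a b a′ b′ ⟩
    (a * a′) * (b * b′)   ≈⟨ *-cong aa′≈1 bb′≈1 ⟩
    1# * 1#               ≈⟨ *-identityˡ 1# ⟩
    1#                    ∎

  inverse-^ : ∀ {a a′} → a * a′ ≈ 1# → ∀ n → a ^ n * a′ ^ n ≈ 1#
  inverse-^ aa′≈1 zero    = *-identityˡ 1#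
  inverse-^ aa′≈1 (suc n) = inverse-* aa′≈1 (inverse-^ aa′≈1 n)

  -- The quotients of `r^(i+1) - 1` by `t` obey a recursion, which yields them without division.
  power-quotient-step : ∀ t h P → t * h ≈ P - 1# → t * ((1# - t) * h - 1#) ≈ (1# - t) * P - 1#
  power-quotient-step t h P th≈ = begin
    t * ((1# - t) * h - 1#)       ≈⟨ solve 2 (λ t h → t :* ((:1 :- t) :* h :- :1) := (:1 :- t) :* (t :* h) :- t) refl t h ⟩
    (1# - t) * (t * h) - t        ≈⟨ +-congʳ (*-congˡ th≈) ⟩
    (1# - t) * (P - 1#) - t       ≈⟨ solve 2 (λ t P → (:1 :- t) :* (P :- :1) :- t := (:1 :- t) :* P :- :1) refl t P ⟩
    (1# - t) * P - 1#             ∎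

  power-quotient-zero : ∀ t → t * - 1# ≈ (1# - t) * 1# - 1#
  power-quotient-zero t = solve 1 (λ t → t :* :- :1 := (:1 :- t) :* :1 :- :1) refl t

  numerator-quotient : ∀ t q h P → t * h ≈ (1# - t) * P - 1# →
                       t * (h + (1# - q) * P) ≈ (1# - q * t) * P - 1#
  numerator-quotient t q h P th≈ = begin
    t * (h + (1# - q) * P)                        ≈⟨ solve 4 (λ t q h P → t :* (h :+ (:1 :- q) :* P) := t :* h :+ t :* (:1 :- q) :* P) refl t q h P ⟩
    t * h + t * (1# - q) * P                      ≈⟨ +-congʳ th≈ ⟩
    (1# - t) * P - 1# + t * (1# - q) * P          ≈⟨ solve 3 (λ t q P → (:1 :- t) :* P :- :1 :+ t :* (:1 :- q) :* P := (:1 :- q :* t) :* P :- :1) refl t q P ⟩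
    (1# - q * t) * P - 1#                         ∎

module FilteredInverse {c ℓ : Level} (S : CommutativeRing c ℓ) (F : Filtration S) where
  open CommutativeRing S hiding (zero)
  open Filtration F using (_≈[_]_; quotient; reduce; separated; -‿cong-mod; ^-order)
  open RingProperties ring
  open SemiringExp semiring
  open Words S
  open Inverses S
  private
    module Q (D : ℕ) = CommutativeRing (quotient D)

  -- Modulo degree `D` the series is a finite geometric sum, with error `(1 - b f) ^ D`, which
  -- vanishes because `1 - b f` has order 1.
  inverse-geometric : (∑∞ : (ℕ → Carrier) → Carrier) →
    (∀ f → (∀ m → f m ≈[ m ] 0#) → ∀ D → ∑∞ f ≈[ D ] ∑< D f) →
    ∀ b f → (1# - b * f) ≈[ 1 ] 0# → f * (b * ∑∞ ((1# - b * f) ^_)) ≈ 1#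
  inverse-geometric ∑∞ ∑∞-mod b f order = separated λ D → Q.trans D
    (Q.*-congˡ D (Q.*-congˡ D (∑∞-mod _ (^-order order) D)))
    (Q.trans D (reduce (geometric-sum b f D))
    (Q.trans D (Q.+-congˡ D (-‿cong-mod (^-order order D)))
      (reduce (trans (+-congˡ -0#≈0#) (+-identityʳ 1#)))))

  inverse-geometric-cong : (∑∞ : (ℕ → Carrier) → Carrier) →
    (∀ f g → (∀ m → f m ≈ g m) → ∑∞ f ≈ ∑∞ g) →
    ∀ b f g → f ≈ g → b * ∑∞ ((1# - b * f) ^_) ≈ b * ∑∞ ((1# - b * g) ^_)
  inverse-geometric-cong ∑∞ ∑∞-cong b f g f≈g =
    *-congˡ (∑∞-cong _ _ (λ m → ^-congˡ m (+-congˡ (-‿cong (*-congˡ f≈g)))))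

module Assembly {c ℓ : Level} (S : CommutativeRing c ℓ) (F : Filtration S) where
  open CommutativeRing S hiding (zero; isEquivalence; +-cong)
  open Filtration F
  open RingProperties ring
  open SemiringExp semiring
  open Words S
  open Standardisation S
  open PermutationSums S
  open Inverses S
  open Resolvent S using (∏<; ∏<-cong; ∏<-scale)
  private
    module Q (D : ℕ) = CommutativeRing (quotient D)

  -- The integer `-(n + 1)`: the constant term of `(r^(n+1) - 1) / t` and, for `n = 0`, also of
  -- `x - 1` and `x - rⁱ`.
  negative : ℕ → Carrier
  negative zero    = - 1#
  negative (suc n) = negative n - 1#

  module Formula
    (∑∞ : (ℕ → Carrier) → Carrier)
    (∑∞-mod : ∀ f → (∀ m → f m ≈[ m ] 0#) → ∀ D → ∑∞ f ≈[ D ] ∑< D f)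
    (inverse divideByT : Carrier → Carrier)
    (t u v q x : Carrier)
    (inverse-one : ∀ f → f ≈[ 1 ] 1# → f * inverse f ≈ 1#)
    (inverse-negative : ∀ n f → f ≈[ 1 ] negative n → f * inverse f ≈ 1#)
    (t-order : t ≈[ 1 ] 0#) (u-order : u ≈[ 1 ] 0#) (x-order : x ≈[ 1 ] 0#)
    (divideByT-* : ∀ f g → t * f ≈ g → divideByT g ≈ f)
    (cancel : ∀ f g → u * x * f ≈ u * x * g → f ≈ g)
    where

    infixl 7 _/_ _/ₜ_
    _/_ _/ₜ_ : Carrier → Carrier → Carrier
    f / g  = f * inverse g
    f /ₜ g = divideByT f / divideByT g

    r : Carrier
    r = 1# - t

    factor : ℕ → Carrier
    factor i = u * (x - r ^ i - x * v * t) * (((1# - q * t) * r ^ (i ∸ 1) - 1#) /ₜ (r ^ i - 1#)) / (x - r ^ i)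

    term : (x u v q : Carrier) → ∀ n → Permutation′ n → Carrier
    term x u v q n π = u ^ des π * x ^ ides π * q ^ lmin π * v ^ rmax π * 1# ^ lmax π
      / ((1# - u) ^ n * (1# - x) ^ n)

    𝓖 : (x u v q : Carrier) → Carrier
    𝓖 x u v q = ∑∞ (λ m → t ^ suc m * ∑-perm (suc m) (term x u v q (suc m)))

    private
      _≈₁_ : Carrier → Carrier → Set ℓ
      f ≈₁ g = f ≈[ 1 ] g

      minus-order : ∀ {f} → f ≈₁ 0# → ∀ g → (g - f) ≈₁ g
      minus-order {f} f≈0 g = Q.trans 1 (Q.+-congˡ 1 {g} (-‿cong-mod f≈0))
        (reduce (trans (+-congˡ -0#≈0#) (+-identityʳ g)))

      ^-one : ∀ {f} → f ≈₁ 1# → ∀ n → (f ^ n) ≈₁ 1#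
      ^-one f≈1 zero    = Q.refl 1
      ^-one f≈1 (suc n) = Q.trans 1 (*-cong-mod f≈1 (^-one f≈1 n)) (reduce (*-identityˡ 1#))

      absorb : ∀ {D f} → f ≈[ D ] 0# → ∀ g → (f * g) ≈[ D ] 0#
      absorb {D} f≈0 g = Q.trans D (Q.*-congʳ D f≈0) (reduce (zeroˡ g))

      r≈1 : r ≈₁ 1#
      r≈1 = minus-order t-order 1#

      swap-inverse : ∀ {f g} → f * g ≈ 1# → g * f ≈ 1#
      swap-inverse fg≈1 = trans (*-comm _ _) fg≈1

      x-minus : ∀ {f} → f ≈₁ 1# → (x - f) ≈₁ negative 0
      x-minus {f} f≈1 = Q.trans 1 (+-cong-mod x-order (-‿cong-mod f≈1)) (reduce (+-identityˡ _))

      ^-quotient : ∀ D a n → a ^ n ≡ SemiringExp._^_ (Q.semiring D) a n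
      ^-quotient D a zero    = ≡.refl
      ^-quotient D a (suc n) = ≡.cong (a *_) (^-quotient D a n)

      s η ξ χ : Carrier
      s = inverse (1# - t)
      η = inverse (1# - u)
      ξ = inverse (1# - x)
      χ = inverse (x - 1#)

      ω h g ι : ℕ → Carrier
      ω i = inverse (x - r ^ suc i)
      g i = divideByT (r ^ suc i - 1#)
      ι i = inverse (g i)
      h zero    = - 1#
      h (suc i) = r * h i - 1#

      1-u-inverse : (1# - u) * η ≈ 1#
      1-u-inverse = inverse-one (1# - u) (minus-order u-order 1#)

      1-x-inverse : (1# - x) * ξ ≈ 1#
      1-x-inverse = inverse-one (1# - x) (minus-order x-order 1#)

      h-eq : ∀ i → t * h i ≈ r ^ suc i - 1#
      h-eq zero    = power-quotient-zero t
      h-eq (suc i) = power-quotient-step t (h i) (r ^ suc i) (h-eq i)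

      h-negative : ∀ i → h i ≈₁ negative i
      h-negative zero    = Q.refl 1
      h-negative (suc i) = Q.+-congʳ 1 { - 1# } (Q.trans 1 (*-cong-mod r≈1 (h-negative i)) (reduce (*-identityˡ (negative i))))

      g≈h : ∀ i → g i ≈ h i
      g≈h i = divideByT-* (h i) (r ^ suc i - 1#) (h-eq i)

      g-eq : ∀ i → t * g i ≈ r ^ suc i - 1#
      g-eq i = trans (*-congˡ (g≈h i)) (h-eq i)

      g-inverse : ∀ i → g i * ι i ≈ 1#
      g-inverse i = inverse-negative i (g i) (Q.trans 1 (reduce (g≈h i)) (h-negative i))

      φ : ℕ → Carrier
      φ i = u * (x - r ^ suc i - x * v * t) * ((g i + (1# - q) * r ^ i) * ι i) * ω i

      factor≈φ : ∀ i → factor (suc i) ≈ φ i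
      factor≈φ i = *-congʳ (*-congˡ (*-congʳ
        (divideByT-* _ _ (numerator-quotient t q (g i) (r ^ i) (g-eq i)))))

      ∏factor : ℕ → Carrier
      ∏factor m = ∏< m (λ i → factor (suc i))

      -- Each factor contains one `u`. This is the degree condition under which `∑∞` may be
      -- truncated.
      ∏factor-order : ∀ m → ∏factor m ≈[ m ] 0#
      ∏factor-order m = Q.trans m
        (reduce (trans (∏<-cong m (λ i → trans (*-congʳ (*-assoc _ _ _)) (*-assoc u (rest i) (ω i))))
                       (∏<-scale m u (λ i → rest i * ω i))))
        (absorb (^-order u-order m) _)
        where
        rest : ℕ → Carrier
        rest i = (x - r ^ suc i - x * v * t) * (((1# - q * t) * r ^ i - 1#) /ₜ (r ^ suc i - 1#))

      ∏-term-order : ∀ (a : ℕ → Carrier) m → (a m * ∏factor m) ≈[ m ] 0#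
      ∏-term-order a m = Q.trans m (reduce (*-comm _ _)) (absorb (∏factor-order m) (a m))

      t-term-order : ∀ (a : ℕ → Carrier) m → (t ^ suc m * a m) ≈[ m ] 0#
      t-term-order a m = absorb (weaken (ℕ.n≤1+n m) (^-order t-order (suc m))) (a m)

      denominator : ∀ n → inverse ((1# - u) ^ n * (1# - x) ^ n) ≈ η ^ n * ξ ^ n
      denominator n = inverse-unique
        (inverse-one _ (Q.trans 1
          (*-cong-mod (^-one (minus-order u-order 1#) n) (^-one (minus-order x-order 1#) n))
          (reduce (*-identityˡ 1#))))
        (inverse-* (inverse-^ 1-u-inverse n) (inverse-^ 1-x-inverse n))

      weight : ∀ n → Permutation′ n → Carrier
      weight n π = u ^ des π * x ^ ides π * q ^ lmin π * v ^ rmax π * (η ^ n * ξ ^ n)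

      𝓖-mod : ∀ D → 𝓖 x u v q ≈[ D ] ∑< D (λ m → t ^ suc m * ∑-perm (suc m) (weight (suc m)))
      𝓖-mod D = Q.trans D
        (∑∞-mod _ (t-term-order (λ m → ∑-perm (suc m) (term x u v q (suc m)))) D)
        (reduce (∑<-cong D (λ m _ → *-congˡ {t ^ suc m} (∑-list-cong (permutations (suc m)) (λ π →
          *-cong (trans (*-congˡ {u ^ des π * x ^ ides π * q ^ lmin π * v ^ rmax π} (1^n≈1 (lmax π))) (*-identityʳ _))
                 (denominator (suc m)))))))

      A C : ℕ → Carrier
      A i = (q * x - 1# + (1# - q) * r ^ i) * ω i
      C i = (x - 1# - x * v) * r ^ i + x * v

      SA SC : Carrier
      SA = ∑∞ (λ m → (q * x - 1# + (1# - q) * r ^ m) / (x - r ^ suc m) * ∏factor m)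
      SC = ∑∞ (λ m → C m * (t /ₜ (r ^ suc m - 1#)) * ∏factor m)

      ∏factor≈ : ∀ m → ∏factor m ≈ ∏< m φ
      ∏factor≈ m = ∏<-cong m factor≈φ

      SA-mod : ∀ D → SA ≈[ D ] ∑< D (λ i → A i * ∏< i φ)
      SA-mod D = Q.trans D (∑∞-mod _ (∏-term-order A) D)
        (reduce (∑<-cong D (λ m _ → *-congˡ {A m} (∏factor≈ m))))

      SC-mod : ∀ D → SC ≈[ D ] ∑< D (λ i → C i * ι i * ∏< i φ)
      SC-mod D = Q.trans D (∑∞-mod _ (∏-term-order (λ m → C m * (t /ₜ (r ^ suc m - 1#)))) D)
        (reduce (∑<-cong D (λ m _ → *-cong {C m * (t /ₜ (r ^ suc m - 1#))} {C m * ι m}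
          (*-congˡ {C m} (trans (*-congʳ {ι m} (divideByT-* 1# t (*-identityʳ t))) (*-identityˡ (ι m))))
          (∏factor≈ m))))

      denominator-series : Carrier
      denominator-series = 1# - u * (q - 1#) / (x - 1#) * SC

      identity-mod : ∀ D → (u * x * (𝓖 x u v q * denominator-series)) ≈[ D ] (u * x * (v * t * ξ * SA))
      identity-mod D = Q.trans D
        (*-cong-mod (Q.refl D) (*-cong-mod (𝓖-mod D) (+-cong-mod (Q.refl D)
          (-‿cong-mod (*-cong-mod (Q.refl D) (SC-mod D))))))
        (Q.trans D
          (Resolvent.PowerIdentity.power-identity (quotient D) _^_ (^-quotient D) t u v q x s η ξ χ ω g ι D
            (reduce (inverse-one r r≈1))
            (reduce (swap-inverse 1-u-inverse))
            (reduce (swap-inverse 1-x-inverse))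
            (reduce (swap-inverse (inverse-negative 0 (x - 1#) (x-minus (Q.refl 1)))))
            (λ i → reduce (swap-inverse (inverse-negative 0 (x - r ^ suc i) (x-minus (^-one r≈1 (suc i))))))
            (λ i → reduce (g-eq i))
            (λ i → reduce (swap-inverse (g-inverse i)))
            (^-order t-order D) (^-order u-order D) (^-order x-order D))
          (*-cong-mod (Q.refl D) (*-cong-mod (Q.refl D) (Q.sym D (SA-mod D)))))

    formula : 𝓖 x u v q ≈ v * t / (1# - x) * SA * inverse denominator-series
    formula = begin
      𝓖 x u v q
        ≈⟨ *-identityʳ _ ⟨
      𝓖 x u v q * 1#
        ≈⟨ *-congˡ denominator-inverse ⟨
      𝓖 x u v q * (denominator-series * inverse denominator-series)
        ≈⟨ *-assoc _ _ _ ⟨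
      𝓖 x u v q * denominator-series * inverse denominator-series
        -- The congruences for all `D` together give an equality in the full ring, where `u * x` can
        -- be cancelled.
        ≈⟨ *-congʳ (cancel _ _ (separated identity-mod)) ⟩
      v * t * ξ * SA * inverse denominator-series
        ∎
      where
      open SetoidReasoning setoid
      denominator-inverse : denominator-series * inverse denominator-series ≈ 1#
      denominator-inverse = inverse-one denominator-series (minus-order
        (Q.trans 1 (reduce (trans (*-congʳ (*-assoc u _ _)) (*-assoc u _ _))) (absorb u-order _)) 1#)

    -- Here `∑∞` is an abstract operation, known only through its truncations, so even its
    -- congruence is derived from these.
    ∑∞-cong : ∀ (a b : ℕ → Carrier) → (∀ m → a m ≈ b m) →
      ∑∞ (λ m → t ^ suc m * a m) ≈ ∑∞ (λ m → t ^ suc m * b m)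
    ∑∞-cong a b a≈b = separated (λ D → Q.trans D (∑∞-mod _ (t-term-order a) D)
      (Q.trans D (reduce (∑<-cong D (λ m _ → *-congˡ {t ^ suc m} (a≈b m))))
        (Q.sym D (∑∞-mod _ (t-term-order b) D))))

    𝓖-swap-vq : ∀ x u v q → 𝓖 x u v q ≈ 𝓖 x u q v
    𝓖-swap-vq x u v q = ∑∞-cong _ _ (λ m → trans
      (∑-list-cong (permutations (suc m)) (λ π → *-congʳ (begin
        u ^ des π * x ^ ides π * q ^ lmin π * v ^ rmax π * 1# ^ lmax π
          ≈⟨ trans (*-congˡ (1^n≈1 (lmax π))) (*-identityʳ _) ⟩
        u ^ des π * x ^ ides π * q ^ lmin π * v ^ rmax π
          ≈⟨ trans (*-assoc _ _ _) (trans (*-congˡ (*-comm _ _)) (sym (*-assoc _ _ _))) ⟩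
        u ^ des π * x ^ ides π * v ^ rmax π * q ^ lmin π
          ∎)))
      (trans (∑-perm-reverseComplement (suc m) (λ (d , i , k , l) → u ^ d * x ^ i * v ^ k * q ^ l
          / ((1# - u) ^ suc m * (1# - x) ^ suc m)))
        (∑-list-cong (permutations (suc m)) (λ π → *-congʳ
          (sym (trans (*-congˡ (1^n≈1 (lmax π))) (*-identityʳ _)))))))
      where open SetoidReasoning setoid

    𝓖-swap-xu : ∀ x u v q → (∀ n → inverse ((1# - u) ^ n * (1# - x) ^ n) ≈ inverse ((1# - x) ^ n * (1# - u) ^ n)) →
      𝓖 x u v q ≈ 𝓖 u x v q
    𝓖-swap-xu x u v q inverse-comm = ∑∞-cong _ _ (λ m → trans
      (∑-list-cong (permutations (suc m)) (λ π → *-cong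
        (trans (*-congˡ (1^n≈1 (lmax π))) (trans (*-identityʳ _) (*-congʳ (*-congʳ (*-comm _ _)))))
        (inverse-comm (suc m))))
      (trans (∑-perm-flip (suc m) (λ (d , i , l , k) → x ^ d * u ^ i * q ^ l * v ^ k
          / ((1# - x) ^ suc m * (1# - u) ^ suc m)))
        (∑-list-cong (permutations (suc m)) (λ π → *-congʳ
          (sym (trans (*-congˡ (1^n≈1 (lmax π))) (*-identityʳ _)))))))

    symmetry-vq : 𝓖 x u v q ≈ 𝓖 x u q v
    symmetry-vq = 𝓖-swap-vq x u v q

    symmetry-xu : 𝓖 x u q v ≈ 𝓖 u x q v
    symmetry-xu = 𝓖-swap-xu x u q v (λ n → inverse-unique
      (inverse-one _ (Q.trans 1
        (*-cong-mod (^-one (minus-order u-order 1#) n) (^-one (minus-order x-order 1#) n))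
        (reduce (*-identityˡ 1#))))
      (trans (*-congʳ (*-comm _ _)) (inverse-one _ (Q.trans 1
        (*-cong-mod (^-one (minus-order x-order 1#) n) (^-one (minus-order u-order 1#) n))
        (reduce (*-identityˡ 1#))))))

-- The operations of a statement about S are parameters here, so that an
-- instance of this module yields the statement literally in terms of given
-- operations, which the type checker then need not unfold.
module Bridge {c ℓ : Level} {Carrier : Set c} (_≈_ : Carrier → Carrier → Set ℓ)
  (_+_ _*_ _-_ _/_ _/ₜ_ : Carrier → Carrier → Carrier) (-_ : Carrier → Carrier) (0# 1# : Carrier)
  (_^_ : Carrier → ℕ → Carrier)
  (isCommutativeRing : IsCommutativeRing _≈_ _+_ _*_ -_ 0# 1#)
  (F : Filtration (toBundle isCommutativeRing))
  where

  private
    S : CommutativeRing c ℓ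
    S = toBundle isCommutativeRing
  open CommutativeRing S using (refl; sym; trans; *-cong; *-congˡ; *-congʳ; +-cong; +-congˡ; +-congʳ; -‿cong; semiring)
  open SemiringExp semiring using () renaming (_^_ to _^ₛ_; ^-congˡ to ^ₛ-congˡ)
  open Filtration F using (_≈[_]_)
  open Words S using (∑<)
  open Standardisation S using (∑-perm; ∑-list-cong)
  open Resolvent S using (∏<; ∏<-cong)
  open Assembly S F using (negative; module Formula)

  module Theorem
    (∑∞ ∑ₙ≥₁ : (ℕ → Carrier) → Carrier)
    (∏[_] : ℕ → (ℕ → Carrier) → Carrier)
    (∑𝔖 : ∀ n → (Permutation′ n → Carrier) → Carrier)
    (inverse divideByT : Carrier → Carrier)
    (t u v q x r : Carrier)
    (factor : ℕ → Carrier)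
    (𝓖 : (t x u v q z : Carrier) → Carrier)
    (∑∞-mod : ∀ f → (∀ m → f m ≈[ m ] 0#) → ∀ D → ∑∞ f ≈[ D ] ∑< D f)
    (inverse-one : ∀ f → f ≈[ 1 ] 1# → (f * inverse f) ≈ 1#)
    (inverse-negative : ∀ n f → f ≈[ 1 ] negative n → (f * inverse f) ≈ 1#)
    (t-order : t ≈[ 1 ] 0#) (u-order : u ≈[ 1 ] 0#) (x-order : x ≈[ 1 ] 0#)
    (divideByT-* : ∀ f g → (t * f) ≈ g → divideByT g ≈ f)
    (cancel : ∀ f g → ((u * x) * f) ≈ ((u * x) * g) → f ≈ g)
    (inverse-cong : ∀ f g → f ≈ g → inverse f ≈ inverse g)
    (divideByT-cong : ∀ f g → f ≈ g → divideByT f ≈ divideByT g)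
    (∑ₙ≥₁-spec : ∀ f g → (∀ m → f (suc m) ≈ g m) → ∑ₙ≥₁ f ≈ ∑∞ g)
    (^-spec : ∀ f n → (f ^ n) ≈ (f ^ₛ n))
    (minus-spec : ∀ f g → (f - g) ≈ (f + (- g)))
    (/-spec : ∀ f g → (f / g) ≈ (f * inverse g))
    (/ₜ-spec : ∀ f g → (f /ₜ g) ≈ (divideByT f * inverse (divideByT g)))
    (∏-spec : ∀ n f → (∏[ suc n ] f) ≈ ∏< n (f ∘ suc))
    (∑𝔖-spec : ∀ n f → ∑𝔖 n f ≈ ∑-perm n f)
    (r-spec : r ≈ (1# - t))
    (factor-spec : ∀ i → factor (suc i) ≈
      (((u * ((x - (r ^ suc i)) - ((x * v) * t))) * ((((1# - (q * t)) * (r ^ i)) - 1#) /ₜ ((r ^ suc i) - 1#)))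
        / (x - (r ^ suc i))))
    (𝓖-spec : ∀ x u v q → 𝓖 t x u v q 1# ≈ ∑ₙ≥₁ (λ n → (t ^ n) * (∑𝔖 n (λ π →
      (((((u ^ des π) * (x ^ ides π)) * (q ^ lmin π)) * (v ^ rmax π)) * (1# ^ lmax π))
        / (((1# - u) ^ n) * ((1# - x) ^ n))))))
    where

    private
      module Fm = Formula ∑∞ ∑∞-mod inverse divideByT t u v q x inverse-one inverse-negative
        t-order u-order x-order divideByT-* cancel

      minus : ∀ {f f′ g g′} → f ≈ f′ → g ≈ g′ → (f - g) ≈ (f′ + (- g′))
      minus f≈ g≈ = trans (minus-spec _ _) (+-cong f≈ (-‿cong g≈))

      divide : ∀ {f f′ g g′} → f ≈ f′ → g ≈ g′ → (f / g) ≈ (f′ * inverse g′)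
      divide f≈ g≈ = trans (/-spec _ _) (*-cong f≈ (inverse-cong _ _ g≈))

      divideₜ : ∀ {f f′ g g′} → f ≈ f′ → g ≈ g′ → (f /ₜ g) ≈ (f′ Fm./ₜ g′)
      divideₜ f≈ g≈ = trans (/ₜ-spec _ _)
        (*-cong (divideByT-cong _ _ f≈) (inverse-cong _ _ (divideByT-cong _ _ g≈)))

      power : ∀ {f f′} → f ≈ f′ → ∀ n → (f ^ n) ≈ (f′ ^ₛ n)
      power f≈ n = trans (^-spec _ n) (^ₛ-congˡ n f≈)

      r≈ : r ≈ Fm.r
      r≈ = trans r-spec (minus-spec 1# t)

      r^ : ∀ n → (r ^ n) ≈ (Fm.r ^ₛ n)
      r^ = power r≈

      factor≈ : ∀ i → factor (suc i) ≈ Fm.factor (suc i)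
      factor≈ i = trans (factor-spec i) (divide
        (*-cong (*-congˡ (minus (minus refl (r^ (suc i))) refl))
          (divideₜ (minus (*-cong (minus refl refl) (r^ i)) refl) (minus (r^ (suc i)) refl)))
        (minus refl (r^ (suc i))))

      ∏≈ : ∀ m → (∏[ suc m ] factor) ≈ ∏< m (Fm.factor ∘ suc)
      ∏≈ m = trans (∏-spec m factor) (∏<-cong m factor≈)

      𝓖≈ : ∀ x u v q → 𝓖 t x u v q 1# ≈ Fm.𝓖 x u v q
      𝓖≈ x u v q = trans (𝓖-spec x u v q) (∑ₙ≥₁-spec _ _ (λ m → *-cong (^-spec t (suc m))
        (trans (∑𝔖-spec (suc m) _) (∑-list-cong (permutations (suc m)) (λ π → divide
          (*-cong (*-cong (*-cong (*-cong (^-spec u (des π)) (^-spec x (ides π))) (^-spec q (lmin π)))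
            (^-spec v (rmax π))) (^-spec 1# (lmax π)))
          (*-cong (power (minus-spec 1# u) (suc m)) (power (minus-spec 1# x) (suc m))))))))

    formula : 𝓖 t x u v q 1# ≈
      ((((v * t) / (1# - x))
        * (∑ₙ≥₁ (λ n → ((((q * x) - 1#) + ((1# - q) * (r ^ (n ∸ 1)))) / (x - (r ^ n))) * (∏[ n ] factor))))
        * (inverse (1# - (((u * (q - 1#)) / (x - 1#))
          * (∑ₙ≥₁ (λ n → (((((x - 1#) - (x * v)) * (r ^ (n ∸ 1))) + (x * v)) * (t /ₜ ((r ^ n) - 1#)))
              * (∏[ n ] factor)))))))
    formula = trans (𝓖≈ x u v q) (trans Fm.formula (sym (*-cong
      (*-cong (divide refl (minus refl refl))
        (∑ₙ≥₁-spec _ _ (λ m → *-cong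
          (divide (+-cong (minus refl refl) (*-cong (minus refl refl) (r^ m))) (minus refl (r^ (suc m))))
          (∏≈ m))))
      (inverse-cong _ _ (minus refl (*-cong (divide (*-congˡ (minus refl refl)) (minus refl refl))
        (∑ₙ≥₁-spec _ _ (λ m → *-cong
          (*-cong (+-congʳ (*-cong (minus (minus refl refl) refl) (r^ m)))
            (divideₜ refl (minus (r^ (suc m)) refl)))
          (∏≈ m)))))))))

    symmetry-vq : 𝓖 t x u v q 1# ≈ 𝓖 t x u q v 1#
    symmetry-vq = trans (𝓖≈ x u v q) (trans Fm.symmetry-vq (sym (𝓖≈ x u q v)))

    symmetry-xu : 𝓖 t x u q v 1# ≈ 𝓖 t u x q v 1#
    symmetry-xu = trans (𝓖≈ x u q v) (trans Fm.symmetry-xu (sym (𝓖≈ u x q v)))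

-- The ring of the theorem

module SeriesRing where

  ℚ[q,v]-isCommutativeRing : IsCommutative 𝔻.ℚ[q,v]
  ℚ[q,v]-isCommutativeRing = Polynomials.isCommutativeRing 𝔻.ℚ[q]
    (Polynomials.isCommutativeRing ℚ.+-*-rawRing ℚ.+-*-isCommutativeRing)

  ℚ[q,v]-ring : CommutativeRing 0ℓ 0ℓ
  ℚ[q,v]-ring = bundle 𝔻.ℚ[q,v] ℚ[q,v]-isCommutativeRing

  module ⟦t⟧ = PowerSeries 𝔻.ℚ[q,v] ℚ[q,v]-isCommutativeRing
  module ⟦x⟧ = PowerSeries 𝔻.ℚ[q,v]⟦t⟧ ⟦t⟧.isCommutativeRing
  module ⟦u⟧ = PowerSeries 𝔻.ℚ[q,v]⟦t,x⟧ ⟦x⟧.isCommutativeRing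

  seriesRing : CommutativeRing 0ℓ 0ℓ
  seriesRing = bundle 𝔻.ℚ[q,v]⟦t,x,u⟧ ⟦u⟧.isCommutativeRing

  filtration : Filtration seriesRing
  filtration = PowerSeriesFiltration.filtration 𝔻.ℚ[q,v]⟦t,x⟧ ⟦x⟧.isCommutativeRing
    (PowerSeriesFiltration.filtration 𝔻.ℚ[q,v]⟦t⟧ ⟦t⟧.isCommutativeRing
      (PowerSeriesFiltration.filtration 𝔻.ℚ[q,v] ℚ[q,v]-isCommutativeRing (discrete ℚ[q,v]-ring)))

  open Filtration filtration hiding (isEquivalence)
  open CommutativeRing seriesRing hiding (zero)
  open SemiringExp semiring
  open Words seriesRing
  module V  = CommutativeRing ℚ[q,v]-ring
  module VW = Words ℚ[q,v]-ring
  module VI = Inverses ℚ[q,v]-ring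

  -- Translates the three nested truncations into a bound on the total degree.
  degree< : ∀ D k j i → 0 < D ∸ k ∸ j ∸ i → k ℕ.+ j ℕ.+ i < D
  degree< D k j i 0<∸ = ℕ.≰⇒> λ D≤ → ℕ.<⇒≢ 0<∸ (≡.sym (≡.trans
    (≡.trans (≡.cong (_∸ i) (ℕ.∸-+-assoc D k j)) (ℕ.∸-+-assoc D (k ℕ.+ j) i)) (ℕ.m≤n⇒m∸n≡0 D≤)))

  <degree : ∀ D k j i → k ℕ.+ j ℕ.+ i < D → 0 < D ∸ k ∸ j ∸ i
  <degree D k j i lt = ≡.subst (0 <_) (≡.sym
    (≡.trans (≡.cong (_∸ i) (ℕ.∸-+-assoc D k j)) (ℕ.∸-+-assoc D (k ℕ.+ j) i))) (ℕ.m<n⇒0<n∸m lt)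

  ε : Carrier → V.Carrier
  ε f = f 0 0 0

  ε-mod : ∀ f g → ε f V.≈ ε g → f ≈[ 1 ] g
  ε-mod f g εf≈εg k j i lt = go k j i (degree< 1 k j i lt)
    where
    go : ∀ k j i → k ℕ.+ j ℕ.+ i < 1 → f k j i V.≈ g k j i
    go zero zero zero _ = εf≈εg
    go zero zero (suc i) (s≤s ())
    go zero (suc j) i (s≤s ())
    go (suc k) j i (s≤s ())

  ε-* : ∀ f g → ε (f * g) V.≈ ε f V.* ε g
  ε-* f g = V.trans {w V.+ V.0# V.+ V.0# V.+ V.0#} {w V.+ V.0# V.+ V.0#} {w} (V.+-identityʳ (w V.+ V.0# V.+ V.0#))
    (V.trans {w V.+ V.0# V.+ V.0#} {w V.+ V.0#} {w} (V.+-identityʳ (w V.+ V.0#)) (V.+-identityʳ w))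
    where w = ε f V.* ε g

  sum-coefficient : ∀ n (f : ℕ → Carrier) k j i → (∑< n f) k j i ≡ VW.∑< n (λ m → f m k j i)
  sum-coefficient zero    f k j i = ≡.refl
  sum-coefficient (suc n) f k j i = ≡.cong (f 0 k j i V.+_) (sum-coefficient n (f ∘ suc) k j i)

  -- The coefficient at `k j i` already sums the terms up to index `k + j + i`; the terms from there
  -- to `D` have too large an order to contribute.
  ∑∞-mod : ∀ f → (∀ m → f m ≈[ m ] 0#) → ∀ D → 𝔻.∑∞ f ≈[ D ] ∑< D f
  ∑∞-mod f order D k j i lt = V.trans
    {𝔻.∑∞ f k j i} {VW.∑< D (λ m → f m k j i)} {(∑< D f) k j i}
    (VI.∑<-extend (degree< D k j i lt) (λ m → f m k j i)
      (λ m d<m → order m k j i (<degree m k j i d<m)))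
    (V.reflexive {VW.∑< D (λ m → f m k j i)} (≡.sym (sum-coefficient D f k j i)))

  constant : ℚ → V.Carrier
  constant a = (a ∷ []) ∷ []

  constant-* : ∀ a b → constant (a ℚ.* b) V.≈ constant a V.* constant b
  constant-* a b zero    zero    = ≡.sym (ℚ.+-identityʳ (a ℚ.* b))
  constant-* a b zero    (suc m) = ≡.refl
  constant-* a b (suc n) m       = ≡.refl

  constant-+ : ∀ a b → constant (a ℚ.+ b) V.≈ constant a V.+ constant b
  constant-+ a b n m = ≡.refl

  inverseℚ-inverse : ∀ a → a ≢ 0ℚ → 𝔻.inverseℚ a ℚ.* a ≡ 1ℚ
  inverseℚ-inverse a a≢0 with a ℚ.≟ 0ℚ
  ... | yes a≡0 = contradiction a≡0 a≢0
  ... | no  a≢0 = ℚ.*-inverseˡ a {{ℚ.≢-nonZero a≢0}}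

  -- The coefficient of degree 0 is a polynomial in `q` and `v`. Only when it is a nonzero rational
  -- does division by the constant term bring `1 - b f` to order 1.
  inverse-inverse : ∀ f a → a ≢ 0ℚ → ε f V.≈ constant a → f * 𝔻.inverse f ≈ 1#
  inverse-inverse f a a≢0 εf≈a =
    FilteredInverse.inverse-geometric seriesRing filtration 𝔻.∑∞ ∑∞-mod b f
      (ε-mod (1# - b * f) 0# (V.trans {ε (1# - b * f)} {V.1# V.- V.1#} {V.0#} (V.+-congˡ {V.1#} {V.- ε (b * f)} {V.- V.1#} (V.-‿cong {ε (b * f)} {V.1#} ε-bf)) (V.-‿inverseʳ V.1#)))
    where
    b : Carrier
    b = 𝔻.scalar (𝔻.inverseℚ (𝔻.constantTerm f))

    constantTerm≡a : 𝔻.constantTerm f ≡ a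
    constantTerm≡a = εf≈a 0 0

    b₀ : V.Carrier
    b₀ = constant (𝔻.inverseℚ (𝔻.constantTerm f))

    ε-bf : ε (b * f) V.≈ V.1#
    ε-bf = V.trans {ε (b * f)} {b₀ V.* ε f} {V.1#} (ε-* b f)
      (V.trans {b₀ V.* ε f} {b₀ V.* constant a} {V.1#} (V.*-congˡ {b₀} {ε f} {constant a} εf≈a)
      (V.trans {b₀ V.* constant a} {constant (𝔻.inverseℚ (𝔻.constantTerm f) ℚ.* a)} {V.1#}
        (V.sym {constant (𝔻.inverseℚ (𝔻.constantTerm f) ℚ.* a)} {b₀ V.* constant a}
          (constant-* (𝔻.inverseℚ (𝔻.constantTerm f)) a))
        (V.reflexive (≡.cong constant (≡.trans (≡.cong (λ b → 𝔻.inverseℚ b ℚ.* a) constantTerm≡a)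
          (inverseℚ-inverse a a≢0))))))

  open Assembly seriesRing filtration using (negative)

  inverse-one : ∀ f → f ≈[ 1 ] 1# → f * 𝔻.inverse f ≈ 1#
  inverse-one f f≈1 = inverse-inverse f 1ℚ (λ ()) (f≈1 0 0 0 (s≤s z≤n))

  negativeℚ : ℕ → ℚ
  negativeℚ zero    = ℚ.- 1ℚ
  negativeℚ (suc n) = negativeℚ n ℚ.+ ℚ.- 1ℚ

  -- Being negative survives the subtraction of 1 and excludes zero.
  negativeℚ<0 : ∀ n → negativeℚ n ℚ.< 0ℚ
  negativeℚ<0 zero    = ℚ.negative⁻¹ (ℚ.- 1ℚ)
  negativeℚ<0 (suc n) = ℚ.+-mono-< (negativeℚ<0 n) (ℚ.negative⁻¹ (ℚ.- 1ℚ))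

  ε-negative : ∀ n → ε (negative n) V.≈ constant (negativeℚ n)
  ε-negative zero    = V.refl {constant (ℚ.- 1ℚ)}
  ε-negative (suc n) = V.trans {ε (negative n) V.+ constant (ℚ.- 1ℚ)} {constant (negativeℚ n) V.+ constant (ℚ.- 1ℚ)}
      {constant (negativeℚ (suc n))}
    (V.+-congʳ {constant (ℚ.- 1ℚ)} {ε (negative n)} {constant (negativeℚ n)} (ε-negative n))
    (V.sym {constant (negativeℚ (suc n))} {constant (negativeℚ n) V.+ constant (ℚ.- 1ℚ)}
      (constant-+ (negativeℚ n) (ℚ.- 1ℚ)))

  inverse-negative : ∀ n f → f ≈[ 1 ] negative n → f * 𝔻.inverse f ≈ 1#
  inverse-negative n f f≈ = inverse-inverse f (negativeℚ n) (ℚ.<⇒≢ (negativeℚ<0 n))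
    (V.trans {ε f} {ε (negative n)} {constant (negativeℚ n)} (f≈ 0 0 0 (s≤s z≤n)) (ε-negative n))

  t-order : 𝔻.t ≈[ 1 ] 0#
  t-order = ε-mod 𝔻.t 0# (V.refl {V.0#})

  u-order : 𝔻.u ≈[ 1 ] 0#
  u-order = ε-mod 𝔻.u 0# (V.refl {V.0#})

  x-order : 𝔻.x ≈[ 1 ] 0#
  x-order = ε-mod 𝔻.x 0# (V.refl {V.0#})

  divideByT-* : ∀ f g → 𝔻.t * f ≈ g → 𝔻.divideByT g ≈ f
  divideByT-* f g tf≈g k j i = V.trans {g k j (suc i)} {(𝔻.t * f) k j (suc i)} {f k j i}
    (V.sym {(𝔻.t * f) k j (suc i)} {g k j (suc i)} (tf≈g k j (suc i)))
    (V.trans {(𝔻.t * f) k j (suc i)} {(t₁ ⟦x⟧* f k) j (suc i)} {f k j i}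
      (⟦u⟧.constant-*ₛ t₁ f k j (suc i))
      (V.trans {(t₁ ⟦x⟧* f k) j (suc i)} {(t₂ ⟦t⟧* f k j) (suc i)} {f k j i}
        (⟦x⟧.constant-*ₛ t₂ (f k) j (suc i)) (⟦t⟧.variable-*ₛ (f k j) i)))
    where
    open RawRing 𝔻.ℚ[q,v]⟦t,x⟧ using () renaming (_*_ to _⟦x⟧*_)
    open RawRing 𝔻.ℚ[q,v]⟦t⟧ using () renaming (_*_ to _⟦t⟧*_)
    t₂ = 𝔻.varₛ 𝔻.ℚ[q,v]
    t₁ = 𝔻.constₛ 𝔻.ℚ[q,v]⟦t⟧ t₂

  -- Multiplication by `u * x` merely shifts the coefficients, so each coefficient of `f` can be
  -- read off from the product.
  cancel : ∀ f g → 𝔻.u * 𝔻.x * f ≈ 𝔻.u * 𝔻.x * g → f ≈ g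
  cancel f g uxf≈uxg k j i = V.trans {f k j i} {(𝔻.u * 𝔻.x * f) (suc k) (suc j) i} {g k j i}
    (V.sym {(𝔻.u * 𝔻.x * f) (suc k) (suc j) i} {f k j i} (shift f))
    (V.trans {(𝔻.u * 𝔻.x * f) (suc k) (suc j) i} {(𝔻.u * 𝔻.x * g) (suc k) (suc j) i} {g k j i}
      (uxf≈uxg (suc k) (suc j) i) (shift g))
    where
    open RawRing 𝔻.ℚ[q,v]⟦t,x⟧ using () renaming (_*_ to _⟦x⟧*_)
    x₁ = 𝔻.varₛ 𝔻.ℚ[q,v]⟦t⟧
    shift : ∀ f → (𝔻.u * 𝔻.x * f) (suc k) (suc j) i V.≈ f k j i
    shift f = V.trans {(𝔻.u * 𝔻.x * f) (suc k) (suc j) i} {(𝔻.u * (𝔻.x * f)) (suc k) (suc j) i} {f k j i}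
      (*-assoc 𝔻.u 𝔻.x f (suc k) (suc j) i)
      (V.trans {(𝔻.u * (𝔻.x * f)) (suc k) (suc j) i} {(𝔻.x * f) k (suc j) i} {f k j i}
        (⟦u⟧.variable-*ₛ (𝔻.x * f) k (suc j) i)
        (V.trans {(𝔻.x * f) k (suc j) i} {(x₁ ⟦x⟧* f k) (suc j) i} {f k j i}
          (⟦u⟧.constant-*ₛ x₁ f k (suc j) i) (⟦x⟧.variable-*ₛ (f k) j i)))

  ∑∞-cong : ∀ f g → (∀ m → f m ≈ g m) → 𝔻.∑∞ f ≈ 𝔻.∑∞ g
  ∑∞-cong f g f≈g k j i = VW.∑<-cong (suc (k ℕ.+ j ℕ.+ i)) {λ m → f m k j i} {λ m → g m k j i}
    (λ m _ → f≈g m k j i)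

  -- `inverse` depends on its argument also through a decision about the rational constant term; for
  -- equivalent series these rationals are identical, so the scalar can be transported.
  inverse-cong : ∀ f g → f ≈ g → 𝔻.inverse f ≈ 𝔻.inverse g
  inverse-cong f g f≈g = ≡.subst (λ c → 𝔻.inverse f ≈ b c * 𝔻.∑∞ ((1# - b c * g) ^_)) (f≈g 0 0 0 0 0)
    (FilteredInverse.inverse-geometric-cong seriesRing filtration 𝔻.∑∞ ∑∞-cong (b (𝔻.constantTerm f)) f g f≈g)
    where
    b : ℚ → Carrier
    b c = 𝔻.scalar (𝔻.inverseℚ c)

-- Equidistribution from sums of indicators

module Equidistribution where
  open Standardisation ℤ.+-*-commutativeRing
  open PermutationSums ℤ.+-*-commutativeRing

  ∑⇒equidistributed : ∀ n (S T : Permutation′ n → ℕ⁴) →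
    (∀ k → ∑-perm n (λ π → ind (S π ≟⁴ k)) ≡ ∑-perm n (λ π → ind (T π ≟⁴ k))) → Equidistributed n S T
  ∑⇒equidistributed n S T ∑≡∑ k = ℤ.+-injective (≡.trans
    (length-filter-∑ (λ π → S π ≟⁴ k) (permutations n))
    (≡.trans (∑≡∑ k) (≡.sym (length-filter-∑ (λ π → T π ≟⁴ k) (permutations n)))))

  equidistributed-reverseComplement : ∀ n →
    Equidistributed n (λ π → des π , ides π , rmax π , lmin π) (λ π → des π , ides π , lmin π , rmax π)
  equidistributed-reverseComplement n = ∑⇒equidistributed n
    (λ π → des π , ides π , rmax π , lmin π) (λ π → des π , ides π , lmin π , rmax π)
    (λ k → ∑-perm-reverseComplement n (λ s → ind (s ≟⁴ k)))

  equidistributed-flip : ∀ n →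
    Equidistributed n (λ π → des π , ides π , rmax π , lmin π) (λ π → ides π , des π , rmax π , lmin π)
  equidistributed-flip n = ∑⇒equidistributed n
    (λ π → des π , ides π , rmax π , lmin π) (λ π → ides π , des π , rmax π , lmin π)
    -- `∑-perm-flip` lists `lmin` before `rmax`; the pattern restores the order of the statement.
    (λ k → ≡.sym (∑-perm-flip n (λ (d , i , l , m) → ind ((d , i , m , l) ≟⁴ k))))

open import Data.Nat.Base using (ℕ; _∸_; _≤_)
open import Data.Product.Base using (_×_; _,_)
open import Defs

private
  module Ring = CommutativeRing SeriesRing.seriesRing

module SeriesBridge = Bridge _≈_ _+_ _*_ _-_ _/_ _/ₜ_ -_ 0# 1# _^_ SeriesRing.⟦u⟧.isCommutativeRing SeriesRing.filtration

module SeriesTheorem = SeriesBridge.Theorem ∑∞ ∑ₙ≥₁ ∏[_] ∑𝔖 inverse divideByT t u v q x r factor 𝓖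
  SeriesRing.∑∞-mod SeriesRing.inverse-one SeriesRing.inverse-negative SeriesRing.t-order SeriesRing.u-order SeriesRing.x-order
  SeriesRing.divideByT-* SeriesRing.cancel SeriesRing.inverse-cong
  (λ f g f≈g k j i → f≈g k j (suc i))
  (λ f g f≈g → SeriesRing.∑∞-cong (λ m → f (suc m)) g f≈g)
  (λ f n → Ring.refl {f ^ n})
  (λ f g → Ring.refl {f - g})
  (λ f g → Ring.refl {f / g})
  (λ f g → Ring.refl {f /ₜ g})
  (λ n f → Ring.refl {∏[ suc n ] f})
  (λ n f → Ring.refl {∑𝔖 n f})
  (Ring.refl {r})
  (λ i → Ring.refl {factor (suc i)})
  (λ x u v q → Ring.refl {𝓖 t x u v q 1#})

-- The operations on the last line are copies of those before.  The type checker
-- identifies closed expressions built from the one and from the other only by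
-- evaluating them, which is unfeasible for 𝓖; here each operation is compared
-- on its own.
restate :
  (P : (Series → Series → Set) → (_+_ _*_ : Series → Series → Series) → (Series → ℕ → Series) → Series → Set) →
  P (RawRing._≈_ ℚ[q,v]⟦t,x,u⟧) (RawRing._+_ ℚ[q,v]⟦t,x,u⟧) (RawRing._*_ ℚ[q,v]⟦t,x,u⟧)
    (RawSemiringDefs._^_ (RawRing.rawSemiring ℚ[q,v]⟦t,x,u⟧)) (RawRing.1# ℚ[q,v]⟦t,x,u⟧) →
  P _≈_ _+_ _*_ _^_ 1#
restate P p = p

theorem1 : (𝓖 t x u v q 1# ≈
    v * t / (1# - x)
    * ∑ₙ≥₁ (λ n →
    (q * x - 1# + (1# - q) * r ^ (n ∸ 1)) / (x - r ^ n) * ∏[ n ] factor)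
    * inverse
    (1# - u * (q - 1#) / (x - 1#)
    * ∑ₙ≥₁ (λ n →
    ((x - 1# - x * v) * r ^ (n ∸ 1) + x * v)
    * (t /ₜ (r ^ n - 1#)) * ∏[ n ] factor)))
    × (𝓖 t x u v q 1# ≈ 𝓖 t x u q v 1#)
    × (𝓖 t x u q v 1# ≈ 𝓖 t u x q v 1#)
    × (∀ (n : ℕ) → 1 ≤ n →
    Equidistributed n (λ π → des π , ides π , rmax π , lmin π)
    (λ π → des π , ides π , lmin π , rmax π)
    × Equidistributed n (λ π → des π , ides π , rmax π , lmin π)
    (λ π → ides π , des π , rmax π , lmin π))
theorem1 =
  let (formula , symmetry-vq , symmetry-xu) = restate (λ _≈_ _+_ _*_ _^_ 1# →
              (𝓖 t x u v q 1# ≈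
                ((((v * t) / (1# - x))
                  * (∑ₙ≥₁ (λ n → ((((q * x) - 1#) + ((1# - q) * (r ^ (n ∸ 1)))) / (x - (r ^ n))) * (∏[ n ] factor))))
                  * (inverse (1# - (((u * (q - 1#)) / (x - 1#))
                    * (∑ₙ≥₁ (λ n → (((((x - 1#) - (x * v)) * (r ^ (n ∸ 1))) + (x * v)) * (t /ₜ ((r ^ n) - 1#)))
                        * (∏[ n ] factor))))))))
              × (𝓖 t x u v q 1# ≈ 𝓖 t x u q v 1#)
              × (𝓖 t x u q v 1# ≈ 𝓖 t u x q v 1#))
            (SeriesTheorem.formula , SeriesTheorem.symmetry-vq , SeriesTheorem.symmetry-xu)
  in formula , symmetry-vq , symmetry-xu ,
     λ n _ → Equidistribution.equidistributed-reverseComplement n , Equidistribution.equidistributed-flip n
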